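{- If $L\subseteq\{0,1\}^*$ is a language decided by a $\mathrm{polylog}(n)$-time randomized Turing machine (allowing for two-sided error), then $L$ is also decided by a $\mathrm{polylog}(n)$-time deterministic Turing machine with a $\mathrm{quasipoly}(n)$-time preprocessing step, a one-time cost for all inputs of length $n$.
   Context: Turing machines are random access Turing machines (they can read any chosen input coordinate, so sublinear running times are meaningful); $n$ denotes the input length. Two-sided error means that on every input the randomized machine answers correctly with probability at least $2/3$. $\mathrm{polylog}(n)=(\log n)^{O(1)}$ and $\mathrm{quasipoly}(n)=2^{\mathrm{polylog}(n)}$. A preprocessing step is a deterministic computation that depends only on the input length $n$ (not on the input itself), is performed once for each $n$, and whose output is available (with random access) to the deterministic machine when it is run on any input of length $n$. -}

module Defs where

open import Data.Bool.Base using (Bool; true; false; if_then_else_)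
import Data.Bool.Properties as Bool
open import Data.Fin.Base using (Fin)
open import Data.List.Base as List using (List; []; _∷_; length; filter; cartesianProductWith; _ʳ++_)
open import Data.Maybe using (Maybe; just; nothing; Is-just)
import Data.Maybe.Properties as Maybe
open import Data.Nat.Base using (ℕ; zero; suc; _+_; _*_; _^_; _≤_)
open import Data.Nat.Logarithm using (⌊log₂_⌋)
open import Data.Product.Base using (Σ; ∃-syntax; _×_; _,_; proj₁; proj₂)
open import Data.Unit.Base using (⊤; tt)
open import Data.Vec.Base as Vec using (Vec; []; _∷_)
open import Function.Bundles using (_↔_)
open import Level using (Level; _⊔_; 0ℓ) renaming (suc to lsuc)
open import Relation.Binary.Definitions using (DecidableEquality)
open import Relation.Binary.PropositionalEquality using (_≡_)
open import Relation.Unary using (Pred; Decidable; _∈_; _∉_)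

private
  variable
    a p ℓ : Level
    A C : Set
    m k t : ℕ

Finite : Set → Set
Finite A = ∃[ n ] (A ↔ Fin n)

------------------------------------------------------------------------
-- Tapes

data Symbol (A : Set) : Set where
  blank : Symbol A
  bit   : Bool → Symbol A
  aux   : A → Symbol A

data Move : Set where
  left stay right : Move

-- A tape infinite to the right only.  `before` lists the cells to the left
-- of the head, nearest first; the cells beyond `after` are blank.
record Tape (A : Set) : Set where
  constructor tape
  field
    before  : List (Symbol A)
    scanned : Symbol A
    after   : List (Symbol A)

open Tape public

blankTape : Tape A
blankTape = tape [] blank []

write : Symbol A → Tape A → Tape A
write s (tape l _ r) = tape l s r

-- Moving left from the leftmost cell has no effect.
move : Move → Tape A → Tape A
move left  (tape []      s r)       = tape [] s r
move left  (tape (x ∷ l) s r)       = tape l x (s ∷ r)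
move stay  t                        = t
move right (tape l       s [])      = tape (s ∷ l) blank []
move right (tape l       s (x ∷ r)) = tape (s ∷ l) x r

leadingBits : List (Symbol A) → List Bool
leadingBits (bit b ∷ ss) = b ∷ leadingBits ss
leadingBits _            = []

-- The string on a tape: the bits from the leftmost cell up to (excluding)
-- the first cell that does not hold a bit.
contents : Tape A → List Bool
contents (tape l s r) = leadingBits (l ʳ++ (s ∷ r))

-- Binary value, least significant bit first.
value : List Bool → ℕ
value []       = 0
value (b ∷ bs) = (if b then 1 else 0) + 2 * value bs

-- `nothing` if the address is past the end of the string, so that a machine
-- can find the length of a string it has random access to.
_at_ : List Bool → ℕ → Maybe Bool
w at i = List.head (List.drop i w)

------------------------------------------------------------------------
-- Random access Turing machines

-- `C` is the type of choices fed to the machine, one per step: ⊤ for a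
-- deterministic machine, Bool (a fair coin) for a randomized one.
--
-- `m` is the number of read-only strings the machine has random access to.
-- The tapes are, in this order: m address tapes, one output tape, and
-- `work` work tapes.  In each step the machine sees, for every i < m, the
-- symbol of the i-th read-only string at the position written in binary on
-- the i-th address tape, together with the symbols scanned on its tapes.
record Machine (C : Set) (m : ℕ) : Set₁ where
  field
    State        : Set
    Aux          : Set
    state-finite : Finite State
    aux-finite   : Finite Aux
    work         : ℕ
    start        : State
    -- `just b` marks a halting state: accepting if b is true, else rejecting.
    halting      : State → Maybe Bool

  tapes : ℕ
  tapes = m + suc work

  field
    δ : State → C → Vec (Maybe Bool) m → Vec (Symbol Aux) tapes →
        State × Vec (Symbol Aux × Move) tapes

  record Config : Set where
    constructor config
    field
      state  : State
      tapeOf : Vec (Tape Aux) tapes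

  open Config public

  initial : Config
  initial = config start (Vec.replicate tapes blankTape)

  verdict : Config → Maybe Bool
  verdict c = halting (state c)

  output : Config → List Bool
  output c = contents (Vec.head (Vec.drop m (tapeOf c)))

  queried : Vec (List Bool) m → Config → Vec (Maybe Bool) m
  queried ws c =
    Vec.zipWith (λ w a → w at value (contents a)) ws (Vec.take m (tapeOf c))

  act : Symbol Aux × Move → Tape Aux → Tape Aux
  act (s , d) t = move d (write s t)

  step : Vec (List Bool) m → Config → C → Config
  step ws c r with verdict c
  ... | just _  = c
  ... | nothing =
    let (q , actions) = δ (state c) r (queried ws c) (Vec.map scanned (tapeOf c))
    in  config q (Vec.zipWith act actions (tapeOf c))

  run : Vec (List Bool) m → Vec C t → Config
  run ws rs = Vec.foldl′ (step ws) initial rs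

DeterministicTM RandomizedTM : ℕ → Set₁
DeterministicTM = Machine ⊤
RandomizedTM    = Machine Bool

runFor : (M : DeterministicTM m) → ℕ → Vec (List Bool) m → Machine.Config M
runFor M t ws = Machine.run M ws (Vec.replicate t tt)

------------------------------------------------------------------------
-- Growth rates

-- (log n)^O(1)
Polylog : (ℕ → ℕ) → Set
Polylog T = ∃[ c ] ∃[ n₀ ] (∀ n → n₀ ≤ n → T n ≤ ⌊log₂ n ⌋ ^ c)

-- 2^polylog(n)
Quasipoly : (ℕ → ℕ) → Set
Quasipoly T = ∃[ e ] (Polylog e × (∀ n → T n ≤ 2 ^ e n))

------------------------------------------------------------------------
-- Deciding languages

Language : (ℓ : Level) → Set (lsuc ℓ)
Language ℓ = Pred (List Bool) ℓ

_≟ᵛ_ : DecidableEquality (Maybe Bool)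
_≟ᵛ_ = Maybe.≡-dec Bool._≟_

coinTosses : (t : ℕ) → List (Vec Bool t)
coinTosses zero    = [] ∷ []
coinTosses (suc t) = cartesianProductWith _∷_ (true ∷ false ∷ []) (coinTosses t)

-- Under the uniform distribution on the entries of Ω, P has probability at
-- least 2/3.
LikelyOn : {A : Set a} {P : Pred A p} → List A → Decidable P → Set
LikelyOn Ω P? = 2 * length Ω ≤ 3 * length (filter P? Ω)

-- M decides L with two-sided error: on inputs of length n it halts within
-- T n steps whatever its coin tosses.
record DecidesRandomized (M : RandomizedTM 1) (T : ℕ → ℕ) (L : Language ℓ) : Set ℓ where
  open Machine M

  result : (x : List Bool) → Vec Bool (T (length x)) → Maybe Bool
  result x ω = verdict (run (x ∷ []) ω)

  Answers : Bool → List Bool → Set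
  Answers b x = LikelyOn (coinTosses (T (length x))) (λ ω → result x ω ≟ᵛ just b)

  field
    halts   : ∀ x ω → Is-just (result x ω)
    accepts : ∀ x → x ∈ L → Answers true x
    rejects : ∀ x → x ∉ L → Answers false x

-- Computing `advice` from the length n alone.  The preprocessing machine
-- is given n as random access to the string 1ⁿ.
record Preprocesses (P : DeterministicTM 1) (Q : ℕ → ℕ) (advice : ℕ → List Bool) : Set where
  open Machine P

  final : ℕ → Config
  final n = runFor P (Q n) (List.replicate n true ∷ [])

  field
    halts   : ∀ n → Is-just (verdict (final n))
    outputs : ∀ n → output (final n) ≡ advice n

-- The first read-only string of D is the input, the second the advice for
-- its length.
record DecidesWithAdvice (D : DeterministicTM 2) (T : ℕ → ℕ)
                         (advice : ℕ → List Bool) (L : Language ℓ) : Set ℓ where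
  open Machine D

  result : List Bool → Maybe Bool
  result x = verdict (runFor D (T (length x)) (x ∷ advice (length x) ∷ []))

  field
    halts   : ∀ x → Is-just (result x)
    accepts : ∀ x → x ∈ L → result x ≡ just true
    rejects : ∀ x → x ∉ L → result x ≡ just false

PolylogRandomized : Language ℓ → Set (lsuc 0ℓ ⊔ ℓ)
PolylogRandomized L =
  Σ (RandomizedTM 1) λ M → ∃[ T ] (Polylog T × DecidesRandomized M T L)

PolylogWithQuasipolyPreprocessing : Language ℓ → Set (lsuc 0ℓ ⊔ ℓ)
PolylogWithQuasipolyPreprocessing L =
  Σ (DeterministicTM 1) λ P → Σ (DeterministicTM 2) λ D →
  ∃[ Q ] ∃[ T ] ∃[ advice ]
    (Quasipoly Q × Preprocesses P Q advice ×
     Polylog T × DecidesWithAdvice D T advice L)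

{-# OPTIONS --safe #-}

-- On inputs of length n, a polylog-time randomized machine is a randomized
-- decision tree of polylog depth d for some function f.  By double counting, an
-- input has at most 3d disjoint sensitive blocks, hence a certificate of size
-- 9d²; and since certificates of 0-inputs meet those of 1-inputs, f has a
-- deterministic decision tree of polylog depth.
--
-- This tree is found by way of a game.  An existential player names L positions,
-- being told a bit for each, and then a universal player sets L further
-- positions to bits of his choice; all other bits are 0.  The existential player
-- wins if f takes the same value whatever the universal player does.  A decision
-- tree of depth L for f is a winning strategy.  Conversely, if the bits told are
-- those of x and the game is won, then the value reached is f x, because the
-- universal player could have had the path of x in the decision tree queried.
-- The game has quasipolynomially many plays, each of which is evaluated by trying
-- all coin tosses, so the winning moves can be tabulated in advance.
module Submission where

open import Defs
open import Level using (Level)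
open import Data.Bool.Base using (Bool; true; false; if_then_else_; not; _∧_; _∨_)
import Data.Bool.Properties as Bool
open import Data.Empty using (⊥-elim)
open import Data.Fin.Base as Fin using (Fin; zero; suc; toℕ; fromℕ<)
import Data.Fin.Properties as Fin
open import Data.List.Base as List using (List; []; _∷_; _++_; length; map; replicate; _ʳ++_; foldr; filter)
import Data.List.Properties as List
open import Data.List.Membership.Propositional using (_∈_)
open import Data.List.Membership.Propositional.Properties using (∈-filter⁺; ∈-filter⁻; ∈-allFin; ∈-++⁺ˡ; ∈-++⁺ʳ)
open import Data.List.Membership.DecPropositional using (_∈?_)
open import Data.List.Relation.Unary.All as All using (All; []; _∷_)
import Data.List.Relation.Unary.All.Properties as All
open import Data.List.Relation.Unary.Any using (here; there)
open import Data.List.Relation.Unary.AllPairs using ([]; _∷_)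
open import Data.List.Relation.Unary.Unique.Propositional using (Unique)
import Data.List.Relation.Unary.Unique.Propositional.Properties as Unique
open import Data.Maybe.Base as Maybe using (Maybe; just; nothing; maybe; fromMaybe)
open import Data.Maybe using (Is-just)
import Data.Maybe.Relation.Unary.Any as MaybeAny
open import Data.Nat.Base
open import Data.Nat.Logarithm using (⌊log₂_⌋; ⌊log₂⌋-mono-≤; ⌊log₂[2^n]⌋≡n)
open import Data.Nat.Properties
open import Data.Product.Base using (Σ; ∃; ∃-syntax; _×_; _,_; proj₁; proj₂; map₁; map₂; uncurry)
open import Data.Product.Function.NonDependent.Propositional using (_×-↔_)
open import Data.Sum.Base using (_⊎_; inj₁; inj₂)
open import Data.Sum.Function.Propositional using (_⊎-↔_)
open import Data.Unit.Base using (⊤; tt)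
open import Data.Vec.Base as Vec using (Vec; []; _∷_)
import Data.Vec.Properties as Vec
open import Data.Vec.Relation.Unary.All as VecAll using ([]; _∷_)
open import Function.Base using (_∘_; id; case_of_)
open import Function.Bundles using (mk↔ₛ′)
open import Function.Properties.Inverse using (↔-sym; ↔-trans)
open import Relation.Binary.PropositionalEquality
open import Relation.Nullary using (¬_; Dec; yes; no; does; contradiction; ¬?; _×-dec_)
open import Relation.Nullary.Decidable using (map′; dec-true; dec-false)

-- Tapes up to trailing blanks

-- Two tapes that differ only in blanks at the far end of `after` behave alike.
-- The operations marked ᵗ never store such blanks, so that erasing a cell
-- restores the tape exactly.

-- Preprocessing cannot test a candidate decision tree against all 2^n inputs. The game avoids this:
-- a play is a string of polylogarithmically many bits, describing an input whose unnamed bits are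
-- all 0, so f is evaluated on quasipolynomially many inputs only. Such an input may be unrelated to
-- the one to be decided. This is why it matters that the error bound holds on every input: f is
-- then total, and the passage from certificates to a decision tree relies on totality.
--
-- The running time T is known only through a bound, and nothing says that T can be computed. The
-- preprocessing machine therefore works with a number L ≥ T n that is a constant power of the
-- number of digits of n plus a constant; surplus coins do no harm, since a halted machine ignores
-- them. The same L serves as number of rounds, as length of an index and as number of tosses, so
-- that one number has to be computed.
--
-- Both machines have to be given concretely. They are written in a small language of commands with
-- costs, which is compiled into Turing machines once and for all.

module _ {A : Set} where

  infixr 5 _∷ᵗ_

  _∷ᵗ_ : Symbol A → List (Symbol A) → List (Symbol A)
  blank ∷ᵗ []      = []
  blank ∷ᵗ (x ∷ r) = blank ∷ x ∷ r
  bit b ∷ᵗ r       = bit b ∷ r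
  aux a ∷ᵗ r       = aux a ∷ r

  trim : List (Symbol A) → List (Symbol A)
  trim = foldr _∷ᵗ_ []

  moveᵗ : Move → Tape A → Tape A
  moveᵗ left  (tape []      s r)       = tape [] s r
  moveᵗ left  (tape (x ∷ l) s r)       = tape l x (s ∷ᵗ r)
  moveᵗ stay  t                        = t
  moveᵗ right (tape l       s [])      = tape (s ∷ l) blank []
  moveᵗ right (tape l       s (x ∷ r)) = tape (s ∷ l) x r

  actᵗ : Symbol A × Move → Tape A → Tape A
  actᵗ (s , d) t = moveᵗ d (write s t)

  normal : Tape A → Tape A
  normal (tape l s r) = tape l s (trim r)

  normal-move : ∀ d t → normal (move d t) ≡ moveᵗ d (normal t)
  normal-move left  (tape []      s r) = refl
  normal-move left  (tape (x ∷ l) s r) = refl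
  normal-move stay  t                  = refl
  normal-move right (tape l s [])      = refl
  -- If `x` is blank and all cells after it trim away, the trimmed tape has no cell to the right;
  -- the head then steps onto a fresh blank, which is what `x` was.
  normal-move right (tape l s (x ∷ r)) with x | trim r
  ... | blank | []     = refl
  ... | blank | _ ∷ _  = refl
  ... | bit _ | _      = refl
  ... | aux _ | _      = refl

  leadingBits-∷ᵗ : ∀ s (r : List (Symbol A)) → leadingBits (s ∷ᵗ r) ≡ leadingBits (s ∷ r)
  leadingBits-∷ᵗ blank   []      = refl
  leadingBits-∷ᵗ blank   (_ ∷ _) = refl
  leadingBits-∷ᵗ (bit b) r       = refl
  leadingBits-∷ᵗ (aux a) r       = refl

  leadingBits-cong : ∀ s {r r′ : List (Symbol A)} → leadingBits r ≡ leadingBits r′ →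
                     leadingBits (s ∷ r) ≡ leadingBits (s ∷ r′)
  leadingBits-cong blank   eq = refl
  leadingBits-cong (bit b) eq = cong (b ∷_) eq
  leadingBits-cong (aux a) eq = refl

  leadingBits-ʳ++ : ∀ (l : List (Symbol A)) {r r′} → leadingBits r ≡ leadingBits r′ →
                    leadingBits (l ʳ++ r) ≡ leadingBits (l ʳ++ r′)
  leadingBits-ʳ++ []      eq = eq
  leadingBits-ʳ++ (s ∷ l) eq = leadingBits-ʳ++ l (leadingBits-cong s eq)

  leadingBits-trim : ∀ (r : List (Symbol A)) → leadingBits (trim r) ≡ leadingBits r
  leadingBits-trim []      = refl
  leadingBits-trim (s ∷ r) =
    trans (leadingBits-∷ᵗ s (trim r)) (leadingBits-cong s (leadingBits-trim r))

  contents-normal : ∀ (t : Tape A) → contents (normal t) ≡ contents t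
  contents-normal (tape l s r) = leadingBits-ʳ++ l (leadingBits-cong s (leadingBits-trim r))

module _ {A B : Set} (f : A → B) where

  mapSymbol : Symbol A → Symbol B
  mapSymbol blank   = blank
  mapSymbol (bit b) = bit b
  mapSymbol (aux a) = aux (f a)

  mapTape : Tape A → Tape B
  mapTape (tape l s r) = tape (map mapSymbol l) (mapSymbol s) (map mapSymbol r)

  mapSymbol-∷ᵗ : ∀ s r → map mapSymbol (s ∷ᵗ r) ≡ mapSymbol s ∷ᵗ map mapSymbol r
  mapSymbol-∷ᵗ blank   []      = refl
  mapSymbol-∷ᵗ blank   (_ ∷ _) = refl
  mapSymbol-∷ᵗ (bit b) r       = refl
  mapSymbol-∷ᵗ (aux a) r       = refl

  mapTape-move : ∀ d t → mapTape (moveᵗ d t) ≡ moveᵗ d (mapTape t)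
  mapTape-move left  (tape []      s r) = refl
  mapTape-move left  (tape (x ∷ l) s r) = cong (tape _ _) (mapSymbol-∷ᵗ s r)
  mapTape-move stay  t                  = refl
  mapTape-move right (tape l s [])      = refl
  mapTape-move right (tape l s (x ∷ r)) = refl

  leadingBits-map : ∀ r → leadingBits (map mapSymbol r) ≡ leadingBits r
  leadingBits-map []          = refl
  leadingBits-map (blank ∷ r) = refl
  leadingBits-map (bit b ∷ r) = cong (b ∷_) (leadingBits-map r)
  leadingBits-map (aux a ∷ r) = refl

  contents-map : ∀ t → contents (mapTape t) ≡ contents t
  contents-map (tape l s r) =
    trans (cong leadingBits (sym (List.map-ʳ++ mapSymbol l))) (leadingBits-map (l ʳ++ (s ∷ r)))

-- Finite types

Finite-⊤ : Finite ⊤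
Finite-⊤ = 1 , ↔-sym Fin.1↔⊤

Finite-Bool : Finite Bool
Finite-Bool = 2 , ↔-sym Fin.2↔Bool

Finite-⊎ : ∀ {A B} → Finite A → Finite B → Finite (A ⊎ B)
Finite-⊎ (_ , f) (_ , g) = _ , ↔-trans (f ⊎-↔ g) (↔-sym Fin.+↔⊎)

Finite-× : ∀ {A B} → Finite A → Finite B → Finite (A × B)
Finite-× (_ , f) (_ , g) = _ , ↔-trans (f ×-↔ g) (↔-sym Fin.*↔×)

Finite-Maybe : ∀ {A} → Finite A → Finite (Maybe A)
Finite-Maybe f with Finite-⊎ Finite-⊤ f
... | _ , g = _ , ↔-trans Maybe↔⊎ g
  where
  Maybe↔⊎ = mk↔ₛ′ (maybe inj₂ (inj₁ tt)) (λ { (inj₁ _) → nothing ; (inj₂ a) → just a })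
                  (λ { (inj₁ _) → refl ; (inj₂ _) → refl })
                  (λ { nothing → refl ; (just _) → refl })

-- A structured language for Turing machines

opaque

  -- Opaque, so that its arguments can be found by unification.
  loop : ℕ → ℕ → ℕ
  loop b j = j * suc b + 1

  loop-zero : ∀ b → 1 ≡ loop b 0
  loop-zero b = refl

  loop-suc : ∀ b j → suc (b + loop b j) ≡ loop b (suc j)
  loop-suc b j = cong suc (sym (+-assoc b (j * suc b) 1))

  loop-mono : ∀ b {i j} → i ≤ j → loop b i ≤ loop b j
  loop-mono b le = +-monoˡ-≤ 1 (*-monoˡ-≤ (suc b) le)

  loop-≡ : ∀ b j → loop b j ≡ j * suc b + 1
  loop-≡ b j = refl

module Language (m : ℕ) (A : Set) (w : ℕ) where

  infixr 4 _⨟_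

  Sym : Set
  Sym = Symbol A

  k : ℕ
  k = m + suc w

  Store Reads Scan Actions : Set
  Store   = Vec (Tape A) k
  Reads   = Vec (Maybe Bool) m
  Scan    = Vec Sym k
  Actions = Vec (Sym × Move) k

  data Cmd : Set where
    exec   : (Reads → Scan → Actions) → Cmd
    _⨟_    : Cmd → Cmd → Cmd
    branch : (Reads → Scan → Bool) → Cmd → Cmd → Cmd
    while  : (Reads → Scan → Bool) → Cmd → Cmd

  idle : Scan → Actions
  idle = Vec.map (_, stay)

  upd : Fin k → (Reads → Scan → Sym × Move) → Cmd
  upd j F = exec (λ r s → Vec.updateAt (idle s) j (λ _ → F r s))

  skip : Cmd
  skip = exec (λ _ → idle)

  scans : Store → Scan
  scans = Vec.map scanned

  perform : Actions → Store → Store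
  perform = Vec.zipWith actᵗ

  module Semantics (ws : Vec (List Bool) m) where

    reads : Store → Reads
    reads σ = Vec.zipWith (λ w a → w at value (contents a)) ws (Vec.take m σ)

    -- The number of steps is an upper bound only.
    data Exec : Cmd → Store → Store → ℕ → Set where
      exec⇓  : ∀ {F σ τ} → perform (F (reads σ) (scans σ)) σ ≡ τ → Exec (exec F) σ τ 1
      _⨟⇓_   : ∀ {c d σ τ υ n n′} → Exec c σ τ n → Exec d τ υ n′ → Exec (c ⨟ d) σ υ (n + n′)
      then⇓  : ∀ {p c d σ τ n} → p (reads σ) (scans σ) ≡ true →
               Exec c σ τ n → Exec (branch p c d) σ τ (suc n)
      else⇓  : ∀ {p c d σ τ n} → p (reads σ) (scans σ) ≡ false →
               Exec d σ τ n → Exec (branch p c d) σ τ (suc n)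
      stop⇓  : ∀ {p c σ} → p (reads σ) (scans σ) ≡ false → Exec (while p c) σ σ 1
      go⇓    : ∀ {p c σ τ υ n n′} → p (reads σ) (scans σ) ≡ true →
               Exec c σ τ n → Exec (while p c) τ υ n′ → Exec (while p c) σ υ (suc (n + n′))
      weaken : ∀ {c σ τ n n′} → n ≤ n′ → Exec c σ τ n → Exec c σ τ n′

    infixr 4 _⨟⇓_

    starts-in : ∀ {c σ σ′ τ n} → σ ≡ σ′ → Exec c σ τ n → Exec c σ′ τ n
    starts-in refl e = e

    ends-in : ∀ {c σ τ τ′ n} → τ ≡ τ′ → Exec c σ τ n → Exec c σ τ′ n
    ends-in refl e = e

    takes : ∀ {c σ τ n n′} → n ≡ n′ → Exec c σ τ n → Exec c σ τ n′
    takes refl e = e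

    -- `loop b j` charges each of `j` iterations `b` steps plus one for the test, and one more step
    -- for the final test that fails.
    again : ∀ {p c σ τ υ b j} → p (reads σ) (scans σ) ≡ true → Exec c σ τ b →
            Exec (while p c) τ υ (loop b j) → Exec (while p c) σ υ (loop b (suc j))
    again {b = b} {j} t e e′ = takes (loop-suc b j) (go⇓ t e e′)

    finish : ∀ {p c σ b} → p (reads σ) (scans σ) ≡ false → Exec (while p c) σ σ (loop b 0)
    finish {b = b} t = takes (loop-zero b) (stop⇓ t)

    perform-idle : ∀ {n} (σ : Vec (Tape A) n) →
                   Vec.zipWith actᵗ (Vec.map (_, stay) (Vec.map scanned σ)) σ ≡ σ
    perform-idle []      = refl
    perform-idle (t ∷ σ) = cong (t ∷_) (perform-idle σ)

    skip⇓ : ∀ {σ} → Exec skip σ σ 1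
    skip⇓ {σ} = exec⇓ (perform-idle σ)

    perform-upd : ∀ {n} (σ : Vec (Tape A) n) j a →
                  Vec.zipWith actᵗ (Vec.updateAt (Vec.map (_, stay) (Vec.map scanned σ)) j (λ _ → a)) σ
                  ≡ Vec.updateAt σ j (actᵗ a)
    perform-upd (t ∷ σ) zero    a = cong (actᵗ a t ∷_) (perform-idle σ)
    perform-upd (t ∷ σ) (suc j) a = cong (t ∷_) (perform-upd σ j a)

    upd⇓ : ∀ {j F σ τ} → Vec.updateAt σ j (actᵗ (F (reads σ) (scans σ))) ≡ τ →
           Exec (upd j F) σ τ 1
    upd⇓ {j} {F} {σ} eq = exec⇓ (trans (perform-upd σ j _) eq)

  -- Compilation

  -- A point is where control rests before its next machine step. The `nothing` of `branch` and
  -- `while` is their test. Sequencing has no point of its own: the last step of the first command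
  -- leads straight to the entry of the second, so that costs simply add up.
  Point : Cmd → Set
  Point (exec F)       = ⊤
  Point (c ⨟ d)        = Point c ⊎ Point d
  Point (branch p c d) = Maybe (Point c ⊎ Point d)
  Point (while p c)    = Maybe (Point c)

  entry : ∀ c → Point c
  entry (exec F)       = tt
  entry (c ⨟ d)        = inj₁ (entry c)
  entry (branch p c d) = nothing
  entry (while p c)    = nothing

  Finite-Point : ∀ c → Finite (Point c)
  Finite-Point (exec F)       = Finite-⊤
  Finite-Point (c ⨟ d)        = Finite-⊎ (Finite-Point c) (Finite-Point d)
  Finite-Point (branch p c d) = Finite-Maybe (Finite-⊎ (Finite-Point c) (Finite-Point d))
  Finite-Point (while p c)    = Finite-Maybe (Finite-Point c)

  -- `nothing` as a next point means that the command has been left.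
  next : ∀ c → Point c → Reads → Scan → Maybe (Point c) × Actions
  next (exec F)       tt              r s = nothing , F r s
  next (c ⨟ d)        (inj₁ x)        r s = map₁ (maybe (just ∘ inj₁) (just (inj₂ (entry d)))) (next c x r s)
  next (c ⨟ d)        (inj₂ x)        r s = map₁ (maybe (just ∘ inj₂) nothing) (next d x r s)
  next (branch p c d) nothing         r s = just (just (if p r s then inj₁ (entry c) else inj₂ (entry d))) ,
    idle s
  next (branch p c d) (just (inj₁ x)) r s = map₁ (maybe (just ∘ just ∘ inj₁) nothing) (next c x r s)
  next (branch p c d) (just (inj₂ x)) r s = map₁ (maybe (just ∘ just ∘ inj₂) nothing) (next d x r s)
  next (while p c)    nothing         r s = (if p r s then just (just (entry c)) else nothing) , idle s
  next (while p c)    (just x)        r s = map₁ (maybe (just ∘ just) (just nothing)) (next c x r s)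

  module _ (c : Cmd) (A-finite : Finite A) (v : Reads → Scan → Bool) where

    -- The verdict is read off the tapes in one extra step after the command has been left. This is
    -- why `compile-correct` asks for strictly more steps than the command takes.
    resume : Maybe (Point c) ⊎ Bool → Reads → Scan → (Maybe (Point c) ⊎ Bool) × Actions
    resume (inj₁ (just x)) r s = map₁ inj₁ (next c x r s)
    resume (inj₁ nothing)  r s = inj₂ (v r s) , idle s
    resume (inj₂ b)        r s = inj₂ b , idle s

    halted : Maybe (Point c) ⊎ Bool → Maybe Bool
    halted (inj₁ _) = nothing
    halted (inj₂ b) = just b

    compile : DeterministicTM m
    compile = record
      { State        = Maybe (Point c) ⊎ Bool
      ; Aux          = A
      ; state-finite = Finite-⊎ (Finite-Maybe (Finite-Point c)) Finite-Bool
      ; aux-finite   = A-finite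
      ; work         = w
      ; start        = inj₁ (just (entry c))
      ; halting      = halted
      ; δ            = λ q _ → resume q
      }

  -- Correctness of the compilation

  module Correctness (ws : Vec (List Bool) m) where

    open Semantics ws

    data Steps (c : Cmd) : Maybe (Point c) → Store → ℕ → Maybe (Point c) → Store → Set where
      done : ∀ {x σ} → Steps c x σ 0 x σ
      more : ∀ {x σ y τ n} →
             Steps c (proj₁ (next c x (reads σ) (scans σ)))
                     (perform (proj₂ (next c x (reads σ) (scans σ))) σ) n y τ →
             Steps c (just x) σ (suc n) y τ

    Steps-trans : ∀ {c x σ y τ z υ n n′} → Steps c x σ n y τ → Steps c y τ n′ z υ →
                  Steps c x σ (n + n′) z υ
    Steps-trans done     s′ = s′
    Steps-trans (more s) s′ = more (Steps-trans s s′)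

    -- h embeds the points of c into those of c′, and e is where c′ continues
    -- after c has been left.
    Steps-embed : ∀ {c c′} (h : Point c → Point c′) (e : Maybe (Point c′)) →
                  (∀ x r s → next c′ (h x) r s ≡ map₁ (maybe (just ∘ h) e) (next c x r s)) →
                  ∀ {x σ n τ} → Steps c x σ n nothing τ →
                  Steps c′ (maybe (just ∘ h) e x) σ n e τ
    Steps-embed h e sim done = done
    Steps-embed {c} {c′} h e sim {σ = σ} {τ = τ} (more {x} {n = n} s) =
      more (subst (λ z → Steps c′ (proj₁ z) (perform (proj₂ z) σ) n e τ)
                  (sym (sim x (reads σ) (scans σ))) (Steps-embed h e sim s))

    test-step : ∀ {c x y σ} → next c x (reads σ) (scans σ) ≡ (y , idle (scans σ)) →
                Steps c (just x) σ 1 y σ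
    test-step {c} {σ = σ} eq = more (subst (λ z → Steps c (proj₁ z) (perform (proj₂ z) σ) 0 _ σ) (sym eq)
      (subst (λ τ → Steps c _ τ 0 _ σ) (sym (perform-idle σ)) done))

    sound : ∀ {c σ τ n} → Exec c σ τ n → ∃[ n′ ] (n′ ≤ n × Steps c (just (entry c)) σ n′ nothing τ)
    sound (exec⇓ refl) = 1 , ≤-refl , more done
    sound (e ⨟⇓ e′) with sound e | sound e′
    ... | _ , le , s | _ , le′ , s′ =
      _ , +-mono-≤ le le′ ,
      Steps-trans (Steps-embed inj₁ _ (λ _ _ _ → refl) s) (Steps-embed inj₂ nothing (λ _ _ _ → refl) s′)
    sound (then⇓ {p} {c} {d} t e) with sound e
    ... | _ , le , s = _ , s≤s le ,
      Steps-trans (test-step (cong (λ b → just (just (if b then inj₁ (entry c) else inj₂ (entry d))) , _) t))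
                  (Steps-embed (just ∘ inj₁) nothing (λ _ _ _ → refl) s)
    sound (else⇓ {p} {c} {d} t e) with sound e
    ... | _ , le , s = _ , s≤s le ,
      Steps-trans (test-step (cong (λ b → just (just (if b then inj₁ (entry c) else inj₂ (entry d))) , _) t))
                  (Steps-embed (just ∘ inj₂) nothing (λ _ _ _ → refl) s)
    sound (stop⇓ {p} {c} t) =
      1 , ≤-refl , test-step (cong (λ b → (if b then just (just (entry c)) else nothing) , _) t)
    sound (go⇓ {p} {c} t e e′) with sound e | sound e′
    ... | _ , le , s | _ , le′ , s′ = _ , s≤s (+-mono-≤ le le′) ,
      Steps-trans (test-step (cong (λ b → (if b then just (just (entry c)) else nothing) , _) t))
        (Steps-trans (Steps-embed just (just nothing) (λ _ _ _ → refl) s) s′)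
    sound (weaken le e) with sound e
    ... | _ , le′ , s = _ , ≤-trans le′ le , s

    module _ (c : Cmd) (A-finite : Finite A) (v : Reads → Scan → Bool) where

      open Machine (compile c A-finite v) hiding (State; Aux)

      normals : Vec (Tape A) k → Store
      normals = Vec.map normal

      scans-normals : ∀ {n} (ts : Vec (Tape A) n) → Vec.map scanned (Vec.map normal ts) ≡ Vec.map scanned ts
      scans-normals []       = refl
      scans-normals (t ∷ ts) = cong (scanned t ∷_) (scans-normals ts)

      perform-normals : ∀ {n} as (ts : Vec (Tape A) n) →
                        Vec.map normal (Vec.zipWith act as ts) ≡ Vec.zipWith actᵗ as (Vec.map normal ts)
      perform-normals []             []       = refl
      perform-normals ((s , d) ∷ as) (t ∷ ts) = cong₂ _∷_ (normal-move d (write s t)) (perform-normals as ts)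

      reads-normals : ∀ {n n′} (us : Vec (List Bool) n) (ts : Vec (Tape A) (n + n′)) →
                      Vec.zipWith (λ w a → w at value (contents a)) us (Vec.take n (Vec.map normal ts))
                      ≡ Vec.zipWith (λ w a → w at value (contents a)) us (Vec.take n ts)
      reads-normals []       ts       = refl
      reads-normals (u ∷ us) (t ∷ ts) =
        cong₂ _∷_ (cong (λ w → u at value w) (contents-normal t)) (reads-normals us ts)

      advance : ℕ → Config → Config
      advance n c = Vec.foldl′ (step ws) c (Vec.replicate n tt)

      advance-halted : ∀ n b ts → advance n (config (inj₂ b) ts) ≡ config (inj₂ b) ts
      advance-halted zero    b ts = refl
      advance-halted (suc n) b ts = advance-halted n b ts

      record Ends (τ : Store) (d : Config) : Set where
        field
          verdict-≡ : verdict d ≡ just (v (reads τ) (scans τ))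
          tapes-≡   : normals (tapeOf d) ≡ τ

      -- Neither reads nor scans see the blanks that `normal` drops, so the machine on its real
      -- tapes and the command on the normalised store pass through the same points.
      simulate : ∀ {x n σ τ} → Steps c x σ n nothing τ → ∀ ts → normals ts ≡ σ →
                 ∀ n′ → n < n′ → Ends τ (advance n′ (config (inj₁ x) ts))
      -- The spare step computes the verdict; all later ones leave the halted configuration alone.
      simulate done ts refl (suc n′) _
        rewrite advance-halted n′ (v (queried ws (config (inj₁ nothing) ts)) (Vec.map scanned ts))
                  (Vec.zipWith act (idle (Vec.map scanned ts)) ts) = record
        { verdict-≡ = cong just (sym (cong₂ v (reads-normals ws ts) (scans-normals ts)))
        ; tapes-≡   = trans (perform-normals (idle (Vec.map scanned ts)) ts)
                        (trans (cong (λ s → perform (idle s) (normals ts)) (sym (scans-normals ts)))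
                               (perform-idle (normals ts)))
        }
      simulate {τ = τ} (more {x} {n = n} s) ts refl (suc n′) (s≤s lt)
        rewrite sym (reads-normals ws ts) | sym (scans-normals ts) =
        simulate s _ (perform-normals (proj₂ (next c x (reads (normals ts)) (scans (normals ts)))) ts) n′ lt

      blanks : Store
      blanks = Vec.replicate k blankTape

      normals-blanks : ∀ n → Vec.map normal (Vec.replicate n blankTape) ≡ Vec.replicate n (blankTape {A})
      normals-blanks zero    = refl
      normals-blanks (suc n) = cong (blankTape ∷_) (normals-blanks n)

      output-≡ : ∀ d → output d ≡ contents (Vec.head (Vec.drop m (normals (tapeOf d))))
      output-≡ d = go m (tapeOf d)
        where
        go : ∀ j (ts : Vec (Tape A) (j + suc w)) →
             contents (Vec.head (Vec.drop j ts)) ≡ contents (Vec.head (Vec.drop j (Vec.map normal ts)))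
        go zero    (t ∷ ts) = sym (contents-normal t)
        go (suc j) (t ∷ ts) = go j ts

      compile-correct : ∀ {τ n} → Exec c blanks τ n → ∀ n′ → n < n′ →
                        Ends τ (runFor (compile c A-finite v) n′ ws)
      compile-correct e n′ lt with sound e
      ... | _ , le , s = simulate s _ (normals-blanks k) n′ (≤-<-trans le lt)

-- Counting

+-interchange : ∀ a b c d → (a + b) + (c + d) ≡ (a + c) + (b + d)
+-interchange a b c d = trans (+-assoc a b (c + d)) (trans (cong (a +_)
  (trans (sym (+-assoc b c d)) (trans (cong (_+ d) (+-comm b c)) (+-assoc c b d)))) (sym (+-assoc a c (b + d))))

indicator : Bool → ℕ
indicator b = if b then 1 else 0

count : {A : Set} → (A → Bool) → List A → ℕ
count p []       = 0
count p (x ∷ xs) = indicator (p x) + count p xs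

module _ {A : Set} where

  count-≤ : {p q : A → Bool} → (∀ x → p x ≡ true → q x ≡ true) → ∀ xs → count p xs ≤ count q xs
  count-≤ p⇒q []       = z≤n
  count-≤ {p} {q} p⇒q (x ∷ xs) = +-mono-≤ (one (p⇒q x)) (count-≤ p⇒q xs)
    where
    one : (p x ≡ true → q x ≡ true) → indicator (p x) ≤ indicator (q x)
    one h with p x
    ... | false = z≤n
    ... | true rewrite h refl = ≤-refl

  count-none : {p : A → Bool} → ∀ {xs} → All (λ x → p x ≡ false) xs → count p xs ≡ 0
  count-none []         = refl
  count-none (px ∷ pxs) rewrite px = count-none pxs

  count-∨ : (p q : A → Bool) → ∀ xs → count (λ x → p x ∨ q x) xs ≤ count p xs + count q xs
  count-∨ p q []       = z≤n
  count-∨ p q (x ∷ xs) = begin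
    indicator (p x ∨ q x) + count _ xs                              ≤⟨ +-mono-≤ (one (p x) (q x))
      (count-∨ p q xs) ⟩
    (indicator (p x) + indicator (q x)) + (count p xs + count q xs) ≡⟨ +-interchange (indicator (p x)) _ _ _ ⟩
    (indicator (p x) + count p xs) + (indicator (q x) + count q xs) ∎
    where
    open ≤-Reasoning
    one : ∀ a b → indicator (a ∨ b) ≤ indicator a + indicator b
    one true  b = m≤m+n 1 _
    one false b = ≤-refl

  -- Inclusion-exclusion: `length xs` pays for one occurrence of each element, and `t` for the
  -- second occurrence of those that satisfy both predicates.
  count-pair : {p q t : A → Bool} → (∀ x → p x ≡ true → q x ≡ true → t x ≡ true) →
               ∀ xs → count p xs + count q xs ≤ length xs + count t xs
  count-pair h []       = z≤n
  count-pair {p} {q} {t} h (x ∷ xs) = begin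
    (indicator (p x) + count p xs) + (indicator (q x) + count q xs) ≡⟨ +-interchange (indicator (p x)) _ _ _ ⟩
    (indicator (p x) + indicator (q x))
      + (count p xs + count q xs) ≤⟨ +-mono-≤ (one (p x) (q x) (h x)) (count-pair {t = t} h xs) ⟩
    (1 + indicator (t x)) + (length xs + count t xs)                ≡⟨ +-interchange 1 (indicator (t x))
      (length xs) (count t xs) ⟩
    suc (length xs) + (indicator (t x) + count t xs)                ∎
    where
    open ≤-Reasoning
    one : ∀ a b → (a ≡ true → b ≡ true → t x ≡ true) → indicator a + indicator b ≤ 1 + indicator (t x)
    one true  true  hx rewrite hx refl refl = ≤-refl
    one true  false hx = s≤s z≤n
    one false true  hx = s≤s z≤n
    one false false hx = z≤n

  count-unique : {p : A → Bool} → ∀ {xs} → Unique xs → (∀ {x y} → p x ≡ true → p y ≡ true → x ≡ y) →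
                 count p xs ≤ 1
  count-unique         []        h = z≤n
  count-unique {p} {x ∷ xs} (x≢ ∷ uniq) h with p x in eq
  ... | false = count-unique uniq h
  ... | true  = ≤-reflexive (cong
    suc (count-none (All.map (λ {y} x≢y → ¬true⇒false (λ py → x≢y (h eq py))) x≢)))
    where
    ¬true⇒false : ∀ {b} → ¬ (b ≡ true) → b ≡ false
    ¬true⇒false {false} _ = refl
    ¬true⇒false {true}  n = contradiction refl n

  count-map : {B : Set} (p : B → Bool) (g : A → B) → ∀ xs → count p (map g xs) ≡ count (p ∘ g) xs
  count-map p g []       = refl
  count-map p g (x ∷ xs) = cong (_ +_) (count-map p g xs)

-- The related pairs are counted by rows and by columns. The factor `c` allows a fractional bound
-- `e / c` on the rows, here a probability of 1/3.
double-count : {A B : Set} (t : A → B → Bool) (c d e : ℕ) → ∀ xs ys →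
               (∀ y → count (λ x → t x y) xs ≤ d) → All (λ x → e ≤ c * count (t x) ys) xs →
               length xs * e ≤ c * (length ys * d)
double-count t c d e xs ys cols rows = ≤-trans (by-rows rows) (*-monoʳ-≤ c (by-columns ys))
  where
  total : ∀ xs ys → ℕ
  total []       ys = 0
  total (x ∷ xs) ys = count (t x) ys + total xs ys

  by-rows : ∀ {xs} → All (λ x → e ≤ c * count (t x) ys) xs → length xs * e ≤ c * total xs ys
  by-rows []       = z≤n
  by-rows (p ∷ ps) = ≤-trans (+-mono-≤ p (by-rows ps)) (≤-reflexive (sym (*-distribˡ-+ c _ _)))

  open ≤-Reasoning

  total-∷ : ∀ xs y ys → total xs (y ∷ ys) ≡ count (λ x → t x y) xs + total xs ys
  total-∷ []       y ys = refl
  total-∷ (x ∷ xs) y ys = begin-equality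
    (indicator (t x y) + count (t x) ys) + total xs (y ∷ ys)      ≡⟨ cong (_ +_) (total-∷ xs y ys) ⟩
    (indicator (t x y) + count (t x) ys) + (count _ xs + total xs ys) ≡⟨ +-assoc (indicator (t x y)) _ _ ⟩
    indicator (t x y) + (count (t x) ys + (count _ xs + total xs ys)) ≡⟨ cong (indicator (t x y) +_)
      (+-assoc (count (t x) ys) _ _) ⟨
    indicator (t x y) + ((count (t x) ys + count _ xs) + total xs ys) ≡⟨
      cong (λ z → indicator (t x y) + (z + total xs ys)) (+-comm (count (t x) ys) _) ⟩
    indicator (t x y) + ((count _ xs + count (t x) ys) + total xs ys) ≡⟨ cong (indicator (t x y) +_)
      (+-assoc (count _ xs) _ _) ⟩
    indicator (t x y) + (count _ xs + (count (t x) ys + total xs ys)) ≡⟨ +-assoc (indicator (t x y)) _ _ ⟨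
    (indicator (t x y) + count _ xs) + (count (t x) ys + total xs ys) ∎

  total-[] : ∀ xs → total xs [] ≡ 0
  total-[] []       = refl
  total-[] (x ∷ xs) = total-[] xs

  by-columns : ∀ ys → total xs ys ≤ length ys * d
  by-columns []       = ≤-reflexive (total-[] xs)
  by-columns (y ∷ ys) = begin
    total xs (y ∷ ys)                        ≡⟨ total-∷ xs y ys ⟩
    count (λ x → t x y) xs + total xs ys     ≤⟨ +-mono-≤ (cols y) (by-columns ys) ⟩
    d + length ys * d                        ∎

-- Decision trees

data Tree (n : ℕ) : ℕ → Set where
  leaf : ∀ {h} → Bool → Tree n h
  node : ∀ {h} → Fin n → Tree n h → Tree n h → Tree n (suc h)

evaluate : ∀ {n h} → Tree n h → Vec Bool n → Bool
evaluate (leaf b)       x = b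
evaluate (node i t₀ t₁) x = evaluate (if Vec.lookup x i then t₁ else t₀) x

deepen : ∀ {n h h′} → h ≤ h′ → Tree n h → Tree n h′
deepen le       (leaf b)       = leaf b
deepen (s≤s le) (node i t₀ t₁) = node i (deepen le t₀) (deepen le t₁)

evaluate-deepen : ∀ {n h h′} (le : h ≤ h′) (t : Tree n h) x → evaluate (deepen le t) x ≡ evaluate t x
evaluate-deepen le       (leaf b)       x = refl
evaluate-deepen (s≤s le) (node i t₀ t₁) x with Vec.lookup x i
... | false = evaluate-deepen le t₀ x
... | true  = evaluate-deepen le t₁ x

-- Exhaustive search over the cube keeps the argument about certificates constructive.
search : ∀ n {P : Vec Bool n → Set} → (∀ x → Dec (P x)) → Dec (∃ P)
search zero P? = map′ ([] ,_) (λ { ([] , p) → p }) (P? [])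
search (suc n) P? with search n (λ x → P? (false ∷ x)) | search n (λ x → P? (true ∷ x))
... | yes (x , p) | _           = yes (false ∷ x , p)
... | no _        | yes (x , p) = yes (true ∷ x , p)
... | no ¬p       | no ¬q       = no λ { (false ∷ x , p) → ¬p (x , p) ; (true ∷ x , p) → ¬q (x , p) }

module _ {n : ℕ} where

  differs : Vec Bool n → Vec Bool n → Fin n → Bool
  differs x y i = not (does (Vec.lookup x i Bool.≟ Vec.lookup y i))

  differs⁻ : ∀ x y i → differs x y i ≡ true → Vec.lookup x i ≢ Vec.lookup y i
  differs⁻ x y i d eq with trans (sym d) (cong not (dec-true (_ Bool.≟ _) eq))
  ... | ()

  differs-same : ∀ x y i → Vec.lookup x i ≡ Vec.lookup y i → differs x y i ≡ false
  differs-same x y i eq = cong not (dec-true (_ Bool.≟ _) eq)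

  diffs : Vec Bool n → Vec Bool n → List (Fin n)
  diffs x y = filter (λ i → ¬? (Vec.lookup x i Bool.≟ Vec.lookup y i)) (List.allFin n)

  diffs-unique : ∀ x y → Unique (diffs x y)
  diffs-unique x y = Unique.filter⁺ _ (Unique.allFin⁺ n)

  Agree : List (Fin n) → Vec Bool n → Vec Bool n → Set
  Agree S x y = All (λ i → Vec.lookup x i ≡ Vec.lookup y i) S

distance : ∀ {n} → Vec Bool n → Vec Bool n → ℕ
distance []      []      = 0
distance (a ∷ x) (b ∷ y) = indicator (not (does (a Bool.≟ b))) + distance x y

distance-update : ∀ {n} (x y : Vec Bool n) i → Vec.lookup x i ≢ Vec.lookup y i →
                  distance x (Vec.updateAt y i (λ _ → Vec.lookup x i)) < distance x y
distance-update (a ∷ x) (b ∷ y) zero    ne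
  rewrite dec-true (a Bool.≟ a) refl | dec-false (a Bool.≟ b) ne = ≤-refl
distance-update (a ∷ x) (b ∷ y) (suc i) ne = +-monoʳ-< _ (distance-update x y i ne)

-- A function f with a bounded-error randomized query algorithm: r x ω is its
-- answer on the input x with coin tosses ω, and q x ω lists its queries.
module Sensitivity {n d : ℕ} {W : Set} (Ω : List W) (Ω-nonempty : 1 ≤ length Ω)
  (f : Vec Bool n → Bool) (r : Vec Bool n → W → Bool) (q : Vec Bool n → W → List (Fin n))
  (q-length : ∀ x ω → length (q x ω) ≤ d)
  (q-local : ∀ x y ω → Agree (q x ω) x y → r x ω ≡ r y ω)
  (likely : ∀ x → 2 * length Ω ≤ 3 * count (λ ω → does (r x ω Bool.≟ f x)) Ω)
  where

  X : Set
  X = Vec Bool n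

  meets : X → X → List (Fin n) → Bool
  meets x y []      = false
  meets x y (i ∷ Q) = differs x y i ∨ meets x y Q

  meets-none : ∀ x y Q → meets x y Q ≡ false → Agree Q x y
  meets-none x y []      _  = []
  meets-none x y (i ∷ Q) eq with Vec.lookup x i Bool.≟ Vec.lookup y i
  ... | yes p = p ∷ meets-none x y Q eq
  meets-none x y (i ∷ Q) () | no _

  -- With probability at least 2/3 + 2/3 - 1 = 1/3 the answers on `x` and on `y` are both right.
  -- They then differ for the same tosses, which is possible only if the run on `x` queries a
  -- position where the inputs differ.
  meets-often : ∀ x y → f y ≢ f x → length Ω ≤ 3 * count (λ ω → meets x y (q x ω)) Ω
  meets-often x y ne = +-cancelˡ-≤ (3 * N) N _ (begin
    3 * N + N                          ≡⟨ +-comm (3 * N) N ⟩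
    4 * N                              ≡⟨ *-distribʳ-+ N 2 2 ⟩
    2 * N + 2 * N                      ≤⟨ +-mono-≤ (likely x) (likely y) ⟩
    3 * count agree-x Ω + 3 * count agree-y Ω ≡⟨ *-distribˡ-+ 3 (count agree-x Ω) _ ⟨
    3 * (count agree-x Ω + count agree-y Ω)   ≤⟨ *-monoʳ-≤ 3 (count-pair {t = met} both Ω) ⟩
    3 * (N + count met Ω)              ≡⟨ *-distribˡ-+ 3 N _ ⟩
    3 * N + 3 * count met Ω            ∎)
    where
    open ≤-Reasoning
    N = length Ω
    agree-x agree-y met : W → Bool
    agree-x ω = does (r x ω Bool.≟ f x)
    agree-y ω = does (r y ω Bool.≟ f y)
    met ω = meets x y (q x ω)
    does⁻ : ∀ {a b} → does (a Bool.≟ b) ≡ true → a ≡ b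
    does⁻ {false} {false} _ = refl
    does⁻ {true}  {true}  _ = refl
    both : ∀ ω → agree-x ω ≡ true → agree-y ω ≡ true → met ω ≡ true
    both ω ax ay with met ω in eq
    ... | true  = refl
    ... | false = contradiction
      (trans (sym (does⁻ ay)) (trans (sym (q-local x y ω (meets-none x y _ eq))) (does⁻ ax))) ne

  -- By disjointness a single query can hit at most one block.
  meets-≤ : ∀ x ys → (∀ i → count (λ y → differs x y i) ys ≤ 1) →
            ∀ Q → count (λ y → meets x y Q) ys ≤ length Q
  meets-≤ x ys h []      = ≤-reflexive (count-none (All.universal (λ _ → refl) ys))
  meets-≤ x ys h (i ∷ Q) = ≤-trans (count-∨ (λ y → differs x y i) _ ys) (+-mono-≤ (h i) (meets-≤ x ys h Q))

  -- A block is represented by the input `y` that flipping it produces. Every block is hit for at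
  -- least a third of the tosses, while each toss hits at most `d` blocks.
  disjoint-blocks : ∀ x ys → (∀ i → count (λ y → differs x y i) ys ≤ 1) →
                    All (λ y → f y ≢ f x) ys → length ys ≤ 3 * d
  disjoint-blocks x ys disj flip = *-cancelʳ-≤ _ _ (length Ω) {{>-nonZero Ω-nonempty}} (begin
    length ys * length Ω   ≤⟨ double-count (λ y ω → meets x y (q x ω)) 3 d (length Ω) ys Ω
                                (λ ω → ≤-trans (meets-≤ x ys disj (q x ω)) (q-length x ω))
                                (All.map (λ {y} → meets-often x y) flip) ⟩
    3 * (length Ω * d)     ≡⟨ cong (3 *_) (*-comm (length Ω) d) ⟩
    3 * (d * length Ω)     ≡⟨ *-assoc 3 d (length Ω) ⟨
    3 * d * length Ω       ∎)
    where open ≤-Reasoning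

  flip-back : X → X → Fin n → X
  flip-back x y i = Vec.updateAt y i (λ _ → Vec.lookup x i)

  Contradicts : List (Fin n) → X → X → Set
  Contradicts S x y = Agree S x y × f y ≢ f x

  contradicts? : ∀ S x y → Dec (Contradicts S x y)
  contradicts? S x y = All.all? (λ i → Vec.lookup x i Bool.≟ Vec.lookup y i) S ×-dec ¬? (f y Bool.≟ f x)

  -- Minimality under the removal of a single index; `minimal-block` asks for no more than this.
  Minimal : X → X → Set
  Minimal x y = ∀ i → i ∈ diffs x y → f (flip-back x y i) ≡ f x

  agree-flip-back : ∀ S x y i → Agree S x y → Agree S x (flip-back x y i)
  agree-flip-back S x y i = All.map λ {j} eq → case j Fin.≟ i of λ
    { (yes refl) → sym (Vec.lookup∘updateAt i y)
    ; (no j≢i)   → trans eq (sym (Vec.lookup∘updateAt′ j i j≢i y)) }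

  -- Descent on the Hamming distance. Flipping a bit back only makes the inputs more alike, so
  -- agreement on `S` survives.
  minimise : ∀ S x k y → distance x y ≤ k → Contradicts S x y →
             ∃[ y′ ] (Contradicts S x y′ × Minimal x y′)
  minimise S x k y le (agree , ne)
    with Fin.any? (λ i → ¬? (Vec.lookup x i Bool.≟ Vec.lookup y i) ×-dec ¬? (f (flip-back x y i) Bool.≟ f x))
  ... | no none = y , (agree , ne) , λ i i∈ → case f (flip-back x y i) Bool.≟ f x of λ
    { (yes eq) → eq
    ; (no ne′) → ⊥-elim (none (i , proj₂ (∈-filter⁻ _ {xs = List.allFin n} i∈) , ne′)) }
  minimise S x zero    y le c | yes (i , di , _) = contradiction (<-≤-trans (distance-update x y i di) le) λ ()
  minimise S x (suc k) y le (agree , _) | yes (i , di , ne′) =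
    minimise S x k (flip-back x y i) (≤-pred (<-≤-trans (distance-update x y i di) le))
      (agree-flip-back S x y i agree , ne′)

  -- Flipping back any single bit of a minimal block changes f, so the bits of the
  -- block are themselves disjoint sensitive blocks of y.
  minimal-block : ∀ x y → f y ≢ f x → Minimal x y → length (diffs x y) ≤ 3 * d
  minimal-block x y ne min = subst (_≤ 3 * d) (List.length-map (flip-back x y) (diffs x y))
    (disjoint-blocks y (map (flip-back x y) (diffs x y)) single (flips (diffs x y) min))
    where
    flips : ∀ xs → (∀ i → i ∈ xs → f (flip-back x y i) ≡ f x) → All (λ z → f z ≢ f y) (map (flip-back x y) xs)
    flips []       h = []
    flips (i ∷ xs) h = (λ eq → ne (trans (sym eq) (h i (here refl)))) ∷ flips xs (λ j j∈ → h j (there j∈))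
    only : ∀ {i} j → differs y (flip-back x y i) j ≡ true → i ≡ j
    only {i} j di with j Fin.≟ i
    ... | yes eq = sym eq
    ... | no j≢i = ⊥-elim (differs⁻ y (flip-back x y i) j di (sym (Vec.lookup∘updateAt′ j i j≢i y)))
    single : ∀ j → count (λ z → differs y z j) (map (flip-back x y) (diffs x y)) ≤ 1
    single j = subst (_≤ 1) (sym (count-map (λ z → differs y z j) (flip-back x y) (diffs x y)))
      (count-unique (diffs-unique x y) (λ p q → trans (only j p) (sym (only j q))))

  C : ℕ
  C = 3 * d * (3 * d)

  record Certificate (x : X) : Set where
    field
      indices : List (Fin n)
      small   : length indices ≤ C
      forces  : ∀ y → Agree indices x y → f y ≡ f x

  open Certificate

  -- Collects disjoint minimal blocks until their union is a certificate.
  certify : ∀ x fuel S ys → length ys + fuel ≡ suc (3 * d) → length S ≤ length ys * (3 * d) →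
            All (λ y → f y ≢ f x) ys → (∀ i → count (λ y → differs x y i) ys ≤ 1) →
            (∀ i → i ∈ S ⊎ count (λ y → differs x y i) ys ≡ 0) → Certificate x
  certify x fuel S ys eq lenS ne disj cover with search n (contradicts? S x)
  ... | no none = record
    { indices = S
    ; small   = ≤-trans lenS (*-monoˡ-≤ (3 * d) (disjoint-blocks x ys disj ne))
    ; forces  = λ y agree → case f y Bool.≟ f x of λ
        { (yes e) → e ; (no ¬e) → ⊥-elim (none (y , agree , ¬e)) }
    }
  -- Without fuel left, `ys` holds `3 * d + 1` disjoint sensitive blocks, one too many.
  certify x zero S ys eq lenS ne disj cover | yes _ =
    contradiction (subst (_≤ 3 * d) (trans (sym (+-identityʳ _)) eq) (disjoint-blocks x ys disj ne))
      (<⇒≱ ≤-refl)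
  certify x (suc fuel) S ys eq lenS ne disj cover | yes (y₀ , c₀)
    with minimise S x (distance x y₀) y₀ ≤-refl c₀
  ... | y , (agree , ney) , min =
    certify x fuel (diffs x y ++ S) (y ∷ ys) (trans (sym (+-suc _ fuel)) eq)
      (subst (_≤ _) (sym (List.length-++ (diffs x y))) (+-mono-≤ (minimal-block x y ney min) lenS))
      (ney ∷ ne) disj′ cover′
    where
    -- The new block avoids `S`, where `y` agrees with `x`; and by `cover` an index outside `S` lies
    -- in no earlier block.
    disj′ : ∀ i → count (λ z → differs x z i) (y ∷ ys) ≤ 1
    disj′ i with cover i
    ... | inj₁ i∈S rewrite differs-same x y i (All.lookup agree i∈S) = disj i
    ... | inj₂ none rewrite none = ≤-trans (≤-reflexive (+-identityʳ _)) (one (differs x y i))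
      where
      one : ∀ b → indicator b ≤ 1
      one false = z≤n
      one true  = ≤-refl
    cover′ : ∀ i → i ∈ (diffs x y ++ S) ⊎ count (λ z → differs x z i) (y ∷ ys) ≡ 0
    cover′ i with Vec.lookup x i Bool.≟ Vec.lookup y i | cover i
    ... | no ne′ | _           = inj₁ (∈-++⁺ˡ (∈-filter⁺ _ (∈-allFin i) ne′))
    ... | yes _  | inj₁ i∈S    = inj₁ (∈-++⁺ʳ (diffs x y) i∈S)
    ... | yes p  | inj₂ none   = inj₂ none

  certificate : ∀ x → Certificate x
  certificate x = certify x (suc (3 * d)) [] [] refl z≤n [] (λ _ → z≤n) (λ _ → inj₂ refl)

  -- Otherwise an input equal to `x` on the one certificate and to `y` on the other would exist, and
  -- it would have both values. `z` is this input.
  certificates-meet : ∀ x y → f x ≢ f y →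
    ∃[ i ] (i ∈ indices (certificate x) × i ∈ indices (certificate y) × Vec.lookup x i ≢ Vec.lookup y i)
  certificates-meet x y ne
    with Fin.any? (λ i → _∈?_ Fin._≟_ i (indices (certificate x)) ×-dec
                         (_∈?_ Fin._≟_ i (indices (certificate y)) ×-dec
                          ¬? (Vec.lookup x i Bool.≟ Vec.lookup y i)))
  ... | yes (i , p , q , d) = i , p , q , d
  ... | no none = ⊥-elim (ne (trans (sym (forces (certificate x) z agree-x))
    (forces (certificate y) z agree-y)))
    where
    Sx = indices (certificate x)
    Sy = indices (certificate y)
    mix : Fin n → Bool
    mix i = if does (_∈?_ Fin._≟_ i Sx) then Vec.lookup x i else Vec.lookup y i
    z : X
    z = Vec.tabulate mix
    agree-x : Agree Sx x z
    agree-x = All.tabulate λ {i} i∈ → sym (trans (Vec.lookup∘tabulate mix i)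
      (cong (λ b → if b then Vec.lookup x i else Vec.lookup y i) (dec-true (_∈?_ Fin._≟_ i Sx) i∈)))
    same : ∀ i → i ∈ Sy → Vec.lookup y i ≡ mix i
    same i i∈y with _∈?_ Fin._≟_ i Sx
    ... | no _ = refl
    ... | yes i∈x with Vec.lookup x i Bool.≟ Vec.lookup y i
    ...   | yes eq = sym eq
    ...   | no ne′ = ⊥-elim (none (i , i∈x , i∈y , ne′))
    agree-y : Agree Sy y z
    agree-y = All.tabulate λ {i} i∈ → trans (same i i∈) (sym (Vec.lookup∘tabulate mix i))

  -- From certificates to a decision tree

  Restriction : Set
  Restriction = List (Fin n × Bool)

  Meets : Restriction → X → Set
  Meets R x = All (λ ib → Vec.lookup x (proj₁ ib) ≡ proj₂ ib) R

  fixed : Restriction → List (Fin n)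
  fixed = map proj₁

  meets-agree : ∀ R x y → Meets R x → Meets R y → Agree (fixed R) x y
  meets-agree []      x y []       []       = []
  meets-agree (_ ∷ R) x y (p ∷ ps) (q ∷ qs) = trans p (sym q) ∷ meets-agree R x y ps qs

  free : Restriction → List (Fin n) → ℕ
  free R = count (λ i → not (does (_∈?_ Fin._≟_ i (fixed R))))

  Decides : ∀ {h} → Tree n h → Restriction → Set
  Decides t R = ∀ y → Meets R y → evaluate t y ≡ f y

  record Refines (S : List (Fin n)) (R R′ : Restriction) : Set where
    field
      fixes  : ∀ {i} → i ∈ S → i ∈ fixed R′
      keeps  : ∀ {i} → i ∈ fixed R → i ∈ fixed R′
      weaker : ∀ y → Meets R′ y → Meets R y

  -- In continuation style: `next` supplies the tree that hangs below each outcome of querying `S`.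
  -- The outcome enters as a restriction that fixes all of `S` and implies `R`.
  query-all : ∀ S R h → (∀ R′ → Refines S R R′ → Σ (Tree n h) λ t → Decides t R′) →
              Σ (Tree n (length S + h)) λ t → Decides t R
  query-all []      R h next = next R (record { fixes = λ () ; keeps = id ; weaker = λ _ → id })
  query-all (i ∷ S) R h next = node i (proj₁ (sub false)) (proj₁ (sub true)) , decides
    where
    sub : ∀ b → Σ (Tree n (length S + h)) λ t → Decides t ((i , b) ∷ R)
    sub b = query-all S ((i , b) ∷ R) h λ R′ ref → next R′ record
      { fixes  = λ { (here refl) → Refines.keeps ref (here refl) ; (there j∈) → Refines.fixes ref j∈ }
      ; keeps  = λ j∈ → Refines.keeps ref (there j∈)
      ; weaker = λ y m → All.tail (Refines.weaker ref y m)
      }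
    decides : Decides (node i (proj₁ (sub false)) (proj₁ (sub true))) R
    decides y m with Vec.lookup y i in eq
    ... | false = proj₂ (sub false) y (eq ∷ m)
    ... | true  = proj₂ (sub true) y (eq ∷ m)

  free-< : ∀ {S R R′ i} T → Refines S R R′ → i ∈ S → i ∈ T → ¬ (i ∈ fixed R) → free R′ T < free R T
  free-< {S} {R} {R′} {i} (j ∷ T) ref i∈S (here refl) i∉
    rewrite dec-true (_∈?_ Fin._≟_ i (fixed R′)) (Refines.fixes ref i∈S)
          | dec-false (_∈?_ Fin._≟_ i (fixed R)) i∉ = s≤s (free-≤ T)
    where
    free-≤ : ∀ T → free R′ T ≤ free R T
    free-≤ = count-≤ λ j eq → cong not (dec-false (_∈?_ Fin._≟_ j (fixed R)) λ j∈ →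
      case trans (sym eq) (cong not (dec-true (_∈?_ Fin._≟_ j (fixed R′)) (Refines.keeps ref j∈))) of λ ())
  free-< {S} {R} {R′} {i} (j ∷ T) ref i∈S (there i∈T) i∉ = +-mono-≤-< one (free-< T ref i∈S i∈T i∉)
    where
    one : indicator (not (does (_∈?_ Fin._≟_ j (fixed R′)))) ≤ indicator (not (does (_∈?_ Fin._≟_ j (fixed R))))
    one with _∈?_ Fin._≟_ j (fixed R) | _∈?_ Fin._≟_ j (fixed R′)
    ... | yes p | yes _ = z≤n
    ... | yes p | no ¬p = contradiction (Refines.keeps ref p) ¬p
    ... | no _  | yes _ = z≤n
    ... | no _  | no _  = ≤-refl

  -- Querying a certificate of a 1-input shrinks every certificate of a 0-input.
  build : ∀ j R → (∀ y → Meets R y → f y ≡ false → free R (indices (certificate y)) ≤ j) →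
          Σ (Tree n (suc j * C)) λ t → Decides t R
  build j R bound with search n (λ x →
    All.all? (λ ib → Vec.lookup x (proj₁ ib) Bool.≟ proj₂ ib) R ×-dec (f x Bool.≟ true))
  ... | no none = leaf false , λ y m → sym (Bool.¬-not (λ eq → none (y , m , eq)))
  ... | yes (x , mx , fx) with query-all (indices (certificate x)) R (j * C) (next j bound)
    where
    shrinks : ∀ {R′} → Refines (indices (certificate x)) R R′ → ∀ y → Meets R′ y → f y ≡ false →
              free R′ (indices (certificate y)) < free R (indices (certificate y))
    shrinks {R′} ref y m fy with certificates-meet x y (λ eq → case trans (sym fx) (trans eq fy) of λ ())
    ... | i , i∈x , i∈y , ne = free-< _ ref i∈x i∈y
      (λ i∈R → ne (All.lookup (meets-agree R x y mx (Refines.weaker ref y m)) i∈R))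
    next : ∀ j → (∀ y → Meets R y → f y ≡ false → free R (indices (certificate y)) ≤ j) →
           ∀ R′ → Refines (indices (certificate x)) R R′ → Σ (Tree n (j * C)) λ t → Decides t R′
    -- The number of free indices would have to drop below 0, so no 0-input is left.
    next zero    bound R′ ref = leaf true , λ y m → case f y Bool.≟ false of λ
      { (yes eq) → contradiction (<-≤-trans (shrinks ref y m eq) (bound y (Refines.weaker ref y m) eq)) λ ()
      ; (no ne)  → sym (Bool.¬-not ne) }
    next (suc j) bound R′ ref = build j R′ λ y m eq →
      ≤-pred (<-≤-trans (shrinks ref y m eq) (bound y (Refines.weaker ref y m) eq))
  ... | t , decides = deepen le t , λ y m → trans (evaluate-deepen le t y) (decides y m)
    where
    le : length (indices (certificate x)) + j * C ≤ suc j * C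
    le = +-monoˡ-≤ (j * C) (small (certificate x))

  -- At the start no certificate has more than `C` free indices, and each round of at most `C`
  -- queries takes one away from every certificate of a 0-input; so `C + 1` rounds are enough.
  decision-tree : Σ (Tree n (suc C * C)) λ t → ∀ x → evaluate t x ≡ f x
  decision-tree with build C [] (λ y _ _ →
    ≤-trans (count-≤-length (indices (certificate y))) (small (certificate y)))
    where
    count-≤-length : ∀ {p : Fin n → Bool} xs → count p xs ≤ length xs
    count-≤-length []       = z≤n
    count-≤-length {p} (x ∷ xs) with p x
    ... | false = m≤n⇒m≤1+n (count-≤-length xs)
    ... | true  = s≤s (count-≤-length xs)
  ... | t , decides = t , λ x → decides x []

-- Virtual inputs

-- The game is played on strings of bits, each tagged with the role it plays:
-- the existential player spells out an index, is told the queried bit, and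
-- repeats this; the universal player then extends the partial input so far.
data Kind : Set where
  exists query pivot index answer toss : Kind

Cell : Set
Cell = Kind × Bool

Finite-Kind : Finite Kind
Finite-Kind = 6 , mk↔ₛ′ to from to∘from from∘to
  where
  to : Kind → Fin 6
  to exists = zero
  to query  = suc zero
  to pivot  = suc (suc zero)
  to index  = suc (suc (suc zero))
  to answer = suc (suc (suc (suc zero)))
  to toss   = suc (suc (suc (suc (suc zero))))
  from : Fin 6 → Kind
  from zero                                = exists
  from (suc zero)                          = query
  from (suc (suc zero))                    = pivot
  from (suc (suc (suc zero)))              = index
  from (suc (suc (suc (suc zero))))        = answer
  from (suc (suc (suc (suc (suc _)))))     = toss
  to∘from : ∀ i → to (from i) ≡ i
  to∘from zero                                = refl
  to∘from (suc zero)                          = refl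
  to∘from (suc (suc zero))                    = refl
  to∘from (suc (suc (suc zero)))              = refl
  to∘from (suc (suc (suc (suc zero))))        = refl
  to∘from (suc (suc (suc (suc (suc zero)))))  = refl
  from∘to : ∀ κ → from (to κ) ≡ κ
  from∘to exists = refl
  from∘to query  = refl
  from∘to pivot  = refl
  from∘to index  = refl
  from∘to answer = refl
  from∘to toss   = refl

isIndex isAnswer : Kind → Bool
isIndex exists  = true
isIndex index   = true
isIndex _       = false
isAnswer query  = true
isAnswer answer = true
isAnswer _      = false

-- Histories list the most recent cell first, so that `indexBits` comes out
-- least significant bit first.
indexBits : List Cell → List Bool
indexBits []            = []
indexBits ((κ , b) ∷ h) = if isIndex κ then b ∷ indexBits h else []

Entry : Set
Entry = List Bool × Bool

entries : List Cell → List Entry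
entries []            = []
entries ((κ , b) ∷ h) = if isAnswer κ then (indexBits h , b) ∷ entries h else entries h

-- The earliest matching entry, which comes last, wins.
respond : List Entry → ℕ → Bool → Bool
respond []             i b = b
respond ((u , c) ∷ es) i b = respond es i (if does (value u ≟ i) then c else b)

respond-++ : ∀ es fs i b → respond (es ++ fs) i b ≡ respond fs i (respond es i b)
respond-++ []       fs i b = refl
respond-++ (e ∷ es) fs i b = respond-++ es fs i _

indexBits-++ : ∀ e h → indexBits h ≡ [] → indexBits (e ++ h) ≡ indexBits e
indexBits-++ []            h eq = eq
indexBits-++ ((κ , b) ∷ e) h eq = cong (λ u → if isIndex κ then b ∷ u else []) (indexBits-++ e h eq)

entries-++ : ∀ e h → indexBits h ≡ [] → entries (e ++ h) ≡ entries e ++ entries h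
entries-++ []            h eq = refl
entries-++ ((κ , b) ∷ e) h eq with isAnswer κ
... | false = entries-++ e h eq
... | true  = cong₂ _∷_ (cong (_, b) (indexBits-++ e h eq)) (entries-++ e h eq)

tag : Kind → List Bool → List Cell
tag κ = map (κ ,_)

indexBits-tag : ∀ κ → isIndex κ ≡ true → ∀ v h → indexBits (tag κ v ʳ++ h) ≡ v ʳ++ indexBits h
indexBits-tag κ eq []      h = refl
indexBits-tag κ eq (b ∷ v) h = trans (indexBits-tag κ eq v ((κ , b) ∷ h))
  (cong (λ z → v ʳ++ (if z then b ∷ indexBits h else [])) eq)

entries-tag : ∀ κ → isAnswer κ ≡ false → ∀ v h → entries (tag κ v ʳ++ h) ≡ entries h
entries-tag κ eq []      h = refl
entries-tag κ eq (b ∷ v) h = trans (entries-tag κ eq v ((κ , b) ∷ h))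
  (cong (λ z → if z then (indexBits h , b) ∷ entries h else entries h) eq)

-- Missing bits count as 0.
play : List Kind → List Bool → List Cell → List Cell
play []       s       h = h
play (κ ∷ κs) []      h = play κs [] ((κ , false) ∷ h)
play (κ ∷ κs) (b ∷ s) h = play κs s ((κ , b) ∷ h)

play-++ : ∀ κs κs′ s s′ h → length s ≡ length κs → play (κs ++ κs′) (s ++ s′) h ≡ play κs′ s′ (play κs s h)
play-++ []       κs′ []      s′ h eq = refl
play-++ (κ ∷ κs) κs′ (b ∷ s) s′ h eq = play-++ κs κs′ s s′ _ (suc-injective eq)

play-split : ∀ κs κs′ s h → ∃[ v ] ∃[ s′ ]
  (length v ≡ length κs × play (κs ++ κs′) s h ≡ play κs′ s′ (play κs v h))
play-split []       κs′ s       h = [] , s , refl , refl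
play-split (κ ∷ κs) κs′ []      h with play-split κs κs′ [] ((κ , false) ∷ h)
... | v , s′ , len , eq = false ∷ v , s′ , cong suc len , eq
play-split (κ ∷ κs) κs′ (b ∷ s) h with play-split κs κs′ s ((κ , b) ∷ h)
... | v , s′ , len , eq = b ∷ v , s′ , cong suc len , eq

play-replicate : ∀ κ L v h → length v ≡ L → play (replicate L κ) v h ≡ tag κ v ʳ++ h
play-replicate κ .0       []      h refl = refl
play-replicate κ .(suc _) (b ∷ v) h refl = play-replicate κ _ v _ refl

play-prefix : ∀ κs s h → ∃[ e ] play κs s h ≡ e ++ h
play-prefix []       s       h = [] , refl
play-prefix (κ ∷ κs) []      h with play-prefix κs [] ((κ , false) ∷ h)
... | e , eq = e ++ (κ , false) ∷ [] , trans eq (sym (List.++-assoc e _ h))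
play-prefix (κ ∷ κs) (b ∷ s) h with play-prefix κs s ((κ , b) ∷ h)
... | e , eq = e ++ (κ , b) ∷ [] , trans eq (sym (List.++-assoc e _ h))

halve : ∀ i → ∃[ b ] ∃[ j ] (i ≡ indicator b + 2 * j)
halve zero    = false , 0 , refl
halve (suc i) with halve i
... | false , j , eq = true , j , cong suc eq
... | true  , j , eq = false , suc j , trans (cong suc eq) (sym (*-suc 2 j))

binary : ∀ L i → i < 2 ^ L → ∃[ u ] (length u ≡ L × value u ≡ i)
binary zero    zero    _  = [] , refl , refl
binary zero    (suc i) (s≤s ())
binary (suc L) i       lt with halve i
... | b , j , refl with binary L j (*-cancelˡ-< 2 j (2 ^ L) (≤-<-trans (m≤n+m (2 * j) (indicator b)) lt))
... | u , len , val = b ∷ u , cong suc len , cong (λ z → indicator b + 2 * z) val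

-- The address w is padded with zeros.
firstBit : List Bool → Bool
firstBit []      = false
firstBit (b ∷ _) = b

rest : List Bool → List Bool
rest []      = []
rest (_ ∷ w) = w

matches : List Bool → List Bool → Bool
matches []      w = true
matches (b ∷ u) w = does (b Bool.≟ firstBit w) ∧ matches u (rest w)

value-split : ∀ w → value w ≡ indicator (firstBit w) + 2 * value (rest w)
value-split []      = refl
value-split (b ∷ w) = refl

double-injective : ∀ b c i j → indicator b + 2 * i ≡ indicator c + 2 * j → b ≡ c × i ≡ j
double-injective false false i j eq = refl , *-cancelˡ-≡ i j 2 eq
double-injective true  true  i j eq = refl , *-cancelˡ-≡ i j 2 (suc-injective eq)
double-injective false true  i j eq = contradiction (sym eq) (odd≢even j i)
  where
  odd≢even : ∀ j i → suc (2 * j) ≢ 2 * i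
  odd≢even zero    (suc i) eq = contradiction (suc-injective (trans eq (*-suc 2 i))) λ ()
  odd≢even (suc j) (suc i) eq = odd≢even j i (suc-injective (suc-injective
    (trans (cong suc (sym (*-suc 2 j))) (trans eq (*-suc 2 i)))))
double-injective true false i j eq with double-injective false true j i (sym eq)
... | () , _

-- `matches` never looks at the bits of `w` beyond the length of `u`; the bound says that these are
-- all zero.
matches-value : ∀ u w → value w < 2 ^ length u → matches u w ≡ does (value u ≟ value w)
matches-value []      w lt = sym (dec-true (0 ≟ value w) (sym (n<1⇒n≡0 lt)))
matches-value (b ∷ u) w lt with b Bool.≟ firstBit w
... | no ne = sym (dec-false (value (b ∷ u) ≟ value w) λ eq →
        ne (proj₁ (double-injective b (firstBit w) (value u) (value (rest w)) (trans eq (value-split w)))))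
... | yes refl = trans
        (matches-value u (rest w) (*-cancelˡ-< 2 _ _ (≤-<-trans (m≤n+m _ (indicator (firstBit w)))
          (subst (_< 2 ^ length (b ∷ u)) (value-split w) lt))))
        same
  where
  same : does (value u ≟ value (rest w)) ≡ does (value (firstBit w ∷ u) ≟ value w)
  same = case value u ≟ value (rest w) of λ
    { (yes eq) → trans (dec-true (_ ≟ _) eq) (sym (dec-true (value (firstBit w ∷ u) ≟ value w)
        (trans (cong (λ z → indicator (firstBit w) + 2 * z) eq) (sym (value-split w)))))
    ; (no ne)  → trans (dec-false (_ ≟ _) ne) (sym (dec-false (value (firstBit w ∷ u) ≟ value w)
        λ eq → ne (proj₂ (double-injective (firstBit w) (firstBit w) (value u) (value (rest w))
          (trans eq (value-split w)))))) }

-- The game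

Value : Set
Value = Maybe Bool

isNothing : Value → Bool
isNothing nothing  = true
isNothing (just _) = false

-- `nothing` means that the universal player can change the value of f.
combine : Kind → Value → Value → Value
combine exists v₀ v₁ = if isNothing v₀ then v₁ else v₀
combine query  v₀ v₁ = if isNothing v₀ then v₀ else v₁
combine pivot  v₀ v₁ = v₀
combine _ (just false) (just false) = just false
combine _ (just true)  (just true)  = just true
combine _ _            _            = nothing

gameValue : List Kind → (List Cell → Value) → List Cell → Value
gameValue []       g h = g h
gameValue (κ ∷ κs) g h = combine κ (gameValue κs g ((κ , false) ∷ h)) (gameValue κs g ((κ , true) ∷ h))

combine-same : ∀ κ b → combine κ (just b) (just b) ≡ just b
combine-same exists b     = refl
combine-same query  b     = refl
combine-same pivot  b     = refl
combine-same index  false = refl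
combine-same index  true  = refl
combine-same answer false = refl
combine-same answer true  = refl
combine-same toss   false = refl
combine-same toss   true  = refl

gameValue-const : ∀ κs g h b → (∀ s → g (play κs s h) ≡ just b) → gameValue κs g h ≡ just b
gameValue-const []       g h b all = all []
gameValue-const (κ ∷ κs) g h b all = trans
  (cong₂ (combine κ) (gameValue-const κs g _ b (λ s → all (false ∷ s)))
                     (gameValue-const κs g _ b (λ s → all (true ∷ s))))
  (combine-same κ b)

isUniversal : Kind → Bool
isUniversal index  = true
isUniversal answer = true
isUniversal _      = false

combine-universal : ∀ κ → isUniversal κ ≡ true → ∀ v₀ v₁ b → combine κ v₀ v₁ ≡ just b → v₀ ≡ just b × v₁
  ≡ just b
combine-universal index  _ (just false) (just false) _ refl = refl , refl
combine-universal index  _ (just true)  (just true)  _ refl = refl , refl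
combine-universal answer _ (just false) (just false) _ refl = refl , refl
combine-universal answer _ (just true)  (just true)  _ refl = refl , refl
combine-universal index  _ (just false) (just true)  _ ()
combine-universal index  _ (just true)  (just false) _ ()
combine-universal index  _ (just false) nothing      _ ()
combine-universal index  _ (just true)  nothing      _ ()
combine-universal index  _ nothing      _            _ ()
combine-universal answer _ (just false) (just true)  _ ()
combine-universal answer _ (just true)  (just false) _ ()
combine-universal answer _ (just false) nothing      _ ()
combine-universal answer _ (just true)  nothing      _ ()
combine-universal answer _ nothing      _            _ ()

gameValue-universal : ∀ {κs} → All (λ κ → isUniversal κ ≡ true) κs → ∀ g h b → gameValue κs g h ≡ just b →
                      ∀ s → g (play κs s h) ≡ just b
gameValue-universal []       g h b eq s = eq
gameValue-universal {κ ∷ _} (u ∷ us) g h b eq s with combine-universal κ u _ _ b eq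
gameValue-universal (u ∷ us) g h b eq []          | eq₀ , _   = gameValue-universal us g _ b eq₀ []
gameValue-universal (u ∷ us) g h b eq (false ∷ s) | eq₀ , _   = gameValue-universal us g _ b eq₀ s
gameValue-universal (u ∷ us) g h b eq (true ∷ s)  | _   , eq₁ = gameValue-universal us g _ b eq₁ s

Wins : Value → Set
Wins v = isNothing v ≡ false

gameValue-exists : ∀ m κs g v h → length v ≡ m → Wins (gameValue κs g (play (replicate m exists) v h)) →
                   Wins (gameValue (replicate m exists ++ κs) g h)
gameValue-exists zero    κs g []      h len w = w
gameValue-exists (suc m) κs g (b ∷ v) h len w =
  one b (gameValue-exists m κs g v ((exists , b) ∷ h) (suc-injective len) w)
  where
  one : ∀ b → Wins (gameValue (replicate m exists ++ κs) g ((exists , b) ∷ h)) →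
        Wins (gameValue (replicate (suc m) exists ++ κs) g h)
  one false w with gameValue (replicate m exists ++ κs) g ((exists , false) ∷ h)
  ... | just _ = refl
  one true  w with gameValue (replicate m exists ++ κs) g ((exists , false) ∷ h)
  ... | just _  = refl
  ... | nothing = w

module Game (L : ℕ) where

  rounds : Kind → Kind → ℕ → List Kind → List Kind
  rounds κ α zero    κs = κs
  rounds κ α (suc m) κs = replicate L κ ++ α ∷ rounds κ α m κs

  universal : ℕ → List Kind
  universal m = rounds index answer m []

  -- `pivot` separates the moves of the two players and belongs to neither. Its place in the advice
  -- holds the value of f that the game has settled on by then, so that the verdict is read off like
  -- one more move. The last `L` rounds give the universal player room for a whole path of the
  -- decision tree.
  schedule : List Kind
  schedule = rounds exists query L (pivot ∷ universal L)

  All-universal : ∀ m → All (λ κ → isUniversal κ ≡ true) (universal m)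
  All-universal zero    = []
  All-universal (suc m) = go L
    where
    go : ∀ j → All (λ κ → isUniversal κ ≡ true) (replicate j index ++ answer ∷ universal m)
    go zero    = refl ∷ All-universal m
    go (suc j) = refl ∷ go j

  -- Indices of exactly `L` bits are what allows comparing them with addresses bit by bit, see
  -- `matches-value`. Between rounds the current index has to be empty, or else it would run on into
  -- the next one.
  Sized : List Cell → Set
  Sized h = All (λ e → length (proj₁ e) ≡ L) (entries h) × indexBits h ≡ []

  Sized-round : ∀ κ α → isIndex κ ≡ true → isAnswer κ ≡ false → isAnswer α ≡ true → isIndex α ≡ false →
                ∀ v b h → length v ≡ L → Sized h → Sized ((α , b) ∷ (tag κ v ʳ++ h))
  Sized-round κ α iκ aκ aα iα v b h len (all , eq) rewrite aα | iα | entries-tag κ aκ v h =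
    (trans (cong length (trans (indexBits-tag κ iκ v h) (cong (v ʳ++_) eq)))
      (trans (List.length-ʳ++ v {[]}) (trans (+-identityʳ _) len))) ∷ all , refl

  Sized-rounds : ∀ κ α → isIndex κ ≡ true → isAnswer κ ≡ false → isAnswer α ≡ true → isIndex α ≡ false →
                 ∀ κs → (∀ s h → Sized h → Sized (play κs s h)) →
                 ∀ m s h → Sized h → Sized (play (rounds κ α m κs) s h)
  Sized-rounds κ α iκ aκ aα iα κs next zero    s h sz = next s h sz
  Sized-rounds κ α iκ aκ aα iα κs next (suc m) s h sz
    with play-split (replicate L κ) (α ∷ rounds κ α m κs) s h
  ... | v , s′ , len , eq rewrite eq | play-replicate κ L v h (trans len (List.length-replicate L)) = tail s′
    where
    tail : ∀ s′ → Sized (play (α ∷ rounds κ α m κs) s′ (tag κ v ʳ++ h))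
    tail []       = Sized-rounds κ α iκ aκ aα iα κs next m [] _
      (Sized-round κ α iκ aκ aα iα v false h (trans len (List.length-replicate L)) sz)
    tail (b ∷ s′) = Sized-rounds κ α iκ aκ aα iα κs next m s′ _
      (Sized-round κ α iκ aκ aα iα v b h (trans len (List.length-replicate L)) sz)

  Sized-schedule : ∀ s → Sized (play schedule s [])
  Sized-schedule s = Sized-rounds exists query refl refl refl refl (pivot ∷ universal L) tail L s [] ([] , refl)
    where
    tail : ∀ s h → Sized h → Sized (play (pivot ∷ universal L) s h)
    tail []      h (sz , _) = Sized-rounds index answer refl refl refl refl [] (λ _ _ → id) L [] _ (sz , refl)
    tail (b ∷ s) h (sz , _) = Sized-rounds index answer refl refl refl refl [] (λ _ _ → id) L s _ (sz , refl)

  -- Winning strategies against decision trees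

  module _ {n : ℕ} (n≤2^L : n ≤ 2 ^ L) (f : Vec Bool n → Bool)
           (t : Tree n L) (t-correct : ∀ x → evaluate t x ≡ f x) where

    virtual : List Cell → Vec Bool n
    virtual h = Vec.tabulate (λ i → respond (entries h) (toℕ i) false)

    leafValue : List Cell → Value
    leafValue h = just (f (virtual h))

    -- The player names an index with its most significant bit first, because histories list the
    -- newest bit first and `value` wants the least significant one there.
    spell : ∀ (i : Fin n) → ∃[ v ] (length v ≡ L × value (v ʳ++ []) ≡ toℕ i)
    spell i with binary L (toℕ i) (<-≤-trans (Fin.toℕ<n i) n≤2^L)
    ... | u , len , val = List.reverse u , trans (List.length-reverse u) len ,
      trans (cong value (List.reverse-involutive u)) val

    -- The existential player walks down the tree and names the variable of each node. The subtree
    -- `s` has to agree with f on virtual inputs that continue `h` only, hence the quantification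
    -- over all later moves `e`. At a leaf f is constant on these, whatever is played.
    wins : ∀ m (s : Tree n m) h → indexBits h ≡ [] →
           (∀ e → evaluate s (virtual (e ++ h)) ≡ f (virtual (e ++ h))) →
           Wins (gameValue (rounds exists query m (pivot ∷ universal L)) leafValue h)
    wins m (leaf b) h eq correct
      rewrite gameValue-const (rounds exists query m (pivot ∷ universal L)) leafValue h b
                (λ s → let e , p = play-prefix (rounds exists query m (pivot ∷ universal L)) s h in
                       cong just (trans (cong (f ∘ virtual) p) (sym (correct e)))) = refl
    wins (suc m) (node i s₀ s₁) h eq correct with spell i
    ... | v , len , val = gameValue-exists L _ leafValue v h len
          (subst (λ h → Wins (gameValue (query ∷ rounds exists query m (pivot ∷ universal L)) leafValue h))
            (sym (play-replicate exists L v h len)) (both (answered false) (answered true)))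
      where
      both : ∀ {v₀ v₁} → Wins v₀ → Wins v₁ → Wins (combine query v₀ v₁)
      both {just _} w₀ w₁ = w₁
      h′ : Bool → List Cell
      h′ b = (query , b) ∷ (tag exists v ʳ++ h)
      told : Bool → Bool
      told b = respond (entries h) (toℕ i) b
      -- Since the earliest entry wins, later moves cannot overturn this bit: it is fixed by an
      -- older entry for `i` if there is one, and by `b` otherwise. The walk continues according to
      -- this bit, which may differ from `b`.
      told-correct : ∀ b e → Vec.lookup (virtual (e ++ h′ b)) i ≡ told b
      told-correct b e = begin
        Vec.lookup (virtual (e ++ h′ b)) i                                       ≡⟨ Vec.lookup∘tabulate _ i ⟩
        respond (entries (e ++ h′ b)) (toℕ i) false                              ≡⟨
          cong (λ es → respond es (toℕ i) false) (entries-++ e (h′ b) refl) ⟩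
        respond (entries e ++ entries (h′ b)) (toℕ i) false                      ≡⟨ respond-++ (entries e)
          (entries (h′ b)) (toℕ i) false ⟩
        respond (entries (h′ b)) (toℕ i) (respond (entries e) (toℕ i) false)     ≡⟨ cong₂
          (λ u es → respond ((u , b) ∷ es) (toℕ i) d)
                                                                                      (trans (indexBits-tag exists refl v h) (cong (v ʳ++_) eq)) (entries-tag exists refl v h) ⟩
        respond (entries h) (toℕ i) (if does (value (v ʳ++ []) ≟ toℕ i) then b else d) ≡⟨
          cong (λ z → respond (entries h) (toℕ i) (if z then b else d)) (dec-true (_ ≟ _) val) ⟩
        told b                                                                   ∎
        where
        open ≡-Reasoning
        d = respond (entries e) (toℕ i) false
      subtree : ∀ b → ∀ e → evaluate (if told b then s₁ else s₀) (virtual (e ++ h′ b)) ≡ f (virtual (e ++ h′ b))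
      subtree b e = trans
        (cong (λ z → evaluate (if z then s₁ else s₀) (virtual (e ++ h′ b))) (sym (told-correct b e)))
        (subst (λ h″ → evaluate (node i s₀ s₁) (virtual h″) ≡ f (virtual h″)) regroup
          (correct (e ++ (query , b) ∷ List.reverse (tag exists v))))
        where
        regroup : (e ++ (query , b) ∷ List.reverse (tag exists v)) ++ h ≡ e ++ h′ b
        regroup = trans (List.++-assoc e _ h)
          (cong (λ z → e ++ (query , b) ∷ z) (sym (List.ʳ++-defn (tag exists v))))
      answered : ∀ b → Wins (gameValue (rounds exists query m (pivot ∷ universal L)) leafValue (h′ b))
      answered b = wins m (if told b then s₁ else s₀) (h′ b) refl (subtree b)

    root-wins : Wins (gameValue schedule leafValue [])
    root-wins = wins L t [] refl (λ e → t-correct _)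

    bitAt : Vec Bool n → ℕ → Bool
    bitAt x i = fromMaybe false (Vec.toList x at i)

    Consistent : Vec Bool n → List Cell → Set
    Consistent x h = All (λ e → bitAt x (value (proj₁ e)) ≡ proj₂ e) (entries h)

    Present : List Cell → ℕ → Set
    Present h i = ∃[ e ] (e ∈ entries h × value (proj₁ e) ≡ i)

    respond-consistent : ∀ x i es b → All (λ e → bitAt x (value (proj₁ e)) ≡ proj₂ e) es →
      (bitAt x i ≡ b ⊎ ∃[ e ] (e ∈ es × value (proj₁ e) ≡ i)) → respond es i b ≡ bitAt x i
    respond-consistent x i []             b []       (inj₁ eq) = sym eq
    respond-consistent x i []             b []       (inj₂ (_ , () , _))
    respond-consistent x i ((u , c) ∷ es) b (p ∷ ps) q = go (value u ≟ i) q
      where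
      go : Dec (value u ≡ i) → (bitAt x i ≡ b ⊎ ∃[ e ] (e ∈ (u , c) ∷ es × value (proj₁ e) ≡ i)) →
           respond ((u , c) ∷ es) i b ≡ bitAt x i
      go (yes refl) _ rewrite dec-true (value u ≟ value u) refl = respond-consistent x i es c ps (inj₁ p)
      go (no ne)    _ with does (value u ≟ i) | dec-false (value u ≟ i) ne
      go (no ne) (inj₁ eq)                    | _ | refl = respond-consistent x i es b ps (inj₁ eq)
      go (no ne) (inj₂ (_ , here refl , val)) | _ | refl = contradiction val ne
      go (no ne) (inj₂ (e , there e∈ , val))  | _ | refl = respond-consistent x i es b ps (inj₂ (e , e∈ , val))

    at-toList : ∀ {n} (x : Vec Bool n) i → Vec.toList x at toℕ i ≡ just (Vec.lookup x i)
    at-toList (b ∷ x) zero    = refl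
    at-toList (b ∷ x) (suc i) = at-toList x i

    virtual-consistent : ∀ x h i → Consistent x h → Present h (toℕ i) →
                         Vec.lookup (virtual h) i ≡ Vec.lookup x i
    virtual-consistent x h i cons pres = trans (Vec.lookup∘tabulate _ i)
      (trans (respond-consistent x (toℕ i) (entries h) false cons (inj₂ pres))
             (cong (fromMaybe false) (at-toList x i)))

    record Follows (x : Vec Bool n) {m} (s : Tree n m) (h h′ : List Cell) : Set where
      field
        consistent : Consistent x h′
        grows      : ∀ {i} → Present h i → Present h′ i
        forces     : ∀ y → (∀ i → Present h′ (toℕ i) → Vec.lookup y i ≡ Vec.lookup x i) → evaluate s y
          ≡ evaluate s x

    -- The universal player can have the path of s on x queried.
    follow : ∀ x m (s : Tree n m) h → indexBits h ≡ [] → Consistent x h →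
             ∃[ bs ] Follows x s h (play (universal m) bs h)
    follow x zero (leaf b) h eq cons = [] , record { consistent = cons ; grows = id ; forces = λ _ _ → refl }
    follow x (suc m) s h eq cons = continue s refl
      where
      module _ (v : List Bool) (len : length v ≡ L) where

        i₀ : ℕ
        i₀ = value (v ʳ++ [])

        h₁ : List Cell
        h₁ = (answer , bitAt x i₀) ∷ (tag index v ʳ++ h)

        entries-h₁ : entries h₁ ≡ (v ʳ++ [] , bitAt x i₀) ∷ entries h
        entries-h₁ = cong₂ (λ u es → (u , bitAt x i₀) ∷ es)
          (trans (indexBits-tag index refl v h) (cong (v ʳ++_) eq)) (entries-tag index refl v h)

        next : ∀ (s′ : Tree n m) →
               (∀ y → (∀ i → toℕ i ≡ i₀ → Vec.lookup y i ≡ Vec.lookup x i) →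
                evaluate s′ y ≡ evaluate s′ x → evaluate s y ≡ evaluate s x) →
               ∃[ bs ] Follows x s h (play (universal (suc m)) bs h)
        next s′ lift
          with follow x m s′ h₁ refl (subst (All _) (sym entries-h₁) (refl ∷ cons))
        ... | bs , fol = v ++ bitAt x i₀ ∷ bs , subst (Follows x s h) (sym played) record
          { consistent = Follows.consistent fol
          ; grows      = λ (e , e∈ , val) →
            Follows.grows fol (e , subst (e ∈_) (sym entries-h₁) (there e∈) , val)
          ; forces     = λ y agree → lift y
              (λ i i≡ → agree i (Follows.grows fol
                ((v ʳ++ [] , bitAt x i₀) , subst ((v ʳ++ [] , bitAt x i₀) ∈_) (sym entries-h₁) (here refl) ,
                  sym i≡)))
              (Follows.forces fol y agree)
          }
          where
          played : play (universal (suc m)) (v ++ bitAt x i₀ ∷ bs) h ≡ play (universal m) bs h₁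
          played = trans (play-++ (replicate L index) (answer ∷ universal m) v (bitAt x i₀ ∷ bs) h
                           (trans len (sym (List.length-replicate L))))
                         (cong (λ z → play (universal m) bs ((answer , bitAt x i₀) ∷ z))
                           (play-replicate index L v h len))

      continue : (s′ : Tree n (suc m)) → s′ ≡ s → ∃[ bs ] Follows x s h (play (universal (suc m)) bs h)
      -- A leaf reached early leaves rounds over; they are spent on asking for position 0, answered
      -- in accordance with `x`.
      continue (leaf b) refl = next (replicate L false) (List.length-replicate L) (leaf b) (λ _ _ _ → refl)
      continue (node i s₀ s₁) refl with spell i
      ... | v , len , val = next v len (if Vec.lookup x i then s₁ else s₀) λ y agree eq′ →
        trans (cong (λ z → evaluate (if z then s₁ else s₀) y) (agree i (sym val))) eq′

    verdict-correct : ∀ x h b c → Consistent x h →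
                      gameValue (universal L) leafValue ((pivot , c) ∷ h) ≡ just b → f x ≡ b
    verdict-correct x h b c cons val with follow x L t ((pivot , c) ∷ h) refl cons
    ... | bs , fol = begin
      f x                                  ≡⟨ t-correct x ⟨
      evaluate t x                         ≡⟨ Follows.forces fol (virtual h′)
        (λ i → virtual-consistent x h′ i (Follows.consistent fol)) ⟨
      evaluate t (virtual h′)              ≡⟨ t-correct (virtual h′) ⟩
      f (virtual h′)                       ≡⟨ just-injective
        (gameValue-universal (All-universal L) leafValue _ b val bs) ⟩
      b                                    ∎
      where
      open ≡-Reasoning
      h′ = play (universal L) bs ((pivot , c) ∷ h)
      just-injective : ∀ {a b : Bool} → just a ≡ just b → a ≡ b
      just-injective refl = refl

-- The advice string

nth : {A : Set} → List A → ℕ → Maybe A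
nth []       i       = nothing
nth (x ∷ xs) zero    = just x
nth (x ∷ xs) (suc i) = nth xs i

at-nth : ∀ w i → w at i ≡ nth w i
at-nth []      zero    = refl
at-nth []      (suc i) = refl
at-nth (b ∷ w) zero    = refl
at-nth (b ∷ w) (suc i) = at-nth w i

value-< : ∀ u → value u < 2 ^ length u
value-< []      = s≤s z≤n
value-< (b ∷ u) = begin-strict
  indicator b + 2 * value u ≤⟨ +-monoˡ-≤ (2 * value u) (one b) ⟩
  1 + 2 * value u           <⟨ ≤-refl ⟩
  2 + 2 * value u           ≡⟨ *-suc 2 (value u) ⟨
  2 * suc (value u)         ≤⟨ *-monoʳ-≤ 2 (value-< u) ⟩
  2 * 2 ^ length u          ∎
  where
  open ≤-Reasoning
  one : ∀ b → indicator b ≤ 1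
  one false = z≤n
  one true  = ≤-refl

value-++ : ∀ u v → value (u ++ v) ≡ value u + 2 ^ length u * value v
value-++ []      v = sym (+-identityʳ _)
value-++ (b ∷ u) v = begin
  indicator b + 2 * value (u ++ v)                             ≡⟨ cong (λ z → indicator b + 2 * z)
    (value-++ u v) ⟩
  indicator b + 2 * (value u + 2 ^ length u * value v)         ≡⟨ cong (indicator b +_)
    (*-distribˡ-+ 2 (value u) _) ⟩
  indicator b + (2 * value u + 2 * (2 ^ length u * value v))   ≡⟨ +-assoc (indicator b) _ _ ⟨
  indicator b + 2 * value u + 2 * (2 ^ length u * value v)     ≡⟨ cong (indicator b + 2 * value u +_)
    (*-assoc 2 (2 ^ length u) (value v)) ⟨
  indicator b + 2 * value u + 2 ^ suc (length u) * value v     ∎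
  where open ≡-Reasoning

module _ {A : Set} where

  nth-++ : ∀ (xs ys : List A) i → nth (xs ++ ys) (length xs + i) ≡ nth ys i
  nth-++ []       ys i = refl
  nth-++ (x ∷ xs) ys i = nth-++ xs ys i

  nth-++ˡ : ∀ (xs ys : List A) i x → nth xs i ≡ just x → nth (xs ++ ys) i ≡ just x
  nth-++ˡ (_ ∷ xs) ys zero    x eq = eq
  nth-++ˡ (_ ∷ xs) ys (suc i) x eq = nth-++ˡ xs ys i x eq

  nth-replicate : ∀ n (x : A) i → i < n → nth (replicate n x) i ≡ just x
  nth-replicate (suc n) x zero    lt       = refl
  nth-replicate (suc n) x (suc i) (s≤s lt) = nth-replicate n x i lt

  pairs↑ pairs↓ : List (A × A) → List A
  pairs↑ []             = []
  pairs↑ ((x , y) ∷ ps) = x ∷ y ∷ pairs↑ ps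
  pairs↓ []             = []
  pairs↓ ((x , y) ∷ ps) = y ∷ x ∷ pairs↓ ps

  pairs-ʳ++ : ∀ ps qs ys → pairs↓ ps ʳ++ (pairs↑ qs ++ ys) ≡ pairs↑ (ps ʳ++ qs) ++ ys
  pairs-ʳ++ []       qs ys = refl
  pairs-ʳ++ (p ∷ ps) qs ys = pairs-ʳ++ ps (p ∷ qs) ys

  nth-pairs : ∀ ps ys i b x y → nth ps i ≡ just (x , y) →
              nth (pairs↑ ps ++ ys) (indicator b + 2 * i) ≡ just (if b then y else x)
  nth-pairs (p ∷ ps) ys zero    false x y refl = refl
  nth-pairs (p ∷ ps) ys zero    true  x y refl = refl
  nth-pairs (p ∷ ps) ys (suc i) b     x y eq   =
    trans (cong (nth (pairs↑ (p ∷ ps) ++ ys))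
      (trans (cong (indicator b +_) (*-suc 2 i)) (move-2 (indicator b) (2 * i))))
          (nth-pairs ps ys i b x y eq)
    where
    move-2 : ∀ a c → a + (2 + c) ≡ 2 + (a + c)
    move-2 a c = trans (sym (+-assoc a 2 c)) (trans (cong (_+ c) (+-comm a 2)) (+-assoc 2 a c))

-- The values of F on the histories with given kinds, in decreasing order of
-- the number whose least significant bit is the most recent one.
table : {A : Set} → List Kind → (List Cell → A) → List A
table []       F = F [] ∷ []
table (κ ∷ κs) F = pairs↓ (table κs (λ h → F ((κ , false) ∷ h) , F ((κ , true) ∷ h)))

length-pairs↓ : ∀ {A : Set} (ps : List (A × A)) → length (pairs↓ ps) ≡ 2 * length ps
length-pairs↓ []       = refl
length-pairs↓ (p ∷ ps) = trans (cong (2 +_) (length-pairs↓ ps)) (sym (*-suc 2 (length ps)))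

length-table : ∀ {A : Set} κs (F : List Cell → A) → length (table κs F) ≡ 2 ^ length κs
length-table []       F = refl
length-table (κ ∷ κs) F = trans (length-pairs↓ (table κs _)) (cong (2 *_) (length-table κs _))

map-pairs↓ : ∀ {A B : Set} (φ : A → B) ps → map φ (pairs↓ ps)
  ≡ pairs↓ (map (λ p → φ (proj₁ p) , φ (proj₂ p)) ps)
map-pairs↓ φ []       = refl
map-pairs↓ φ (p ∷ ps) = cong (λ z → φ (proj₂ p) ∷ φ (proj₁ p) ∷ z) (map-pairs↓ φ ps)

map-table : ∀ {A B : Set} κs (φ : A → B) (F : List Cell → A) → map φ (table κs F) ≡ table κs (φ ∘ F)
map-table []       φ F = refl
map-table (κ ∷ κs) φ F = trans (map-pairs↓ φ (table κs _)) (cong pairs↓ (map-table κs _ _))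

kinds : List Cell → List Kind
kinds = map proj₁

bits : List Cell → List Bool
bits = map proj₂

-- Reversing the table brings it into increasing order, so a history is found at the number spelled
-- by its own bits.
nth-table : ∀ {A : Set} h (F : List Cell → A) ys → nth (table (kinds h) F ʳ++ ys) (value (bits h)) ≡ just (F h)
nth-table []            F ys = refl
nth-table ((κ , b) ∷ h) F ys = trans
  (cong (λ zs → nth zs (value (b ∷ bits h))) (pairs-ʳ++ (table (kinds h) F₂) [] ys))
  (trans (nth-pairs (table (kinds h) F₂ ʳ++ []) ys (value (bits h)) b _ _ (nth-table h F₂ []))
         (cong just (choose b)))
  where
  F₂ = λ h → F ((κ , false) ∷ h) , F ((κ , true) ∷ h)
  choose : ∀ b → (if b then F ((κ , true) ∷ h) else F ((κ , false) ∷ h)) ≡ F ((κ , b) ∷ h)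
  choose false = refl
  choose true  = refl

-- Only the moves made by the follower need advice. Type bit 1 sends it to the input, type bit 0 to
-- the choice bit, which is the next bit of a winning move or, at the pivot, the value of f.
emits typeBit : Kind → Bool
emits exists  = true
emits query   = true
emits pivot   = true
emits _       = false
typeBit query = true
typeBit _     = false

choiceBit : Kind → Value → Value → Bool
choiceBit exists v₀ v₁ = isNothing v₀
choiceBit pivot  v₀ v₁ = fromMaybe false v₀
choiceBit _      v₀ v₁ = false

module Advice (g : List Cell → Value) where

  options : Kind → List Kind → List Cell → Value × Value
  options κ κs h = gameValue κs g ((κ , false) ∷ h) , gameValue κs g ((κ , true) ∷ h)

  choices : List Kind → Kind → List Kind → List Bool
  choices K κ κs = table K (uncurry (choiceBit κ) ∘ options κ κs)

  -- The blocks of advice for the histories of kinds K and longer, κs being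
  -- the kinds still to come: for each length, the type bits of all histories
  -- are followed by their choice bits.
  blocks : List Kind → List Kind → List Bool
  blocks K []       = []
  blocks K (κ ∷ κs) = if emits κ
    then replicate (2 ^ length K) (typeBit κ) ++ (choices K κ κs ʳ++ blocks (κ ∷ K) κs)
    else blocks (κ ∷ K) κs

  -- The two leading bits occupy the addresses 0 and 1, which are not used.
  advice : List Kind → List Bool
  advice κs = false ∷ false ∷ blocks [] κs

  -- Numbering as in a binary heap: the leading 1 tells histories of different lengths apart, and
  -- the bit `s` selects between type and choice. The history, newest bit first, is already the low
  -- part of its own address, so the follower copies instead of calculating.
  address : List Cell → Bool → List Bool
  address h s = bits h ++ s ∷ true ∷ []

  record At (w : List Bool) (h : List Cell) (κs : List Kind) : Set where
    field
      prefix   : List Bool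
      length-≡ : length prefix ≡ 2 ^ suc (length h)
      split    : w ≡ prefix ++ blocks (kinds h) κs

  At-root : ∀ κs → At (advice κs) [] κs
  At-root κs = record { prefix = false ∷ false ∷ [] ; length-≡ = refl ; split = refl }

  address-value : ∀ h s → value (address h s) ≡ 2 ^ suc (length h)
    + (2 ^ length h * indicator s + value (bits h))
  address-value h s = begin
    value (address h s)                                            ≡⟨ value-++ (bits h) (s ∷ true ∷ []) ⟩
    value (bits h) + 2 ^ length (bits h) *
      (indicator s + 2)       ≡⟨ cong (λ m → value (bits h) + 2 ^ m * (indicator s + 2))
        (List.length-map proj₂ h) ⟩
    value (bits h) + 2 ^ length h * (indicator s + 2)              ≡⟨ +-comm (value (bits h)) _ ⟩
    2 ^ length h * (indicator s + 2)
      + value (bits h)              ≡⟨ cong (_+ value (bits h)) (*-distribˡ-+ (2 ^ length h) (indicator s) 2) ⟩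
    2 ^ length h * indicator s + 2 ^ length h * 2
      + value (bits h) ≡⟨ cong (_+ value (bits h)) (+-comm (2 ^ length h * indicator s) _) ⟩
    2 ^ length h * 2 + 2 ^ length h * indicator s + value (bits h) ≡⟨ +-assoc (2 ^ length h * 2) _ _ ⟩
    2 ^ length h * 2 + (2 ^ length h * indicator s + value (bits h)) ≡⟨
      cong (_+ (2 ^ length h * indicator s + value (bits h))) (*-comm (2 ^ length h) 2) ⟩
    2 ^ suc (length h) + (2 ^ length h * indicator s + value (bits h)) ∎
    where open ≡-Reasoning

  at-block : ∀ {w h κs} → At w h κs → ∀ s →
             w at value (address h s) ≡ nth (blocks (kinds h) κs) (2 ^ length h * indicator s + value (bits h))
  at-block {w} {h} {κs} a s = begin
    w at value (address h s)                     ≡⟨ at-nth w _ ⟩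
    nth w (value (address h s))                  ≡⟨ cong₂ nth split
      (trans (address-value h s) (cong (_+ j) (sym length-≡))) ⟩
    nth (prefix ++ blocks (kinds h) κs) (length prefix + j) ≡⟨ nth-++ prefix _ j ⟩
    nth (blocks (kinds h) κs) j                  ∎
    where
    open ≡-Reasoning
    open At a
    j = 2 ^ length h * indicator s + value (bits h)

  length-kinds : ∀ h → length (kinds h) ≡ length h
  length-kinds = List.length-map proj₁

  at-type : ∀ {w h κ κs} → emits κ ≡ true → At w h (κ ∷ κs) → w at value (address h false) ≡ just (typeBit κ)
  at-type {w} {h} {κ} {κs} em a rewrite at-block a false | em | *-zeroʳ (2 ^ length h) =
    nth-++ˡ (replicate (2 ^ length (kinds h)) (typeBit κ)) _ _ _
      (nth-replicate (2 ^ length (kinds h)) (typeBit κ) _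
      (<-≤-trans (value-< (bits h)) (≤-reflexive
        (cong (2 ^_) (trans (List.length-map proj₂ h) (sym (length-kinds h)))))))

  at-choice : ∀ {w h κ κs} → emits κ ≡ true → At w h (κ ∷ κs) →
              w at value (address h true) ≡ just (uncurry (choiceBit κ) (options κ κs h))
  at-choice {w} {h} {κ} {κs} em a rewrite at-block a true | em = trans
    (cong (λ j → nth (types ++ rest′) (j + value (bits h))) lengths)
    (trans (nth-++ types rest′ (value (bits h))) (nth-table h _ _))
    where
    types = replicate (2 ^ length (kinds h)) (typeBit κ)
    rest′ = choices (kinds h) κ κs ʳ++ blocks (κ ∷ kinds h) κs
    lengths : 2 ^ length h * 1 ≡ length types
    lengths = trans (*-identityʳ _)
      (trans (cong (2 ^_) (sym (length-kinds h))) (sym (List.length-replicate (2 ^ length (kinds h)))))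

  -- A level stores two bits for each of `2 ^ length h` histories, exactly as many bits as precede
  -- it, the two leading ones included. So the prefix doubles, in step with the leading 1 of the
  -- address.
  At-next : ∀ {w h κ κs} → emits κ ≡ true → At w h (κ ∷ κs) → ∀ b → At w ((κ , b) ∷ h) κs
  At-next {w} {h} {κ} {κs} em a b = record
    { prefix   = prefix ++ (types ++ (cs ʳ++ []))
    ; length-≡ = trans (List.length-++ prefix) (cong₂ _+_ length-≡ (trans lengths (sym (+-identityʳ _))))
    ; split    = trans split (trans (cong (prefix ++_) regroup) (sym (List.++-assoc prefix _ _)))
    }
    where
    open At a
    types = replicate (2 ^ length (kinds h)) (typeBit κ)
    cs = choices (kinds h) κ κs
    lengths : length (types ++ (cs ʳ++ [])) ≡ 2 ^ suc (length h)
    lengths = trans (List.length-++ types) (cong₂ _+_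
      (trans (List.length-replicate (2 ^ length (kinds h))) (cong (2 ^_) (length-kinds h)))
      (trans (List.length-ʳ++ cs) (cong (_+ 0)
        (trans (length-table (kinds h) _) (cong (2 ^_) (length-kinds h))))))
    regroup : blocks (kinds h) (κ ∷ κs) ≡ (types ++ (cs ʳ++ [])) ++ blocks (κ ∷ kinds h) κs
    regroup rewrite em = trans (cong (types ++_) (List.ʳ++-defn cs))
      (sym (List.++-assoc types (cs ʳ++ []) _))

  -- The follower notices the end of its moves by an address beyond the end of the advice.
  at-end : ∀ {w h κs} → blocks (kinds h) κs ≡ [] → At w h κs → ∀ s → w at value (address h s) ≡ nothing
  at-end eq a s = trans (at-block a s) (cong (λ z → nth z _) eq)

  blocks-universal : ∀ {κs} → All (λ κ → isUniversal κ ≡ true) κs → ∀ K → blocks K κs ≡ []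
  blocks-universal []                  K = refl
  blocks-universal {index ∷ _}  (_ ∷ us) K = blocks-universal us _
  blocks-universal {answer ∷ _} (_ ∷ us) K = blocks-universal us _

-- The machine that follows the advice

module Follower where

  -- `nothing` marks the bottom of the history; `just (a , b)` is the bit b, and
  -- a tells whether it is an answer.
  Mark : Set
  Mark = Maybe (Bool × Bool)

  open Language 2 Mark 2 public

  inp adv hst reg : Fin 5
  inp = zero
  adv = suc zero
  hst = suc (suc (suc zero))
  reg = suc (suc (suc (suc zero)))

  isMark isBlank : Sym → Bool
  isMark (aux nothing) = true
  isMark _             = false
  isBlank blank        = true
  isBlank _            = false

  recorded : Sym → Bool
  recorded (aux (just (_ , b))) = b
  recorded _                    = false

  -- Answers do not become bits on the input address tape, so that its contents
  -- end where the current index does.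
  addressed : Sym → Sym
  addressed (aux (just (false , b))) = bit b
  addressed s                        = s

  onAdvice onInput : Reads → Maybe Bool
  onInput  r = Vec.lookup r zero
  onAdvice r = Vec.lookup r (suc zero)

  mark : Sym
  mark = aux nothing

  goLeft goRight : Fin 5 → Cmd
  goLeft  i = upd i (λ _ s → Vec.lookup s i , left)
  goRight i = upd i (λ _ s → Vec.lookup s i , right)

  put : Fin 5 → Sym → Move → Cmd
  put i s d = upd i (λ _ _ → s , d)

  -- One history yields both addresses: as a whole it is the address in the advice, and its newest
  -- bits back to the last answer are the index to read from the input. Each round lays out both
  -- afresh, fetches one bit into `reg`, clears the address tapes and appends the bit. A mark in
  -- `reg` says that the advice is exhausted.
  copyCell uncopyCell copy ask uncopy append round program : Cmd
  copyCell = upd adv (λ _ s → bit (recorded (Vec.lookup s hst)) , right)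
           ⨟ upd inp (λ _ s → addressed (Vec.lookup s hst) , right)
           ⨟ goLeft hst
  copy = goLeft hst ⨟ while (λ _ s → not (isMark (Vec.lookup s hst))) copyCell
       ⨟ put adv (bit false) right ⨟ put adv (bit true) stay
  ask = branch (λ r _ → isNothing (onAdvice r)) (put reg mark stay)
       (branch (λ r _ → fromMaybe false (onAdvice r))
         (upd reg (λ r _ → aux (just (true , fromMaybe false (onInput r))) , stay))
         (goLeft adv ⨟ put adv (bit true) right
          ⨟ upd reg (λ r _ → aux (just (false , fromMaybe false (onAdvice r))) , stay)))
  uncopyCell = put adv blank left ⨟ goLeft inp ⨟ put inp blank stay ⨟ goRight hst
  uncopy = put adv blank left ⨟ put adv blank left ⨟ goRight hst
         ⨟ while (λ _ s → not (isBlank (Vec.lookup s hst))) uncopyCell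
  append = branch (λ _ s → isMark (Vec.lookup s reg)) skip (upd hst (λ _ s → Vec.lookup s reg , right))
  round = copy ⨟ ask ⨟ uncopy ⨟ append
  program = put hst mark right ⨟ while (λ _ s → not (isMark (Vec.lookup s reg))) round ⨟ goLeft hst

  -- When `program` ends, the head stands on the newest bit of the history, that of the pivot.
  accepting : Reads → Scan → Bool
  accepting _ s = recorded (Vec.lookup s hst)

  Finite-Mark : Finite Mark
  Finite-Mark = Finite-Maybe (Finite-× Finite-Bool Finite-Bool)

  written : Cell → Sym
  written (κ , b) = aux (just (isAnswer κ , b))

  leftward rightward : List Cell → List Cell → Tape Mark
  leftward []      r = tape [] mark (map written r)
  leftward (c ∷ l) r = tape (map written l ++ mark ∷ []) (written c) (map written r)
  rightward l []      = tape (map written l ++ mark ∷ []) blank []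
  rightward l (c ∷ r) = tape (map written l ++ mark ∷ []) (written c) (map written r)

  stack top : List Sym → Tape Mark
  stack ss       = tape ss blank []
  top []         = blankTape
  top (s ∷ ss)   = tape ss s []

  store : Tape Mark → Tape Mark → Tape Mark → Sym → Store
  store i a h r = i ∷ a ∷ blankTape ∷ h ∷ tape [] r [] ∷ []

  adviceSym inputSym : Cell → Sym
  adviceSym c = bit (proj₂ c)
  inputSym c  = addressed (written c)

  leadingBits-advice : ∀ h ss → leadingBits (map adviceSym h ++ ss) ≡ bits h ++ leadingBits ss
  leadingBits-advice []      ss = refl
  leadingBits-advice (c ∷ h) ss = cong (proj₂ c ∷_) (leadingBits-advice h ss)

  Exploring : List Cell → Set
  Exploring = All (λ c → isAnswer (proj₁ c) ≡ not (isIndex (proj₁ c)))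

  leadingBits-input : ∀ {h} → Exploring h → leadingBits (map inputSym h ++ blank ∷ []) ≡ indexBits h
  leadingBits-input []                     = refl
  leadingBits-input (_∷_ {κ , b} eq ex) rewrite eq with isIndex κ
  ... | true  = cong (b ∷_) (leadingBits-input ex)
  ... | false = refl

  roundCost : ℕ → ℕ
  roundCost ℓ = (1 + (loop 3 ℓ + (1 + 1))) + (5 + ((1 + (1 + (1 + loop 4 ℓ))) + 2))

  roundCost-mono : ∀ i j → i ≤ j → roundCost i ≤ roundCost j
  roundCost-mono i j le = +-mono-≤ (+-monoʳ-≤ 1 (+-monoˡ-≤ 2 (loop-mono 3 le)))
    (+-monoʳ-≤ 5 (+-monoˡ-≤ 2 (+-monoʳ-≤ 3 (loop-mono 4 le))))

  module Run (x w : List Bool) where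

    open Semantics (x ∷ w ∷ []) public

    copy-loop : ∀ h r is as g →
      Exec (while (λ _ s → not (isMark (Vec.lookup s hst))) copyCell)
           (store (stack is) (stack as) (leftward h r) g)
           (store (stack (map inputSym h ʳ++ is)) (stack (map adviceSym h ʳ++ as)) (leftward [] (h ʳ++ r)) g)
           (loop 3 (length h))
    copy-loop []            r is as g = finish refl
    copy-loop (c ∷ [])      r is as g =
      again refl (upd⇓ refl ⨟⇓ upd⇓ refl ⨟⇓ upd⇓ refl) (copy-loop [] (c ∷ r) _ _ g)
    copy-loop (c ∷ c′ ∷ h)  r is as g =
      again refl (upd⇓ refl ⨟⇓ upd⇓ refl ⨟⇓ upd⇓ refl) (copy-loop (c′ ∷ h) (c ∷ r) _ _ g)

    uncopy-loop : ∀ l r is as g → length is ≡ length r → length as ≡ length r →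
      Exec (while (λ _ s → not (isBlank (Vec.lookup s hst))) uncopyCell)
           (store (stack is) (top as) (rightward l r) g)
           (store blankTape blankTape (rightward (r ʳ++ l) []) g)
           (loop 4 (length r))
    uncopy-loop l []      []       []             g _  _  = finish refl
    uncopy-loop l (c ∷ r) (i ∷ is) (a ∷ as)       g eq eq′ =
      again refl (upd⇓ {τ = store (stack (i ∷ is)) (top as) (rightward l (c ∷ r)) g} (pop as)
                  ⨟⇓ upd⇓ refl ⨟⇓ upd⇓ refl ⨟⇓ upd⇓ (step r))
        (uncopy-loop (c ∷ l) r is as g (suc-injective eq) (suc-injective eq′))
      where
      pop : ∀ as → store (stack (i ∷ is)) (actᵗ (blank , left) (top (a ∷ as))) (rightward l (c ∷ r)) g
                   ≡ store (stack (i ∷ is)) (top as) (rightward l (c ∷ r)) g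
      pop []       = refl
      pop (_ ∷ as) = refl
      step : ∀ r → store (stack is) (top as) (actᵗ (written c , right) (rightward l (c ∷ r))) g
                   ≡ store (stack is) (top as) (rightward (c ∷ l) r) g
      step []      = refl
      step (_ ∷ r) = refl

    inputCopy adviceCopy : List Cell → List Sym
    inputCopy h  = map inputSym h ʳ++ []
    adviceCopy h = map adviceSym h ʳ++ []

    asking : List Cell → Bool → Sym → Store
    asking h s g = store (stack (inputCopy h)) (tape (bit s ∷ adviceCopy h) (bit true) [])
      (leftward [] (h ʳ++ [])) g

    rest-at : List Cell → Tape Mark
    rest-at h = rightward h []

    copy-run : ∀ h g → Exec copy (store blankTape blankTape (rest-at h) g) (asking h false g)
                            (1 + (loop 3 (length h) + (1 + 1)))
    copy-run []      g = upd⇓ refl ⨟⇓ copy-loop [] [] [] [] g ⨟⇓ upd⇓ refl ⨟⇓ upd⇓ refl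
    copy-run (c ∷ h) g = upd⇓ refl ⨟⇓ copy-loop (c ∷ h) [] [] [] g ⨟⇓ upd⇓ refl ⨟⇓ upd⇓ refl

    -- The constant game is a dummy: the address of a history is the same for every game.
    asking-advice : ∀ h s g → onAdvice (reads (asking h s g)) ≡ w at value (Advice.address (λ _ → nothing) h s)
    asking-advice h s g = cong (λ u → w at value u) (trans
      (cong leadingBits (trans (List.ʳ++-ʳ++ (map adviceSym h)) refl))
      (leadingBits-advice h (bit s ∷ bit true ∷ [])))

    asking-input : ∀ h s g → Exploring h → onInput (reads (asking h s g)) ≡ x at value (indexBits h)
    asking-input h s g ex = cong (λ u → x at value u)
      (trans (cong leadingBits (List.ʳ++-ʳ++ (map inputSym h))) (leadingBits-input ex))

    length-copy : ∀ (φ : Cell → Sym) h → length (map φ h ʳ++ []) ≡ length (h ʳ++ [])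
    length-copy φ h = trans (cong length (sym (List.map-ʳ++ φ h {[]}))) (List.length-map φ (h ʳ++ []))

    uncopy-run : ∀ h s g → Exec uncopy (asking h s g) (store blankTape blankTape (rest-at h) g)
                                (1 + (1 + (1 + loop 4 (length h))))
    uncopy-run h s g = upd⇓ refl ⨟⇓ upd⇓ {τ =
      store (stack (inputCopy h)) (top (adviceCopy h)) (leftward [] (h ʳ++ [])) g} (pop (adviceCopy h))
      ⨟⇓ upd⇓ (begin-right (h ʳ++ []))
      ⨟⇓ takes (cong (loop 4) (List.length-reverse h))
        (ends-in (cong (λ h′ → store blankTape blankTape (rest-at h′) g) (List.reverse-involutive h))
           (uncopy-loop [] (h ʳ++ []) (inputCopy h) (adviceCopy h) g (length-copy inputSym h)
             (length-copy adviceSym h)))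
      where
      pop : ∀ as → store (stack (inputCopy h)) (actᵗ (blank , left) (tape as (bit s) []))
        (leftward [] (h ʳ++ [])) g
                   ≡ store (stack (inputCopy h)) (top as) (leftward [] (h ʳ++ [])) g
      pop []       = refl
      pop (_ ∷ as) = refl
      begin-right : ∀ r → store (stack (inputCopy h)) (top (adviceCopy h))
        (actᵗ (mark , right) (leftward [] r)) g
                          ≡ store (stack (inputCopy h)) (top (adviceCopy h)) (rightward [] r) g
      begin-right []      = refl
      begin-right (_ ∷ _) = refl

    resting : List Cell → Sym → Store
    resting h g = store blankTape blankTape (rest-at h) g

    round-append : ∀ h g s c → Exec ask (asking h false g) (asking h s (written c)) 5 →
                   Exec round (resting h g) (resting (c ∷ h) (written c)) (roundCost (length h))
    round-append h g s c asked = copy-run h g ⨟⇓ asked ⨟⇓ uncopy-run h s (written c) ⨟⇓ else⇓ refl (upd⇓ refl)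

    round-stop : ∀ h g → onAdvice (reads (asking h false g)) ≡ nothing →
                 Exec round (resting h g) (resting h mark) (roundCost (length h))
    round-stop h g eq = copy-run h g ⨟⇓ weaken {n′ = 5} (s≤s (s≤s z≤n)) (then⇓ (cong isNothing eq) (upd⇓ refl))
      ⨟⇓ uncopy-run h false mark ⨟⇓ then⇓ refl skip⇓

    ask-choice : ∀ h g κ b → isAnswer κ ≡ false →
                 onAdvice (reads (asking h false g)) ≡ just false → onAdvice (reads (asking h true g))
                   ≡ just b →
                 Exec ask (asking h false g) (asking h true (written (κ , b))) 5
    ask-choice h g κ b κ-choice eq eq′ = else⇓ (cong isNothing eq) (else⇓ (cong (fromMaybe false) eq)
      (upd⇓ refl ⨟⇓ upd⇓ refl ⨟⇓ upd⇓ (cong₂ (λ a c → asking h true (aux (just (a , c))))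
        (sym κ-choice) (cong (fromMaybe false) eq′))))

    ask-answer : ∀ h g b → onAdvice (reads (asking h false g)) ≡ just true →
                 fromMaybe false (onInput (reads (asking h false g))) ≡ b →
                 Exec ask (asking h false g) (asking h false (written (query , b))) 5
    ask-answer h g b eq eq′ = weaken (s≤s (s≤s (s≤s z≤n)))
      (else⇓ (cong isNothing eq) (then⇓ (cong (fromMaybe false) eq)
      (upd⇓ (cong (λ c → asking h false (aux (just (true , c)))) eq′))))

  -- One round for each move explored, one for the pivot, and one that finds the end of the advice.
  followCost : ℕ → ℕ
  followCost L = 1 + (loop (roundCost (length explored + 1)) (suc (suc (length explored))) + 1)
    where explored = Game.rounds L exists query L []

  module Walk (L : ℕ) {n : ℕ} (n≤2^L : n ≤ 2 ^ L) (f : Vec Bool n → Bool)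
              (t : Tree n L) (t-correct : ∀ x → evaluate t x ≡ f x) (x : Vec Bool n) where

    open Game L
    open Advice (leafValue n≤2^L f t t-correct)

    leaves : List Cell → Value
    leaves = leafValue n≤2^L f t t-correct

    w : List Bool
    w = advice schedule

    open Run (Vec.toList x) w

    data Exploration : Kind → Set where
      exists : Exploration exists
      query  : Exploration query

    -- Move 0 is taken unless it loses, and if it loses the win must come from move 1.
    wins-choice : ∀ κs h → Wins (gameValue (exists ∷ κs) leaves h) →
                  Wins (gameValue κs leaves ((exists ,
                    isNothing (gameValue κs leaves ((exists , false) ∷ h))) ∷ h))
    wins-choice κs h win with gameValue κs leaves ((exists , false) ∷ h) in eq
    ... | just _ rewrite eq = refl
    ... | nothing = win

    wins-answer : ∀ κs h → Wins (gameValue (query ∷ κs) leaves h) → ∀ b →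
      Wins (gameValue κs leaves ((query , b) ∷ h))
    wins-answer κs h win b with gameValue κs leaves ((query , false) ∷ h) in eq
    wins-answer κs h win false | just _ rewrite eq = refl
    wins-answer κs h win true  | just _ = win
    wins-answer κs h ()  _     | nothing

    wins-pivot : ∀ κs h → Wins (gameValue (pivot ∷ κs) leaves h) →
                 gameValue κs leaves ((pivot , false) ∷ h)
                   ≡ just (uncurry (choiceBit pivot) (options pivot κs h))
    wins-pivot κs h win with gameValue κs leaves ((pivot , false) ∷ h)
    ... | just b = refl
    wins-pivot κs h () | nothing

    guard : Reads → Scan → Bool
    guard _ s = not (isMark (Vec.lookup s reg))

    -- The invariant: the game is won from `h`, and the answers in `h` are bits of `x`. `N` bounds
    -- the length of all histories to come, so that one cost serves for every round.
    walk : ∀ N κs → All Exploration κs → ∀ h g → isMark g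
      ≡ false → Exploring h → Consistent n≤2^L f t t-correct x h →
           length κs + suc (length h) ≤ N →
           At w h (κs ++ pivot ∷ universal L) → Wins (gameValue (κs ++ pivot ∷ universal L) leaves h) →
           ∃[ h′ ] Exec (while guard round) (resting h g) (resting ((pivot , f x) ∷ h′) mark)
                        (loop (roundCost N) (suc (suc (length κs))))
    walk N [] [] h g ok ex cons le loc win = h ,
      ends-in (cong (λ b → resting ((pivot , b) ∷ h) mark)
        (sym (verdict-correct n≤2^L f t t-correct x h b false cons (wins-pivot (universal L) h win))))
        (again {j = 1} (cong not ok) (weaken (roundCost-mono (length h) N (<⇒≤ le))
          (round-append h g true (pivot , b)
           (ask-choice h g pivot b refl
             (trans (asking-advice h false g) (at-type {κs = universal L} refl loc))
             (trans (asking-advice h true g) (at-choice {κs = universal L} refl loc)))))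
         -- The round after the pivot appends nothing and only puts the mark that stops the loop.
         (again {j = 0} refl (weaken (roundCost-mono (suc (length h)) N le)
           (round-stop ((pivot , b) ∷ h) (written (pivot , b))
           (trans (asking-advice ((pivot , b) ∷ h) false (written (pivot , b)))
             (at-end (blocks-universal (All-universal L) _) (At-next {κs = universal L} refl loc b) false))))
          (finish refl)))
      where b = uncurry (choiceBit pivot) (options pivot (universal L) h)
    walk N (exists ∷ κs) (exists ∷ es) h g ok ex cons le loc win =
      map₂ (again (cong not ok) (weaken
        (roundCost-mono (length h) N (≤-trans (m≤n+m (length h) _)
          (≤-trans (+-monoʳ-≤ (length (exists ∷ κs)) (n≤1+n (length h))) le)))
        (round-append h g true (exists , b) (ask-choice h g exists b refl
             (trans (asking-advice h false g) (at-type {κs = κs ++ pivot ∷ universal L} refl loc))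
             (trans (asking-advice h true g) (at-choice {κs = κs ++ pivot ∷ universal L} refl loc))))))
        (walk N κs es ((exists , b) ∷ h) (written (exists , b)) refl (refl ∷ ex) cons
          (subst (_≤ N) (sym (+-suc (length κs) (suc (length h)))) le)
          (At-next {κs = κs ++ pivot ∷ universal L} refl loc b) (wins-choice (κs ++ pivot ∷ universal L) h win))
      where b = uncurry (choiceBit exists) (options exists (κs ++ pivot ∷ universal L) h)
    walk N (query ∷ κs) (query ∷ es) h g ok ex cons le loc win =
      map₂ (again (cong not ok) (weaken
        (roundCost-mono (length h) N (≤-trans (m≤n+m (length h) _)
          (≤-trans (+-monoʳ-≤ (length (query ∷ κs)) (n≤1+n (length h))) le)))
        (round-append h g false (query , b) (ask-answer h g b
             (trans (asking-advice h false g) (at-type {κs = κs ++ pivot ∷ universal L} refl loc))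
             (cong (fromMaybe false) (asking-input h false g ex))))))
        (walk N κs es ((query , b) ∷ h) (written (query , b)) refl (refl ∷ ex) (refl ∷ cons)
          (subst (_≤ N) (sym (+-suc (length κs) (suc (length h)))) le)
          (At-next {κs = κs ++ pivot ∷ universal L} refl loc b)
            (wins-answer (κs ++ pivot ∷ universal L) h win b))
      where b = bitAt n≤2^L f t t-correct x (value (indexBits h))

    explored : List Kind
    explored = rounds exists query L []

    rounds-++ : ∀ m κs → rounds exists query m κs ≡ rounds exists query m [] ++ κs
    rounds-++ zero    κs = refl
    rounds-++ (suc m) κs = trans (cong (λ z → replicate L exists ++ query ∷ z) (rounds-++ m κs))
      (sym (List.++-assoc (replicate L exists) (query ∷ rounds exists query m []) κs))

    All-explored : ∀ m → All Exploration (rounds exists query m [])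
    All-explored zero    = []
    All-explored (suc m) = go L
      where
      go : ∀ j → All Exploration (replicate j exists ++ query ∷ rounds exists query m [])
      go zero    = query ∷ All-explored m
      go (suc j) = exists ∷ go j

    program-run : ∃[ h ] Exec program (Vec.replicate 5 blankTape)
                              (store blankTape blankTape (leftward ((pivot , f x) ∷ h) []) mark) (followCost L)
    program-run with walk (length explored + 1) explored (All-explored L) [] blank refl [] [] ≤-refl
        (subst (At w []) (rounds-++ L (pivot ∷ universal L)) (At-root schedule))
        (subst (λ κs → Wins (gameValue κs leaves [])) (rounds-++ L (pivot ∷ universal L))
          (root-wins n≤2^L f t t-correct))
    ... | h , e = h , upd⇓ refl ⨟⇓ e ⨟⇓ upd⇓ refl

-- The preprocessing machine

module Preprocessor (M : RandomizedTM 1) where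

  module M = Machine M

  Mark : Set
  Mark = M.State ⊎ (M.Aux ⊎ Maybe Cell)

  Finite-Mark : Finite Mark
  Finite-Mark = Finite-⊎ M.state-finite
    (Finite-⊎ M.aux-finite (Finite-Maybe (Finite-× Finite-Kind Finite-Bool)))

  open Language 1 Mark (13 + suc M.work) public

  stateSym : M.State → Sym
  stateSym q = aux (inj₁ q)

  mark : Sym
  mark = aux (inj₂ (inj₂ nothing))

  cellSym : Cell → Sym
  cellSym c = aux (inj₂ (inj₂ (just c)))

  -- The tapes after `len` simulate the output and work tapes of M, `addr`
  -- simulates its address tape; `pos` follows the head of `addr` and marks
  -- the leftmost cell.
  record Tapes : Set where
    constructor tapes
    field
      addr out pos sta ans cand sav wt ct bal tab tmp stk yy len : Tape Mark
      mts : Vec (Tape Mark) (suc M.work)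

  open Tapes public

  vec : Tapes → Store
  vec σ = addr σ ∷ out σ ∷ pos σ ∷ sta σ ∷ ans σ ∷ cand σ ∷ sav σ ∷ wt σ ∷ ct σ ∷ bal σ ∷ tab σ ∷ tmp σ
    ∷ stk σ ∷ yy σ ∷ len σ ∷ mts σ

  addr# out# pos# sta# ans# cand# sav# wt# ct# bal# tab# tmp# stk# yy# len# : Fin k
  addr# = zero
  out#  = suc zero
  pos#  = suc (suc zero)
  sta#  = suc (suc (suc zero))
  ans#  = suc (suc (suc (suc zero)))
  cand# = suc (suc (suc (suc (suc zero))))
  sav#  = suc (suc (suc (suc (suc (suc zero)))))
  wt#   = suc (suc (suc (suc (suc (suc (suc zero))))))
  ct#   = suc (suc (suc (suc (suc (suc (suc (suc zero)))))))
  bal#  = suc (suc (suc (suc (suc (suc (suc (suc (suc zero))))))))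
  tab#  = suc (suc (suc (suc (suc (suc (suc (suc (suc (suc zero)))))))))
  tmp#  = suc (suc (suc (suc (suc (suc (suc (suc (suc (suc (suc zero))))))))))
  stk#  = suc (suc (suc (suc (suc (suc (suc (suc (suc (suc (suc (suc zero)))))))))))
  yy#   = suc (suc (suc (suc (suc (suc (suc (suc (suc (suc (suc (suc (suc zero))))))))))))
  len#  = suc (suc (suc (suc (suc (suc (suc (suc (suc (suc (suc (suc (suc (suc zero)))))))))))))

  isMark isBlank isBit isOne : Sym → Bool
  isMark (aux (inj₂ (inj₂ nothing)))          = true
  isMark _                                    = false
  isBlank blank                               = true
  isBlank _                                   = false
  isBit (bit _)                               = true
  isBit _                                     = false
  isOne (aux (inj₂ (inj₂ (just (_ , true))))) = true
  isOne _                                     = false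

  withBit : Bool → Sym → Sym
  withBit b (aux (inj₂ (inj₂ (just (κ , _))))) = cellSym (κ , b)
  withBit b s                                  = s

  sees : (Sym → Bool) → Fin k → Reads → Scan → Bool
  sees p i _ s = p (Vec.lookup s i)

  sees-no : (Sym → Bool) → Fin k → Reads → Scan → Bool
  sees-no p i _ s = not (p (Vec.lookup s i))

  goLeft goRight : Fin k → Cmd
  goLeft  i = upd i (λ _ s → Vec.lookup s i , left)
  goRight i = upd i (λ _ s → Vec.lookup s i , right)

  put : Fin k → Sym → Move → Cmd
  put i s d = upd i (λ _ _ → s , d)

  rewrite-cell : Fin k → Bool → Move → Cmd
  rewrite-cell i b d = upd i (λ _ s → withBit b (Vec.lookup s i) , d)

  toEnd : Fin k → Cmd
  toEnd i = while (sees-no isBlank i) (goRight i)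

  -- A loop over the cells of a history that starts and ends on the blank behind it: newest cell
  -- first on the way to the mark, oldest cell first on the way back.
  sweep : Fin k → Cmd → Cmd → Cmd
  sweep i bodyˡ bodyʳ = goLeft i ⨟ while (sees-no isMark i) (bodyˡ ⨟ goLeft i)
                      ⨟ goRight i ⨟ while (sees-no isBlank i) (bodyʳ ⨟ goRight i)

  pop : Fin k → Cmd
  pop i = put i blank left

  drain : Fin k → Cmd → Cmd
  drain i body = goLeft i ⨟ while (sees-no isBlank i) (body ⨟ pop i)

  -- A binary counter whose newest cell is the least significant. On the blank behind it the body is
  -- run for the current bits; a 1 is reset and carried, a 0 becomes 1 and sends the head back to
  -- the end. Carrying into the mark means overflow, and all bits are 0 again.
  count-up : Fin k → Cmd → Cmd
  count-up i body = branch (sees isBlank i) (body ⨟ goLeft i)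
    (branch (sees isOne i) (rewrite-cell i false left) (rewrite-cell i true right ⨟ toEnd i))

  odometer : Fin k → Cmd → Cmd
  odometer i body = while (sees-no isMark i) (count-up i body) ⨟ goRight i ⨟ toEnd i

  stack : List Sym → Tape Mark
  stack ss = tape ss blank []

  top : List Sym → Tape Mark
  top []       = blankTape
  top (s ∷ ss) = tape ss s []

  base : List Cell → List Sym
  base h = map cellSym h ++ mark ∷ []

  leftward rightward : List Cell → List Cell → Tape Mark
  leftward []      r = tape [] mark (map cellSym r)
  leftward (c ∷ l) r = tape (base l) (cellSym c) (map cellSym r)
  rightward l []      = tape (base l) blank []
  rightward l (c ∷ r) = tape (base l) (cellSym c) (map cellSym r)

  resting : List Cell → Tape Mark
  resting h = rightward h []

  zeros : List Kind → List Cell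
  zeros = map (_, false)

  foldPlays : {A : Set} → List Kind → (List Cell → A → A) → List Cell → A → A
  foldPlays []       f h a = f h a
  foldPlays (κ ∷ κs) f h a = foldPlays κs f ((κ , true) ∷ h) (foldPlays κs f ((κ , false) ∷ h) a)

  play-zeros : ∀ κs h → play κs [] h ≡ zeros κs ʳ++ h
  play-zeros []       h = refl
  play-zeros (κ ∷ κs) h = play-zeros κs _

  times : {A : Set} → ℕ → (A → A) → A → A
  times zero    f a = a
  times (suc j) f a = times j f (f a)

  sweepCost : ℕ → ℕ → ℕ → ℕ
  sweepCost b b′ j = 1 + (loop (b + 1) j + (1 + loop (b′ + 1) j))

  drainCost : ℕ → ℕ → ℕ
  drainCost b j = 1 + loop (b + 1) j

  odometerCost : ℕ → ℕ → ℕ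
  odometerCost b zero    = 3 + b
  odometerCost b (suc j) = odometerCost b j + ((4 + loop 1 j) + (odometerCost b j + 4))

  -- Proof rules for the loops over a tape

  module Loops (ws : Vec (List Bool) 1) where

    open Semantics ws public

    -- `place t a` is a store whose tape i is t; the other tapes depend on a.
    module On {A : Set} (i : Fin k) (place : Tape Mark → A → Store)
              (scan-place : ∀ t a → Vec.lookup (scans (place t a)) i ≡ scanned t)
              (update-place : ∀ t a f → Vec.updateAt (place t a) i f ≡ place (f t) a) where

      upd-here : ∀ {t a F s d} → F (reads (place t a)) (scans (place t a)) ≡ (s , d) →
                 Exec (upd i F) (place t a) (place (actᵗ (s , d) t) a) 1
      upd-here {t} {a} eq = upd⇓ (trans (update-place t a _) (cong (λ z → place (actᵗ z t) a) eq))

      on-tape : ∀ {c s t t′ a n} → t ≡ t′ → Exec c s (place t a) n → Exec c s (place t′ a) n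
      on-tape refl e = e

      left⇓ : ∀ {t a} → Exec (goLeft i) (place t a) (place (moveᵗ left t) a) 1
      left⇓ {t} {a} = upd-here (cong (_, left) (scan-place t a))

      right⇓ : ∀ {t a} → Exec (goRight i) (place t a) (place (moveᵗ right t) a) 1
      right⇓ {t} {a} = upd-here (cong (_, right) (scan-place t a))

      sees≡ : ∀ p t a → sees p i (reads (place t a)) (scans (place t a)) ≡ p (scanned t)
      sees≡ p t a = cong p (scan-place t a)

      sees-no≡ : ∀ p t a → sees-no p i (reads (place t a)) (scans (place t a)) ≡ not (p (scanned t))
      sees-no≡ p t a = cong (not ∘ p) (scan-place t a)

      move-left : ∀ c l r → moveᵗ left (leftward (c ∷ l) r) ≡ leftward l (c ∷ r)
      move-left c []      r = refl
      move-left c (_ ∷ l) r = refl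

      move-right : ∀ l c r → moveᵗ right (rightward l (c ∷ r)) ≡ rightward (c ∷ l) r
      move-right l c []      = refl
      move-right l c (_ ∷ r) = refl

      move-left-rest : ∀ h → moveᵗ left (resting h) ≡ leftward h []
      move-left-rest []      = refl
      move-left-rest (_ ∷ h) = refl

      move-right-mark : ∀ r → moveᵗ right (leftward [] r) ≡ rightward [] r
      move-right-mark []      = refl
      move-right-mark (_ ∷ r) = refl

      toEnd-run : ∀ l r a → Exec (toEnd i) (place (rightward l r) a) (place (resting (r ʳ++ l)) a)
        (loop 1 (length r))
      toEnd-run l []      a = finish (sees-no≡ isBlank (rightward l []) a)
      toEnd-run l (c ∷ r) a = again (sees-no≡ isBlank (rightward l (c ∷ r)) a)
        (on-tape (move-right l c r) right⇓)
        (toEnd-run (c ∷ l) r a)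

      module _ {h : List Cell} {bodyˡ bodyʳ : Cmd} {b b′ : ℕ} (aˡ aʳ : List Cell → List Cell → A)
        (stepˡ : ∀ l c r → l ʳ++ (c ∷ r) ≡ h ʳ++ [] →
                 Exec bodyˡ (place (leftward (c ∷ l) r) (aˡ (c ∷ l) r))
                   (place (leftward (c ∷ l) r) (aˡ l (c ∷ r))) b)
        (stepʳ : ∀ l c r → l ʳ++ (c ∷ r) ≡ h ʳ++ [] →
                 Exec bodyʳ (place (rightward l (c ∷ r)) (aʳ l (c ∷ r)))
                   (place (rightward l (c ∷ r)) (aʳ (c ∷ l) r)) b′)
        (turn : ∀ r → aˡ [] r ≡ aʳ [] r) where

        sweep-left : ∀ l r → l ʳ++ r ≡ h ʳ++ [] →
          Exec (while (sees-no isMark i) (bodyˡ ⨟ goLeft i)) (place (leftward l r) (aˡ l r))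
               (place (leftward [] (h ʳ++ [])) (aˡ [] (h ʳ++ []))) (loop (b + 1) (length l))
        sweep-left []      r refl = finish (sees-no≡ isMark (leftward [] r) _)
        sweep-left (c ∷ l) r eq   = again (sees-no≡ isMark (leftward (c ∷ l) r) _)
          (stepˡ l c r eq ⨟⇓ on-tape (move-left c l r) left⇓)
          (sweep-left l (c ∷ r) eq)

        sweep-right : ∀ l r → l ʳ++ r ≡ h ʳ++ [] → r ʳ++ l ≡ h →
          Exec (while (sees-no isBlank i) (bodyʳ ⨟ goRight i)) (place (rightward l r) (aʳ l r))
               (place (resting h) (aʳ h [])) (loop (b′ + 1) (length r))
        sweep-right l []      eq refl = finish (sees-no≡ isBlank (rightward l []) _)
        sweep-right l (c ∷ r) eq eq′  = again (sees-no≡ isBlank (rightward l (c ∷ r)) _)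
          (stepʳ l c r eq ⨟⇓ on-tape (move-right l c r) right⇓)
          (sweep-right (c ∷ l) r eq eq′)

        -- `aˡ` and `aʳ` are loop invariants that express the other tapes through the cells on
        -- either side of the head; `turn` joins them at the mark.
        sweep-run : Exec (sweep i bodyˡ bodyʳ) (place (resting h) (aˡ h [])) (place (resting h) (aʳ h []))
                         (sweepCost b b′ (length h))
        sweep-run = on-tape (move-left-rest h) left⇓
          ⨟⇓ sweep-left h [] refl
          ⨟⇓ ends-in (cong₂ place (move-right-mark (h ʳ++ [])) (turn (h ʳ++ []))) right⇓
          ⨟⇓ takes (cong (loop (b′ + 1)) (List.length-reverse h))
            (sweep-right [] (h ʳ++ []) refl (List.reverse-involutive h))

      move-left-stack : ∀ ss → moveᵗ left (stack ss) ≡ top ss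
      move-left-stack []      = refl
      move-left-stack (_ ∷ _) = refl

      pop-top : ∀ s ss → actᵗ (blank , left) (top (s ∷ ss)) ≡ top ss
      pop-top s []      = refl
      pop-top s (_ ∷ _) = refl

      module _ {X : Set} (φ : X → Sym) (φ-full : ∀ x → isBlank (φ x) ≡ false) {body : Cmd} {b : ℕ} (n : ℕ) (a : List X → A)
        (step : ∀ x xs → length xs < n → Exec body (place (top (map φ (x ∷ xs))) (a (x ∷ xs))) (place (top (map φ (x ∷ xs))) (a xs)) b) where

        drain-loop : ∀ xs → length xs ≤ n →
          Exec (while (sees-no isBlank i) (body ⨟ pop i)) (place (top (map φ xs)) (a xs))
                                 (place blankTape (a [])) (loop (b + 1) (length xs))
        drain-loop []       le = finish (sees-no≡ isBlank blankTape _)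
        drain-loop (x ∷ xs) le = again (trans (sees-no≡ isBlank (top (map φ (x ∷ xs))) _) (cong not (φ-full x)))
          (step x xs le ⨟⇓ on-tape (pop-top (φ x) (map φ xs)) (upd-here refl))
          (drain-loop xs (<⇒≤ le))

        drain-run : ∀ xs → length xs ≤ n →
          Exec (drain i body) (place (stack (map φ xs)) (a xs)) (place blankTape (a []))
            (drainCost b (length xs))
        drain-run xs le = on-tape (move-left-stack (map φ xs)) left⇓
          ⨟⇓ drain-loop xs le

      module _ {X : Set} (φ : X → Sym) (φ-full : ∀ x → isBlank (φ x) ≡ false) {body : Cmd} {b : ℕ} (f : A → A)
        (step : ∀ x xs a → Exec body (place (top (map φ (x ∷ xs))) a) (place (top (map φ (x ∷ xs))) (f a)) b) where

        drain-times : ∀ xs a → Exec (while (sees-no isBlank i) (body ⨟ pop i)) (place (top (map φ xs)) a)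
                                    (place blankTape (times (length xs) f a)) (loop (b + 1) (length xs))
        drain-times []       a = finish (sees-no≡ isBlank blankTape a)
        drain-times (x ∷ xs) a = again (trans (sees-no≡ isBlank (top (map φ (x ∷ xs))) a) (cong not (φ-full x)))
          (step x xs a ⨟⇓ on-tape (pop-top (φ x) (map φ xs)) (upd-here refl))
          (drain-times xs (f a))

        drain-times-run : ∀ xs a → Exec (drain i body) (place (stack (map φ xs)) a)
                                        (place blankTape (times (length xs) f a)) (drainCost b (length xs))
        drain-times-run xs a = on-tape (move-left-stack (map φ xs)) left⇓
          ⨟⇓ drain-times xs a

        drain-replicate : ∀ x j a → Exec (drain i body) (place (stack (map φ (replicate j x))) a)
                                         (place blankTape (times j f a)) (drainCost b j)
        drain-replicate x j a = takes (cong (drainCost b) (List.length-replicate j))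
          (ends-in (cong (λ i → place blankTape (times i f a)) (List.length-replicate j))
            (drain-times-run (replicate j x) a))

      module _ {body : Cmd} {b : ℕ} (f : List Cell → A → A) where

        loopBody : Cmd
        loopBody = while (sees-no isMark i) (count-up i body)

        -- Stated for any continuation e of the loop, for the induction on κs.
        enumerate : ∀ κs h → (∀ s a → Exec body (place (resting (play κs s h)) a)
          (place (resting (play κs s h)) (f (play κs s h) a)) b) →
                    ∀ a {τ n} → Exec loopBody (place (leftward h (zeros κs)) (foldPlays κs f h a)) τ n →
                    Exec loopBody (place (resting (play κs [] h)) a) τ (odometerCost b (length κs) + n)
        enumerate [] h step a {τ} {n} e = weaken (≤-reflexive (cong (λ z → suc (suc z + n)) (+-comm b 1)))
          (go⇓ (sees-no≡ isMark (resting h) a) (then⇓ (sees≡ isBlank (resting h) a)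
            (step [] a ⨟⇓ on-tape (move-left-rest h) left⇓)) e)
        enumerate (κ ∷ κs) h step a {τ} {n} e = weaken (≤-reflexive arith)
          -- The plays with a 0 here return to this cell with all later cells 0. It becomes 1, the
          -- plays with a 1 follow, and the last carry resets it and moves on to the left.
          (enumerate κs ((κ , false) ∷ h) (λ s → step (false ∷ s)) a
            (go⇓ (sees-no≡ isMark t₀ a₀)
              (else⇓ (sees≡ isBlank t₀ a₀) (else⇓ (sees≡ isOne t₀ a₀)
                (on-tape (move-right h (κ , true) (zeros κs))
                   (upd-here (cong (λ s → withBit true s , right) (scan-place t₀ a₀)))
                 ⨟⇓ takes (cong (loop 1) (List.length-map (_, false) κs))
                   (on-tape (cong resting (sym (play-zeros κs ((κ , true) ∷ h))))
                      (toEnd-run ((κ , true) ∷ h) (zeros κs) a₀)))))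
              (enumerate κs ((κ , true) ∷ h) (λ s → step (true ∷ s)) a₀
                (go⇓ (sees-no≡ isMark t₁ a₁) (else⇓ (sees≡ isBlank t₁ a₁) (then⇓ (sees≡ isOne t₁ a₁)
                  (on-tape (back h)
                    (upd-here (cong (λ s → withBit false s , left) (scan-place t₁ a₁)))))) e))))
          where
          a₀ = foldPlays κs f ((κ , false) ∷ h) a
          a₁ = foldPlays κs f ((κ , true) ∷ h) a₀
          t₀ = leftward ((κ , false) ∷ h) (zeros κs)
          t₁ = leftward ((κ , true) ∷ h) (zeros κs)
          back : ∀ h → actᵗ (cellSym (κ , false) , left) (leftward ((κ , true) ∷ h) (zeros κs))
            ≡ leftward h (zeros (κ ∷ κs))
          back []      = refl
          back (_ ∷ _) = refl
          c = odometerCost b (length κs)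
          j = loop 1 (length κs)
          arith : c + suc (suc (suc (1 + j)) + (c + suc (suc (suc 1) + n))) ≡ c + ((4 + j) + (c + 4)) + n
          arith = trans (cong (λ z → c + (4 + (j + z))) (sym (+-assoc c 4 n)))
                 (trans (cong (λ z → c + (4 + z)) (sym (+-assoc j (c + 4) n))) (sym (+-assoc c _ n)))

        odometer-run : ∀ κs → (∀ s a → Exec body (place (resting (play κs s [])) a)
          (place (resting (play κs s [])) (f (play κs s []) a)) b) →
                       ∀ a → Exec (odometer i body) (place (resting (play κs [] [])) a)
                                  (place (resting (play κs [] [])) (foldPlays κs f [] a))
                                  (odometerCost b (length κs) + 1 + (1 + loop 1 (length κs)))
        odometer-run κs step a = enumerate κs [] step a (stop⇓ (sees-no≡ isMark (leftward [] (zeros κs)) _))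
          ⨟⇓ on-tape (move-right-mark (zeros κs)) right⇓
          ⨟⇓ takes (cong (loop 1) (List.length-map (_, false) κs))
            (on-tape (cong resting (sym (play-zeros κs []))) (toEnd-run [] (zeros κs) _))

-- Rewinding a tape and reading its contents bit by bit

module _ {A : Set} where

  lefts : ℕ → Tape A → Tape A
  lefts zero    t = t
  lefts (suc j) t = lefts j (moveᵗ left t)

  rewound : Tape A → Tape A
  rewound t = lefts (length (before t)) t

  -- Under this invariant a move right is undone by a move left; blanks at the end of `after` would
  -- get lost on the way.
  Trimmed : Tape A → Set
  Trimmed t = trim (after t) ≡ after t

  trim-∷ᵗ : ∀ s (r : List (Symbol A)) → trim (s ∷ᵗ r) ≡ s ∷ᵗ trim r
  trim-∷ᵗ blank   []      = refl
  trim-∷ᵗ blank   (_ ∷ _) = refl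
  trim-∷ᵗ (bit _) r       = refl
  trim-∷ᵗ (aux _) r       = refl

  trim-idempotent : ∀ (r : List (Symbol A)) → trim (trim r) ≡ trim r
  trim-idempotent []      = refl
  trim-idempotent (s ∷ r) = trans (trim-∷ᵗ s (trim r)) (cong (s ∷ᵗ_) (trim-idempotent r))

  untrim : ∀ s (r : List (Symbol A)) → trim (s ∷ r) ≡ s ∷ r → trim r ≡ r × s ∷ᵗ r ≡ s ∷ r
  untrim s r eq with trim r | s
  untrim s r refl | r′@(_ ∷ _) | blank = refl , refl
  untrim s r refl | r′         | bit _ = refl , refl
  untrim s r refl | r′         | aux _ = refl , refl

  move-right-left : ∀ l x s (r : List (Symbol A)) → moveᵗ right (tape l x (s ∷ᵗ r)) ≡ tape (x ∷ l) s r
  move-right-left l x blank   []      = refl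
  move-right-left l x blank   (_ ∷ _) = refl
  move-right-left l x (bit _) r       = refl
  move-right-left l x (aux _) r       = refl

  rights-lefts : ∀ j (t : Tape A) → j < length (before t) → moveᵗ right (lefts (suc j) t) ≡ lefts j t
  rights-lefts zero    (tape (x ∷ l) s r) lt       = move-right-left l x s r
  rights-lefts (suc j) (tape (x ∷ l) s r) (s≤s lt) = rights-lefts j (tape l x (s ∷ᵗ r)) lt

  length-before-right : ∀ (t : Tape A) → length (before (moveᵗ right t)) ≡ suc (length (before t))
  length-before-right (tape l s [])      = refl
  length-before-right (tape l s (_ ∷ _)) = refl

  move-left-right : ∀ (t : Tape A) → Trimmed t → moveᵗ left (moveᵗ right t) ≡ t
  move-left-right (tape l s [])      tr = refl
  move-left-right (tape l s (x ∷ r)) tr = cong (tape l s) (proj₂ (untrim x r tr))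

  Trimmed-right : ∀ (t : Tape A) → Trimmed t → Trimmed (moveᵗ right t)
  Trimmed-right (tape l s [])      tr = refl
  Trimmed-right (tape l s (x ∷ r)) tr = proj₁ (untrim x r tr)

  Trimmed-left : ∀ (t : Tape A) → Trimmed t → Trimmed (moveᵗ left t)
  Trimmed-left (tape []      s r) tr = tr
  Trimmed-left (tape (x ∷ l) s r) tr = trans (trim-∷ᵗ s r) (cong (s ∷ᵗ_) tr)

  Trimmed-lefts : ∀ j (t : Tape A) → Trimmed t → Trimmed (lefts j t)
  Trimmed-lefts zero    t tr = tr
  Trimmed-lefts (suc j) t tr = Trimmed-lefts j _ (Trimmed-left t tr)

  rewound-right : ∀ (t : Tape A) → Trimmed t → rewound (moveᵗ right t) ≡ rewound t
  rewound-right t tr = trans (cong (λ j → lefts j (moveᵗ right t)) (length-before-right t))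
                             (cong (lefts (length (before t))) (move-left-right t tr))

  before-rewound : ∀ (t : Tape A) → before (rewound t) ≡ []
  before-rewound (tape l s r) = go l s r
    where
    go : ∀ l s r → before (rewound (tape l s r)) ≡ []
    go []      s r = refl
    go (x ∷ l) s r = go l x (s ∷ᵗ r)

  rewound-idempotent : ∀ (t : Tape A) → rewound (rewound t) ≡ rewound t
  rewound-idempotent t = cong (λ l → lefts (length l) (rewound t)) (before-rewound t)

  contents-left : ∀ (t : Tape A) → contents (moveᵗ left t) ≡ contents t
  contents-left (tape []      s r) = refl
  contents-left (tape (x ∷ l) s r) = leadingBits-ʳ++ l (leadingBits-cong x (leadingBits-∷ᵗ s r))

  contents-lefts : ∀ j (t : Tape A) → contents (lefts j t) ≡ contents t
  contents-lefts zero    t = refl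
  contents-lefts (suc j) t = trans (contents-lefts j (moveᵗ left t)) (contents-left t)

  remaining : Tape A → List Bool
  remaining t = leadingBits (scanned t ∷ after t)

  contents-rewound : ∀ (t : Tape A) → remaining (rewound t) ≡ contents t
  contents-rewound t = trans (cong (λ l → leadingBits (l ʳ++ (scanned (rewound t) ∷ after (rewound t))))
    (sym (before-rewound t)))
                             (contents-lefts (length (before t)) t)

  symBit : Symbol A → Bool
  symBit (bit b) = b
  symBit _       = false

  onward : Symbol A → Move
  onward (bit _) = right
  onward _       = stay

  -- The head stops at the first cell that holds no bit, which then reads as an endless run of
  -- zeros, as in `firstBit` and `rest`.
  advanced : Tape A → Tape A
  advanced t = moveᵗ (onward (scanned t)) t

  firstBit-remaining : ∀ (t : Tape A) → firstBit (remaining t) ≡ symBit (scanned t)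
  firstBit-remaining (tape l blank   r) = refl
  firstBit-remaining (tape l (bit b) r) = refl
  firstBit-remaining (tape l (aux a) r) = refl

  remaining-advanced : ∀ (t : Tape A) → remaining (advanced t) ≡ rest (remaining t)
  remaining-advanced (tape l blank   r)       = refl
  remaining-advanced (tape l (bit b) [])      = refl
  remaining-advanced (tape l (bit b) (_ ∷ _)) = refl
  remaining-advanced (tape l (aux a) r)       = refl

  Trimmed-advanced : ∀ (t : Tape A) → Trimmed t → Trimmed (advanced t)
  Trimmed-advanced (tape l blank   r) tr = tr
  Trimmed-advanced (tape l (bit b) r) tr = Trimmed-right (tape l (bit b) r) tr
  Trimmed-advanced (tape l (aux a) r) tr = tr

  rewound-advanced : ∀ (t : Tape A) → Trimmed t → rewound (advanced t) ≡ rewound t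
  rewound-advanced (tape l blank   r) tr = refl
  rewound-advanced (tape l (bit b) r) tr = rewound-right (tape l (bit b) r) tr
  rewound-advanced (tape l (aux a) r) tr = refl

  -- The head position plus the number of unread bits does not change under `advanced`, and it
  -- bounds the cost of rewinding.
  within : ℕ → Tape A → Set
  within P t = length (before t) + length (remaining t) ≤ P

  within-advanced : ∀ P t → within P t → within P (advanced t)
  within-advanced P (tape l blank   r)       le = le
  within-advanced P (tape l (bit b) [])      le = subst (_≤ P) (+-suc (length l) 0) le
  within-advanced P (tape l (bit b) (x ∷ r)) le = subst (_≤ P) (+-suc (length l) _) le
  within-advanced P (tape l (aux a) r)       le = le

  within-rewound : ∀ P t → length (contents t) ≤ P → within P (rewound t)
  within-rewound P t le = subst₂ (λ l w → length l + length w ≤ P) (sym (before-rewound t))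
    (sym (contents-rewound t)) le

-- `respond` with the comparison of numbers replaced by the bitwise one that the machine carries
-- out.
reply : List Entry → List Bool → Bool → Bool
reply []             w b = b
reply ((u , c) ∷ es) w b = reply es w (if matches u w then c else b)

-- Answering a query

module Queries (M : RandomizedTM 1) where

  open Preprocessor M public

  onSym : Fin k → Scan → Sym
  onSym i s = Vec.lookup s i

  isIndexCell : Sym → Bool
  isIndexCell (aux (inj₂ (inj₂ (just (κ , _))))) = isIndex κ
  isIndexCell _                                  = false

  cellBit : Sym → Bool
  cellBit (aux (inj₂ (inj₂ (just (_ , b))))) = b
  cellBit _                                  = false

  proposal : Sym → Sym
  proposal (aux (inj₂ (inj₂ (just (κ , b))))) = if isAnswer κ then bit b else blank
  proposal _                                  = blank

  -- `query-lookup` sweeps the history from its newest cell, so that each entry shows its answer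
  -- before its index. The answer becomes the candidate; the index is compared with the simulated
  -- address from its first cell on, and a mismatch erases the candidate. A surviving candidate
  -- overwrites the answer so far, hence the earliest entry prevails, as in `respond`. `sav` records
  -- how far the simulated head has to return.
  back rewind saveRewind restore compareCell advance commit propose examine query-lookup : Cmd
  back         = goLeft addr# ⨟ goLeft pos#
  rewind       = while (sees-no isMark pos#) back
  saveRewind   = while (sees-no isMark pos#) (back ⨟ put sav# mark right)
  restore      = drain sav# (goRight addr# ⨟ goRight pos#)
  compareCell  = upd cand# (λ _ s →
    (if does (cellBit (onSym ct# s) Bool.≟ symBit (onSym addr# s)) then onSym cand# s else blank) , stay)
  advance      = upd pos# (λ _ s → onSym pos# s , onward (onSym addr# s))
               ⨟ upd addr# (λ _ s → onSym addr# s , onward (onSym addr# s))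
  commit       = upd ans# (λ _ s → (if isBit (onSym cand# s) then onSym cand# s else onSym ans# s) , stay)
  propose      = upd cand# (λ _ s → proposal (onSym ct# s) , stay)
  examine      = branch (sees isIndexCell ct#) (compareCell ⨟ advance) (commit ⨟ rewind ⨟ propose)
  query-lookup = saveRewind ⨟ put ans# (bit false) stay ⨟ sweep ct# examine skip
               ⨟ commit ⨟ put cand# blank stay ⨟ rewind ⨟ restore

  single : Sym → Tape Mark
  single s = tape [] s []

  trail : ℕ → List Sym
  trail zero    = mark ∷ []
  trail (suc j) = blank ∷ trail j

  posTape : ℕ → Tape Mark
  posTape zero    = tape [] mark []
  posTape (suc j) = tape (trail j) blank []

  located : Tape Mark → Tapes → Tapes
  located t σ = record σ { addr = t ; pos = posTape (length (before t)) }

  posTape-right : ∀ j → moveᵗ right (posTape j) ≡ posTape (suc j)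
  posTape-right zero    = refl
  posTape-right (suc j) = refl

  posTape-move : ∀ d (t : Tape Mark) → moveᵗ d (posTape (length (before t)))
    ≡ posTape (length (before (moveᵗ d t)))
  posTape-move left  (tape []          s r) = refl
  posTape-move left  (tape (_ ∷ [])    s r) = refl
  posTape-move left  (tape (_ ∷ _ ∷ l) s r) = refl
  posTape-move stay  t                      = refl
  posTape-move right t = trans (posTape-right _) (cong posTape (sym (length-before-right t)))

  -- The state of the search for a matching entry: the address tape, the answer
  -- so far, and the answer of the current entry unless it does not match.
  Search : Set
  Search = Tape Mark × Bool × Maybe Bool

  candidate : Maybe Bool → Sym
  candidate nothing  = blank
  candidate (just b) = bit b

  searchStep : Cell → Search → Search
  searchStep (κ , b) (t , a , c) =
    if isIndex κ then (advanced t , a , (if does (b Bool.≟ symBit (scanned t)) then c else nothing))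
    else (rewound t , fromMaybe a c , (if isAnswer κ then just b else nothing))

  settled : Search → Bool
  settled (t , a , c) = fromMaybe a c

  -- The scan may be caught in the middle of an index: the current candidate `c` still has to match
  -- the rest of its index against the unread part of the address, while all older entries start
  -- over from the rewound tape `A₀`.
  search-correct : ∀ A₀ h t a c → Trimmed t → rewound t ≡ A₀ →
    settled (List.foldl (λ z x → searchStep x z) (t , a , c) h)
    ≡ reply (entries h) (remaining A₀) (if matches (indexBits h) (remaining t) then fromMaybe a c else a)
  search-correct A₀ []            t a c tr eq = refl
  search-correct A₀ ((κ , b) ∷ h) t a c tr refl with isIndex κ | isAnswer κ | exclusive κ
    where
    exclusive : ∀ κ → isIndex κ ≡ true → isAnswer κ ≡ false
    exclusive exists _ = refl
    exclusive index  _ = refl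
  ... | true | true  | ex with ex refl
  ...   | ()
  search-correct A₀ ((κ , b) ∷ h) t a c tr refl | true | false | ex = trans
    (search-correct (rewound t) h (advanced t) a _ (Trimmed-advanced t tr) (rewound-advanced t tr))
    (cong (reply (entries h) (remaining (rewound t))) (trans
      (cong (λ w → if matches (indexBits h) w then fromMaybe a c′ else a) (remaining-advanced t))
      (split (does (b Bool.≟ symBit (scanned t))) (cong (λ z → does (b Bool.≟ z)) (firstBit-remaining t)))))
    where
    c′ = if does (b Bool.≟ symBit (scanned t)) then c else nothing
    w′ = rest (remaining t)
    split : ∀ d → does (b Bool.≟ firstBit (remaining t)) ≡ d →
            (if matches (indexBits h) w′ then fromMaybe a (if d then c else nothing) else a)
            ≡ (if does (b Bool.≟ firstBit (remaining t)) ∧ matches (indexBits h) w′ then fromMaybe a c else a)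
    split true  eq rewrite eq = refl
    split false eq rewrite eq with matches (indexBits h) w′
    ... | true  = refl
    ... | false = refl
  search-correct A₀ ((κ , b) ∷ h) t a c tr refl | false | true | ex =
    search-correct (rewound t) h (rewound t) (fromMaybe a c) (just b)
      (Trimmed-lefts (length (before t)) t tr) (rewound-idempotent t)
  search-correct A₀ ((κ , b) ∷ h) t a c tr refl | false | false | ex = trans
    (search-correct (rewound t) h (rewound t) (fromMaybe a c) nothing
      (Trimmed-lefts (length (before t)) t tr) (rewound-idempotent t))
    (cong (reply (entries h) (remaining (rewound t))) (same (matches (indexBits h) (remaining (rewound t)))))
    where
    same : ∀ m → (if m then fromMaybe a c else fromMaybe a c) ≡ fromMaybe a c
    same true  = refl
    same false = refl

  examineCost : ℕ → ℕ
  examineCost P = suc (3 + loop 2 P)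

  lookupCost : ℕ → ℕ → ℕ
  lookupCost P N = loop 3 P + (1 + (sweepCost (examineCost P) 1 N + (1 + (1 + (loop 2 P + drainCost 2 P)))))

  Sound : ℕ → Tape Mark → Search → Set
  Sound P A₀ (t , _ , _) = Trimmed t × rewound t ≡ A₀ × within P t

  sound-step : ∀ P A₀ c s → length (remaining A₀) ≤ P → Sound P A₀ s → Sound P A₀ (searchStep c s)
  sound-step P A₀ (κ , b) (t , a , c) le (tr , refl , w) with isIndex κ
  ... | true  = Trimmed-advanced t tr , rewound-advanced t tr , within-advanced P t w
  ... | false = Trimmed-lefts (length (before t)) t tr , rewound-idempotent t ,
    within-rewound P t (subst (λ u → length u ≤ P) (contents-rewound t) le)

  searched : Tape Mark → List Cell → Search
  searched A₀ = foldr searchStep (A₀ , false , nothing)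

  sound-searched : ∀ P t → Trimmed t → length (contents t)
    ≤ P → ∀ r → Sound P (rewound t) (searched (rewound t) r)
  sound-searched P t tr le []      = Trimmed-lefts (length (before t)) t tr , rewound-idempotent t ,
    within-rewound P t le
  sound-searched P t tr le (c ∷ r) = sound-step P (rewound t) c (searched (rewound t) r)
    (subst (λ u → length u ≤ P) (sym (contents-rewound t)) le) (sound-searched P t tr le r)

  settled-searched : ∀ t → Trimmed t → ∀ h →
                     settled (searched (rewound t) (h ʳ++ [])) ≡ reply (entries h) (contents t) false
  settled-searched t tr h = begin
    settled (searched (rewound t) (h ʳ++ []))
      ≡⟨ cong settled (List.foldr-ʳ++ searchStep (rewound t , false , nothing) h) ⟩
    settled (List.foldl (λ z x → searchStep x z) (rewound t , false , nothing) h)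
      ≡⟨ search-correct (rewound t) h (rewound t) false nothing (Trimmed-lefts (length (before t)) t tr)
        (rewound-idempotent t) ⟩
    reply (entries h) (remaining (rewound t))
      (if matches (indexBits h) (remaining (rewound t)) then false else false)
      ≡⟨ cong₂ (reply (entries h)) (contents-rewound t) (same (matches (indexBits h) (remaining (rewound t)))) ⟩
    reply (entries h) (contents t) false ∎
    where
    open ≡-Reasoning
    same : ∀ m → (if m then false else false) ≡ false
    same true  = refl
    same false = refl

  module QueryRuns (ws : Vec (List Bool) 1) where

    open Loops ws public

    back-run : ∀ σ t → Exec back (vec (located t σ)) (vec (located (moveᵗ left t) σ)) 2
    back-run σ t = upd⇓ refl ⨟⇓ upd⇓ (cong (λ p → vec (record σ { addr = moveᵗ left t ; pos = p }))
      (posTape-move left t))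

    forth-run : ∀ σ t → Exec (goRight addr# ⨟ goRight pos#) (vec (located t σ))
      (vec (located (moveᵗ right t) σ)) 2
    forth-run σ t = upd⇓ refl ⨟⇓ upd⇓ (cong (λ p → vec (record σ { addr = moveᵗ right t ; pos = p }))
      (posTape-move right t))

    rewind-run : ∀ σ l s r → Exec rewind (vec (located (tape l s r) σ))
      (vec (located (rewound (tape l s r)) σ)) (loop 2 (length l))
    rewind-run σ []      s r = finish refl
    rewind-run σ (x ∷ l) s r = again refl (back-run σ (tape (x ∷ l) s r)) (rewind-run σ l x (s ∷ᵗ r))

    saved : List Sym → Tape Mark
    saved us = stack (map (λ _ → mark) us)

    saveRewind-run : ∀ σ l s r us → Exec saveRewind (vec (record (located (tape l s r) σ) { sav = saved us }))
      (vec (record (located (rewound (tape l s r)) σ) { sav = saved (l ʳ++ us) })) (loop 3 (length l))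
    saveRewind-run σ []      s r us = finish refl
    saveRewind-run σ (x ∷ l) s r us = again refl
      (back-run (record σ { sav = saved us }) (tape (x ∷ l) s r) ⨟⇓ upd⇓ refl)
        (saveRewind-run σ l x (s ∷ᵗ r) (x ∷ us))

    restore-run : ∀ σ t us → length us ≡ length (before t) →
                  Exec restore (vec (record (located (rewound t) σ) { sav = saved us }))
                               (vec (record (located t σ) { sav = blankTape })) (drainCost 2 (length us))
    restore-run σ t us eq = starts-in (cong (λ j → vec (record (located (lefts j t) σ) { sav = saved us })) eq)
      (drain-run (λ _ → mark) (λ _ → refl) (length us) (λ xs → lefts (length xs) t) step us ≤-refl)
      where
      place : Tape Mark → Tape Mark → Store
      place s t = vec (record (located t σ) { sav = s })
      open On {A = Tape Mark} sav# place (λ _ _ → refl) (λ _ _ _ → refl)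
      step : ∀ x xs → length xs < length us →
             Exec (goRight addr# ⨟ goRight pos#)
               (vec (record (located (lefts (suc (length xs)) t) σ) { sav = top (map (λ _ → mark) (x ∷ xs)) }))
               (vec (record (located (lefts (length xs) t) σ) { sav = top (map (λ _ → mark) (x ∷ xs)) })) 2
      step x xs lt = subst
        (λ t′ → Exec (goRight addr# ⨟ goRight pos#)
          (vec (record (located (lefts (suc (length xs)) t) σ) { sav = saved-top }))
                  (vec (record (located t′ σ) { sav = saved-top })) 2)
        (rights-lefts (length xs) t (subst (length xs <_) eq lt))
        (forth-run (record σ { sav = saved-top }) (lefts (suc (length xs)) t))
        where saved-top = top (map (λ _ → mark) (x ∷ xs))

    searching : Tapes → Tape Mark → Search → Store
    searching σ h (t , a , c) = vec (record (located t σ)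
      { ct = h ; ans = single (bit a) ; cand = single (candidate c) })

    committed : ∀ a c → (if isBit (candidate c) then candidate c else bit a) ≡ bit (fromMaybe a c)
    committed a nothing  = refl
    committed a (just _) = refl

    examine-run : ∀ σ P l r κ b t a c → length (before t) ≤ P →
                  Exec examine (searching σ (leftward ((κ , b) ∷ l) r) (t , a , c))
                               (searching σ (leftward ((κ , b) ∷ l) r) (searchStep (κ , b) (t , a , c)))
                                 (examineCost P)
    examine-run σ P l r κ b t a c le with isIndex κ in eq
    ... | true  = weaken (s≤s (m≤m+n 3 _)) (then⇓ eq
      (upd⇓ (cong (λ s → vec (record σ₁ { cand = single s })) (compared (does (b Bool.≟ symBit (scanned t)))))
       ⨟⇓ upd⇓ (cong (λ p → vec (record σ₂ { pos = p })) (posTape-move (onward (scanned t)) t)) ⨟⇓ upd⇓ refl))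
      where
      c′ = if does (b Bool.≟ symBit (scanned t)) then c else nothing
      σ₁ = record (located t σ) { ct = leftward ((κ , b) ∷ l) r ; ans = single (bit a)
        ; cand = single (candidate c) }
      σ₂ = record σ₁ { cand = single (candidate c′) }
      compared : ∀ d → (if d then candidate c else blank) ≡ candidate (if d then c else nothing)
      compared true  = refl
      compared false = refl
    ... | false = weaken (s≤s (s≤s (≤-trans (≤-reflexive (+-comm _ 1))
      (s≤s (≤-trans (loop-mono 2 le) (n≤1+n _)))))) (else⇓ eq
      (upd⇓ (cong (λ s → vec (record σ₁ { ans = single s })) (committed a c))
       ⨟⇓ rewind-run (record σ₁ { ans = single (bit (fromMaybe a c)) }) (before t) (scanned t) (after t)
       ⨟⇓ upd⇓ (cong (λ s → vec (record (located (rewound t) σ₁)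
         { ans = single (bit (fromMaybe a c)) ; cand = single s }))
                (proposed (isAnswer κ)))))
      where
      σ₁ = record (located t σ) { ct = leftward ((κ , b) ∷ l) r ; ans = single (bit a)
        ; cand = single (candidate c) }
      proposed : ∀ d → (if d then bit b else blank) ≡ candidate (if d then just b else nothing)
      proposed true  = refl
      proposed false = refl

    lookup-run : ∀ σ P t h s → Trimmed t → length (contents t) ≤ P → length (before t) ≤ P →
      Exec query-lookup
        (vec (record (located t σ) { ct = resting h ; sav = blankTape ; ans = single s ; cand = single blank }))
        (vec (record (located t σ) { ct = resting h ; sav = blankTape ; cand = single blank
                                   ; ans = single (bit (reply (entries h) (contents t) false)) }))
        (lookupCost P (length h))
    lookup-run σ P t h s tr le le′ =
      weaken (loop-mono 3 le′) (saveRewind-run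
        (record σ { ct = resting h ; ans = single s ; cand = single blank }) (before t) (scanned t)
          (after t) [])
      ⨟⇓ upd⇓ refl
      ⨟⇓ sweep-run {h = h} (λ l r → searched A₀ r) (λ l r → searched A₀ (l ʳ++ r))
           (λ l (κ , b) r _ → let t₁ , a₁ , c₁ = searched A₀ r in
              examine-run σ′ P l r κ b t₁ a₁ c₁
                (≤-trans (m≤m+n _ _) (proj₂ (proj₂ (sound-searched P t tr le r)))))
           (λ l c r _ → skip⇓) (λ r → refl)
      ⨟⇓ upd⇓ (cong (λ s → vec (record (located t′ σ′)
        { ct = resting h ; cand = single (candidate c′) ; ans = single s })) (committed a′ c′))
      ⨟⇓ upd⇓ refl
      ⨟⇓ weaken (loop-mono 2 (≤-trans (m≤m+n _ _) (proj₂ (proj₂ sound))))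
           (rewind-run (settling σ′ (fromMaybe a′ c′)) (before t′) (scanned t′) (after t′))
      ⨟⇓ weaken (+-monoʳ-≤ 1 (loop-mono 3 (subst (_≤ P) (sym saved-length) le′)))
           (starts-in (cong (λ t → vec (located t (settling σ′ (fromMaybe a′ c′)))) (sym (proj₁ (proj₂ sound))))
             (ends-in (cong (λ b → vec (record (located t (settling σ b)) { sav = blankTape }))
               (settled-searched t tr h))
               (restore-run (settling σ′ (fromMaybe a′ c′)) t (before t ʳ++ []) saved-length)))
      where
      A₀ = rewound t
      settling : Tapes → Bool → Tapes
      settling σ b = record σ { ct = resting h ; cand = single blank ; ans = single (bit b) }
      σ′ = record σ { sav = saved (before t ʳ++ []) }
      open On {A = Search} ct# (λ ct s → searching σ′ ct s) (λ _ _ → refl) (λ _ _ _ → refl)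
      final = searched A₀ (h ʳ++ [])
      t′ = proj₁ final
      a′ = proj₁ (proj₂ final)
      c′ = proj₂ (proj₂ final)
      sound = sound-searched P t tr le (h ʳ++ [])
      saved-length : length (before t ʳ++ []) ≡ length (before t)
      saved-length = List.length-reverse (before t)

-- Simulating one run

module _ {A B : Set} (φ : A → B) where

  trim-map : ∀ r → trim (map (mapSymbol φ) r) ≡ map (mapSymbol φ) (trim r)
  trim-map []      = refl
  trim-map (s ∷ r) = trans (cong (mapSymbol φ s ∷ᵗ_) (trim-map r)) (sym (mapSymbol-∷ᵗ φ s (trim r)))

  embedTape : Tape A → Tape B
  embedTape t = mapTape φ (normal t)

  embedTape-act : ∀ s d t → embedTape (move d (write s t)) ≡ actᵗ (mapSymbol φ s , d) (embedTape t)
  embedTape-act s d t = trans (cong (mapTape φ) (normal-move d (write s t)))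
    (mapTape-move φ d (normal (write s t)))

  contents-embed : ∀ t → contents (embedTape t) ≡ contents t
  contents-embed t = trans (contents-map φ (normal t)) (contents-normal t)

  Trimmed-embed : ∀ t → Trimmed (embedTape t)
  Trimmed-embed t = trans (trim-map (trim (after t))) (cong (map (mapSymbol φ)) (trim-idempotent (after t)))

module _ {A : Set} where

  extent : Tape A → ℕ
  extent t = length (before t) + length (after t)

  extent-act : ∀ s d (t : Tape A) → extent (move d (write s t)) ≤ suc (extent t)
  extent-act s left  (tape []      _ r)       = n≤1+n _
  extent-act s left  (tape (x ∷ l) _ r)       = ≤-trans (≤-reflexive (+-suc (length l) (length r))) (n≤1+n _)
  extent-act s stay  t                        = n≤1+n _
  extent-act s right (tape l _ [])            = ≤-refl
  extent-act s right (tape l _ (x ∷ r))       =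
    ≤-trans (≤-reflexive (sym (+-suc (length l) (length r)))) (n≤1+n _)

  length-∷ᵗ : ∀ s (r : List (Symbol A)) → length (s ∷ᵗ r) ≤ suc (length r)
  length-∷ᵗ blank   []      = z≤n
  length-∷ᵗ blank   (_ ∷ _) = ≤-refl
  length-∷ᵗ (bit _) r       = ≤-refl
  length-∷ᵗ (aux _) r       = ≤-refl

  length-trim : ∀ (r : List (Symbol A)) → length (trim r) ≤ length r
  length-trim []      = z≤n
  length-trim (s ∷ r) = ≤-trans (length-∷ᵗ s (trim r)) (s≤s (length-trim r))

  length-leadingBits : ∀ (r : List (Symbol A)) → length (leadingBits r) ≤ length r
  length-leadingBits []          = z≤n
  length-leadingBits (blank ∷ r) = z≤n
  length-leadingBits (bit b ∷ r) = s≤s (length-leadingBits r)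
  length-leadingBits (aux a ∷ r) = z≤n

  length-contents : ∀ (t : Tape A) → length (contents t) ≤ suc (extent t)
  length-contents (tape l s r) = ≤-trans (length-leadingBits (l ʳ++ (s ∷ r)))
    (≤-reflexive (trans (List.length-ʳ++ l) (+-suc (length l) (length r))))

  iter : (Tape A → Tape A) → ℕ → Tape A → Tape A
  iter φ zero    t = t
  iter φ (suc j) t = φ (iter φ j t)

  wiped : Tape A → Tape A
  wiped = actᵗ (blank , left)

  rights-after : ∀ j (t : Tape A) → length (after t) ≤ j →
                 after (iter (moveᵗ right) j t) ≡ [] × length (before (iter (moveᵗ right) j t))
                   ≡ length (before t) + j
  rights-after j t le = go j t le , moved j
    where
    commute : ∀ j (t : Tape A) → iter (moveᵗ right) (suc j) t ≡ iter (moveᵗ right) j (moveᵗ right t)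
    commute zero    t = refl
    commute (suc j) t = cong (moveᵗ right) (commute j t)
    go : ∀ j (t : Tape A) → length (after t) ≤ j → after (iter (moveᵗ right) j t) ≡ []
    go zero    (tape l s [])      le       = refl
    go (suc j) (tape l s [])      le       =
      trans (cong after (commute j (tape l s []))) (go j (tape (s ∷ l) blank []) z≤n)
    go (suc j) (tape l s (x ∷ r)) (s≤s le) =
      trans (cong after (commute j (tape l s (x ∷ r)))) (go j (tape (s ∷ l) x r) le)
    moved : ∀ j → length (before (iter (moveᵗ right) j t)) ≡ length (before t) + j
    moved zero    = sym (+-identityʳ _)
    moved (suc j) = trans (length-before-right (iter (moveᵗ right) j t))
      (trans (cong suc (moved j)) (sym (+-suc _ j)))

  wiped-all : ∀ j (t : Tape A) → after t ≡ [] → length (before t) < j → iter wiped j t ≡ blankTape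
  wiped-all (suc j) t eq lt = trans (commute j t) (go j t eq (≤-pred lt))
    where
    commute : ∀ j (t : Tape A) → iter wiped (suc j) t ≡ iter wiped j (wiped t)
    commute zero    t = refl
    commute (suc j) t = cong wiped (commute j t)
    fixed′ : ∀ j → iter wiped j (blankTape {A}) ≡ blankTape
    fixed′ zero    = refl
    fixed′ (suc j) = cong wiped (fixed′ j)
    go : ∀ j (t : Tape A) → after t ≡ [] → length (before t) ≤ j → iter wiped j (wiped t) ≡ blankTape
    go j       (tape []      s _) refl le       = fixed′ j
    go (suc j) (tape (x ∷ l) s _) refl (s≤s le) = trans (commute j (tape l x [])) (go j (tape l x []) refl le)

  -- The simulated machine may write any symbol of its own, so the ends of its tapes cannot be
  -- recognised. For a tape of extent at most `N`, however, `N` moves right pass everything written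
  -- and end at most `2 * N` cells from the left end, so that `2 * N + 1` wiping moves left clear
  -- it; surplus ones do nothing.
  erase : ℕ → Tape A → Tape A
  erase N t = wiped (iter (wiped ∘ wiped) N (iter (moveᵗ right) N t))

  erase-blank : ∀ N (t : Tape A) → extent t ≤ N → erase N t ≡ blankTape
  erase-blank N t le = trans (cong wiped (double N _)) (wiped-all (suc (N + N)) _ (proj₁ ra)
    (s≤s (≤-trans (≤-reflexive (proj₂ ra)) (+-monoˡ-≤ N (≤-trans (m≤m+n _ _) le)))))
    where
    ra = rights-after N t (≤-trans (m≤n+m _ (length (before t))) le)
    double : ∀ j t → iter (wiped ∘ wiped) j t ≡ iter wiped (j + j) t
    double zero    t = refl
    double (suc j) t = cong wiped (trans (cong wiped (double j t))
      (cong (λ i → iter wiped i t) (sym (+-suc j j))))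

module Simulation (M : RandomizedTM 1) where

  open Queries M public

  raise : M.Aux → Mark
  raise = inj₂ ∘ inj₁

  lower : Sym → Symbol M.Aux
  lower blank                 = blank
  lower (bit b)               = bit b
  lower (aux (inj₂ (inj₁ a))) = aux a
  lower (aux _)               = blank

  lower-raise : ∀ s → lower (mapSymbol raise s) ≡ s
  lower-raise blank   = refl
  lower-raise (bit b) = refl
  lower-raise (aux a) = refl

  Transition : Set
  Transition = M.State × Vec (Symbol M.Aux × Move) M.tapes

  stateOf : Sym → Maybe M.State
  stateOf (aux (inj₁ q)) = just q
  stateOf _              = nothing

  -- The string of `n` ones settles whether the address is within the input; the bit itself comes
  -- from the history.
  answered : Maybe Bool → Bool → Maybe Bool
  answered nothing  b = nothing
  answered (just _) b = just b

  transition : Maybe M.State → Bool → Maybe Bool → Vec (Symbol M.Aux) M.tapes → Maybe Transition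
  transition nothing  c a ss = nothing
  transition (just q) c a ss with M.halting q
  ... | just _  = nothing
  ... | nothing = just (M.δ q c (a ∷ []) ss)

  raiseAction : Symbol M.Aux × Move → Sym × Move
  raiseAction (s , d) = mapSymbol raise s , d

  enact : Scan → Maybe Transition → Actions
  enact s nothing = idle s
  enact (_ ∷ s₁ ∷ s₂ ∷ _ ∷ s₄ ∷ s₅ ∷ s₆ ∷ s₇ ∷ s₈ ∷ s₉ ∷ s₁₀ ∷ s₁₁ ∷ s₁₂ ∷ s₁₃ ∷ s₁₄ ∷ _)
    (just (q , (s , d) ∷ as)) =
    (mapSymbol raise s , d) ∷ (s₁ , stay) ∷ (s₂ , d) ∷ (stateSym q , stay) ∷ (s₄ , stay) ∷ (s₅ , stay)
      ∷ (s₆ , stay)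
    ∷ (s₇ , stay) ∷ (s₈ , stay) ∷ (s₉ , stay) ∷ (s₁₀ , stay) ∷ (s₁₁ , stay) ∷ (s₁₂ , stay) ∷ (s₁₃ , stay)
      ∷ (s₁₄ , stay)
    ∷ Vec.map raiseAction as

  lowered : Scan → Vec (Symbol M.Aux) M.tapes
  lowered (s ∷ _ ∷ _ ∷ _ ∷ _ ∷ _ ∷ _ ∷ _ ∷ _ ∷ _ ∷ _ ∷ _ ∷ _ ∷ _ ∷ _ ∷ ss) = lower s ∷ Vec.map lower ss

  simulate : Cmd
  simulate = exec λ r s → enact s (transition (stateOf (onSym sta# s)) (cellBit (onSym wt# s))
                                     (answered (Vec.head r) (symBit (onSym ans# s))) (lowered s))

  spread : (Sym → Sym × Move) → Scan → Actions
  spread f (s₀ ∷ s₁ ∷ s₂ ∷ s₃ ∷ s₄ ∷ s₅ ∷ s₆ ∷ s₇ ∷ s₈ ∷ s₉ ∷ s₁₀ ∷ s₁₁ ∷ s₁₂ ∷ s₁₃ ∷ s₁₄ ∷ ss) =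
    f s₀ ∷ (s₁ , stay) ∷ f s₂ ∷ (s₃ , stay) ∷ (s₄ , stay) ∷ (s₅ , stay) ∷ (s₆ , stay)
    ∷ (s₇ , stay) ∷ (s₈ , stay) ∷ (s₉ , stay) ∷ (s₁₀ , stay) ∷ (s₁₁ , stay) ∷ (s₁₂ , stay) ∷ (s₁₃ , stay)
      ∷ (s₁₄ , stay)
    ∷ Vec.map f ss

  allRight wipe toss-step wipe-all trial : Cmd
  allRight = exec (λ _ → spread (λ s → s , right))
  wipe     = exec (λ _ → spread (λ _ → blank , left))

  accepting : Sym → Bool
  accepting s with stateOf s
  ... | nothing = false
  ... | just q  = does (M.halting q ≟ᵛ just true)

  isBitOf : Bool → Sym → Bool
  isBitOf b (bit c) = does (b Bool.≟ c)
  isBitOf b _       = false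

  -- The balance is a unary signed number: its sign is the common value of the
  -- bits on the stack.
  tally : Bool → Cmd
  tally b = goLeft bal# ⨟ branch (sees (isBitOf (not b)) bal#) (put bal# blank stay)
    (branch (sees isBlank bal#) skip (goRight bal#) ⨟ put bal# (bit b) right)

  toss-step = query-lookup ⨟ simulate ⨟ put ans# blank stay
  wipe-all  = sweep wt# allRight (wipe ⨟ wipe) ⨟ wipe ⨟ put pos# mark stay
  trial     = upd sta# (λ _ _ → stateSym M.start , stay) ⨟ sweep wt# skip toss-step
            ⨟ branch (sees accepting sta#) (tally true) (tally false)
            ⨟ wipe-all ⨟ put sta# blank stay

  shown : M.Config → Tapes → Tapes
  shown c σ = record (located (embedTape raise (Vec.head (M.tapeOf c))) σ)
    { sta = single (stateSym (M.state c)) ; mts = Vec.map (embedTape raise) (Vec.tail (M.tapeOf c)) }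

  step-halted : ∀ {ws q v} b ts → M.halting q ≡ just v → M.step ws (M.config q ts) b ≡ M.config q ts
  step-halted b ts eq rewrite eq = refl

  advanceConfig : Transition → Vec (Tape M.Aux) M.tapes → M.Config
  advanceConfig (q , as) ts = M.config q (Vec.zipWith M.act as ts)

  step-running : ∀ {ws q} b ts → M.halting q ≡ nothing →
    M.step ws (M.config q ts) b ≡ advanceConfig (M.δ q b (M.queried ws (M.config q ts)) (Vec.map scanned ts)) ts
  step-running b ts eq rewrite eq = refl

  transition-halted : ∀ {q v} c a ss → M.halting q ≡ just v → transition (just q) c a ss ≡ nothing
  transition-halted c a ss eq rewrite eq = refl

  transition-running : ∀ {q} c a ss → M.halting q ≡ nothing → transition (just q) c a ss
    ≡ just (M.δ q c (a ∷ []) ss)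
  transition-running c a ss eq rewrite eq = refl

  lower-scans : ∀ {n} (ts : Vec (Tape M.Aux) n) →
                Vec.map lower (Vec.map scanned (Vec.map (embedTape raise) ts)) ≡ Vec.map scanned ts
  lower-scans []       = refl
  lower-scans (t ∷ ts) = cong₂ _∷_ (lower-raise (scanned t)) (lower-scans ts)

  raise-actions : ∀ {n} as (ts : Vec (Tape M.Aux) n) →
                  Vec.zipWith actᵗ (Vec.map raiseAction as) (Vec.map (embedTape raise) ts)
                  ≡ Vec.map (embedTape raise) (Vec.zipWith M.act as ts)
  raise-actions []             []       = refl
  raise-actions ((s , d) ∷ as) (t ∷ ts) = cong₂ _∷_ (sym (embedTape-act raise s d t)) (raise-actions as ts)

  perform-enact : ∀ σ c mv → perform (enact (scans (vec (shown c σ))) (just mv)) (vec (shown c σ))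
                             ≡ vec (shown (advanceConfig mv (M.tapeOf c)) σ)
  perform-enact σ (M.config q₀ (t ∷ ts)) (q , (s , d) ∷ as) = cong₃
    (λ t₁ p ms → vec (record σ { addr = t₁ ; pos = p ; sta = single (stateSym q) ; mts = ms }))
    (sym (embedTape-act raise s d t))
    (trans (posTape-move d (write (mapSymbol raise s) (embedTape raise t)))
           (cong (λ t₁ → posTape (length (before t₁))) (sym (embedTape-act raise s d t))))
    (raise-actions as ts)
    where
    cong₃ : ∀ {A B C D : Set} (f : A → B → C → D) {a a′ b b′ c c′} → a ≡ a′ → b ≡ b′ → c ≡ c′ → f a b c
      ≡ f a′ b′ c′
    cong₃ f refl refl refl = refl

  afterCoins : List Bool → List Cell → M.Config
  afterCoins x []      = M.initial
  afterCoins x (c ∷ h) = M.step (x ∷ []) (afterCoins x h) (proj₂ c)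

  Small : ∀ {A n} → ℕ → Vec (Tape A) n → Set
  Small N = VecAll.All (λ t → extent t ≤ N)

  small-act : ∀ {n} N as (ts : Vec (Tape M.Aux) n) → Small N ts → Small (suc N) (Vec.zipWith M.act as ts)
  small-act N []             []       []         = []
  small-act N ((s , d) ∷ as) (t ∷ ts) (le ∷ les) = ≤-trans (extent-act s d t) (s≤s le) ∷ small-act N as ts les

  small-step : ∀ ws c b N → Small N (M.tapeOf c) → Small (suc N) (M.tapeOf (M.step ws c b))
  small-step ws (M.config q ts) b N sm = go (M.halting q) refl
    where
    go : ∀ v → M.halting q ≡ v → Small (suc N) (M.tapeOf (M.step ws (M.config q ts) b))
    go (just v) eq = subst (Small (suc N) ∘ M.tapeOf) (sym (step-halted {ws} b ts eq)) (VecAll.map m≤n⇒m≤1+n sm)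
    go nothing  eq = subst (Small (suc N) ∘ M.tapeOf) (sym (step-running {ws} b ts eq)) (small-act N _ ts sm)

  small-blank : ∀ n → Small 0 (Vec.replicate n (blankTape {M.Aux}))
  small-blank zero    = []
  small-blank (suc n) = z≤n ∷ small-blank n

  small-afterCoins : ∀ x h → Small (length h) (M.tapeOf (afterCoins x h))
  small-afterCoins x []      = small-blank M.tapes
  small-afterCoins x (c ∷ h) = small-step (x ∷ []) (afterCoins x h) (proj₂ c) (length h) (small-afterCoins x h)

  extent-embed : ∀ (t : Tape M.Aux) → extent (embedTape raise t) ≤ extent t
  extent-embed (tape l s r) = +-mono-≤ (≤-reflexive (List.length-map _ l))
    (≤-trans (≤-reflexive (List.length-map _ (trim r))) (length-trim r))

  small-embed : ∀ {n} N (ts : Vec (Tape M.Aux) n) → Small N ts → Small N (Vec.map (embedTape raise) ts)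
  small-embed N []       []         = []
  small-embed N (t ∷ ts) (le ∷ les) = ≤-trans (extent-embed t) le ∷ small-embed N ts les

  -- The tapes `addr`, `pos` and `mts`.
  Simulated : Set
  Simulated = Tape Mark × Tape Mark × Vec (Tape Mark) (suc M.work)

  everywhere : (Tape Mark → Tape Mark) → Simulated → Simulated
  everywhere φ (a , p , ts) = φ a , φ p , Vec.map φ ts

  everywhere-∘ : ∀ φ ψ s → everywhere φ (everywhere ψ s) ≡ everywhere (φ ∘ ψ) s
  everywhere-∘ φ ψ (a , p , ts) = cong (λ ts → φ (ψ a) , φ (ψ p) , ts) (sym (Vec.map-∘ φ ψ ts))

  everywhere-foldr : ∀ φ s (r : List Cell) → foldr (λ _ → everywhere φ) s r ≡ everywhere (iter φ (length r)) s
  everywhere-foldr φ (a , p , ts) []      = cong (λ ts → a , p , ts) (sym (Vec.map-id ts))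
  everywhere-foldr φ s            (c ∷ r) =
    trans (cong (everywhere φ) (everywhere-foldr φ s r)) (everywhere-∘ φ (iter φ (length r)) s)

  erase-small : ∀ {n} N (ts : Vec (Tape Mark) n) → Small N ts → Vec.map (erase N) ts ≡ Vec.replicate n blankTape
  erase-small N []       []         = refl
  erase-small N (t ∷ ts) (le ∷ les) = cong₂ _∷_ (erase-blank N t le) (erase-small N ts les)

  extent-posTape : ∀ j → extent (posTape j) ≡ j
  extent-posTape zero    = refl
  extent-posTape (suc j) = trans (+-identityʳ _) (length-trail j)
    where
    length-trail : ∀ j → length (trail j) ≡ suc j
    length-trail zero    = refl
    length-trail (suc j) = cong suc (length-trail j)

  net : ℕ → ℕ → List Bool
  net zero    r       = replicate r false
  net (suc a) zero    = replicate (suc a) true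
  net (suc a) (suc r) = net a r

  vote : Bool → ℕ × ℕ → ℕ × ℕ
  vote true  (a , r) = suc a , r
  vote false (a , r) = a , suc r

  tallied : Bool → List Bool → List Bool
  tallied b []       = b ∷ []
  tallied b (c ∷ cs) = if does (not b Bool.≟ c) then cs else b ∷ c ∷ cs

  tallied-net : ∀ b a r → tallied b (net a r) ≡ uncurry net (vote b (a , r))
  tallied-net true  zero    zero    = refl
  tallied-net true  zero    (suc r) = refl
  tallied-net true  (suc a) zero    = refl
  tallied-net true  (suc a) (suc r) = tallied-net true a r
  tallied-net false zero    zero    = refl
  tallied-net false zero    (suc r) = refl
  tallied-net false (suc zero)    zero = refl
  tallied-net false (suc (suc a)) zero = refl
  tallied-net false (suc a) (suc r) = tallied-net false a r

  ready : Tapes → Tapes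
  ready σ = record σ { addr = blankTape ; pos = posTape 0 ; sta = blankTape ; ans = blankTape ; cand = blankTape
                     ; sav = blankTape ; mts = Vec.replicate _ blankTape }

  accepts : List Bool → List Cell → Bool
  accepts x h = does (M.verdict (afterCoins x h) ≟ᵛ just true)

  wipeCost : ℕ → ℕ
  wipeCost N = sweepCost 1 (1 + 1) N + (1 + 1)

  tossCost trialCost : ℕ → ℕ → ℕ
  tossCost N P  = lookupCost N P + (1 + 1)
  trialCost N P = 1 + (sweepCost 1 (tossCost N P) N + (suc 5 + (wipeCost N + 1)))

  module SimulationRuns (u : List Bool) where

    open QueryRuns (u ∷ []) public

    simulate-run : ∀ σ c x l κ b r a →
      x at value (contents (Vec.head (M.tapeOf c)))
        ≡ answered (u at value (contents (Vec.head (M.tapeOf c)))) a →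
      Exec simulate (vec (shown c (record σ { wt = rightward l ((κ , b) ∷ r) ; ans = single (bit a) })))
                    (vec (shown (M.step (x ∷ []) c b)
                      (record σ { wt = rightward l ((κ , b) ∷ r) ; ans = single (bit a) }))) 1
    simulate-run σ (M.config q (t ∷ ts)) x l κ b r a same = go (M.halting q) refl
      where
      σ₁ = record σ { wt = rightward l ((κ , b) ∷ r) ; ans = single (bit a) }
      σ′ = shown (M.config q (t ∷ ts)) σ₁
      go : ∀ v → M.halting q ≡ v → Exec simulate (vec σ′)
        (vec (shown (M.step (x ∷ []) (M.config q (t ∷ ts)) b) σ₁)) 1
      go (just v) eq = exec⇓ (trans
        (cong (λ m → perform (enact (scans (vec σ′)) m) (vec σ′)) (transition-halted b _ _ eq))
        (trans (perform-idle (vec σ′)) (cong (λ c → vec (shown c σ₁))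
          (sym (step-halted {x ∷ []} b (t ∷ ts) eq)))))
      go nothing  eq = exec⇓ (trans
        (cong (λ m → perform (enact (scans (vec σ′)) m) (vec σ′)) (trans (transition-running b _ _ eq)
          (cong₂ (λ a ss → just (M.δ q b (a ∷ []) ss))
            (trans (cong (λ w → answered (u at value w) a) (contents-embed raise t)) (sym same))
            (lower-scans (t ∷ ts)))))
        (trans (perform-enact σ₁ (M.config q (t ∷ ts))
          (M.δ q b (M.queried (x ∷ []) (M.config q (t ∷ ts))) (Vec.map scanned (t ∷ ts))))
            (cong (λ c → vec (shown c σ₁)) (sym (step-running {x ∷ []} b (t ∷ ts) eq)))))

    -- The virtual input `x` has length `n` and is too long to be written down for each play; it
    -- exists only through the answers to queries.
    Faithful : List Bool → List Cell → Set
    Faithful x h = ∀ w → x at value w ≡ answered (u at value w) (reply (entries h) w false)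

    module _ (σ : Tapes) (x : List Bool) (hᶜ : List Cell) (faithful : Faithful x hᶜ) where

      private
        running : Tape Mark → M.Config → Tapes
        running w c = record (shown c σ)
          { wt = w ; ct = resting hᶜ ; sav = blankTape ; ans = blankTape ; cand = blankTape }

      toss-run : ∀ N l κ b r → suc (length l) ≤ N →
        Exec toss-step (vec (running (rightward l ((κ , b) ∷ r)) (afterCoins x l)))
                       (vec (running (rightward l ((κ , b) ∷ r)) (afterCoins x ((κ , b) ∷ l))))
                         (tossCost N (length hᶜ))
      toss-run N l κ b r le =
        lookup-run (record (shown c σ) { wt = rightward l ((κ , b) ∷ r) }) N t hᶜ blank (Trimmed-embed raise t₀)
          (≤-trans (length-contents t) (≤-trans (s≤s small) le))
          (≤-trans (≤-trans (m≤m+n _ (length (after t))) small) (<⇒≤ le))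
        ⨟⇓ simulate-run (record σ { ct = resting hᶜ ; sav = blankTape ; cand = blankTape }) c x l κ b r
          (reply (entries hᶜ) (contents t) false)
             (trans (faithful (contents t₀))
               (cong (λ w → answered (u at value (contents t₀)) (reply (entries hᶜ) w false))
               (sym (contents-embed raise t₀))))
        ⨟⇓ upd⇓ refl
        where
        c  = afterCoins x l
        t₀ = Vec.head (M.tapeOf c)
        t  = embedTape raise t₀
        small : extent t ≤ length l
        small = ≤-trans (extent-embed t₀) (head-small (M.tapeOf c) (small-afterCoins x l))
          where
          head-small : ∀ {n N} (ts : Vec (Tape M.Aux) (suc n)) → Small N ts → extent (Vec.head ts) ≤ N
          head-small (t ∷ ts) (le ∷ _) = le

      coins-run : ∀ h → Exec (sweep wt# skip toss-step) (vec (running (resting h) M.initial))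
                             (vec (running (resting h) (afterCoins x h)))
                               (sweepCost 1 (tossCost (length h) (length hᶜ)) (length h))
      coins-run h = sweep-run {h = h} (λ _ _ → M.initial) (λ l r → afterCoins x l)
        (λ _ _ _ _ → skip⇓) (λ l (κ , b) r eq → toss-run (length h) l κ b r (shorter l (κ , b) r eq))
          (λ _ → refl)
        where
        open On {A = M.Config} wt# (λ w c → vec (running w c)) (λ _ _ → refl) (λ _ _ _ → refl)
        shorter : ∀ l c r → l ʳ++ (c ∷ r) ≡ h ʳ++ [] → suc (length l) ≤ length h
        shorter l c r eq = begin
          suc (length l)               ≤⟨ m≤m+n _ (length r) ⟩
          suc (length l + length r)    ≡⟨ +-suc (length l) (length r) ⟨
          length l + suc (length r)    ≡⟨ List.length-ʳ++ l ⟨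
          length (l ʳ++ (c ∷ r))       ≡⟨ cong length eq ⟩
          length (h ʳ++ [])            ≡⟨ List.length-reverse h ⟩
          length h                     ∎
          where open ≤-Reasoning

    tally-run : ∀ σ b a r → Exec (tally b) (vec (record σ { bal = stack (map bit (net a r)) }))
                                          (vec (record σ { bal = stack (map bit
                                            (uncurry net (vote b (a , r)))) })) 5
    tally-run σ b a r = ends-in (cong (λ cs → vec (record σ { bal = stack (map bit cs) }))
      (tallied-net b a r)) (go (net a r))
      where
      go : ∀ cs → Exec (tally b) (vec (record σ { bal = stack (map bit cs) }))
        (vec (record σ { bal = stack (map bit (tallied b cs)) })) 5
      go []       = upd⇓ refl ⨟⇓ else⇓ refl (then⇓ refl skip⇓ ⨟⇓ upd⇓ refl)
      go (c ∷ cs) with not b Bool.≟ c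
      ... | yes p = weaken (s≤s (s≤s (s≤s z≤n))) (upd⇓ refl ⨟⇓ then⇓ (dec-true (not b Bool.≟ c) p) (upd⇓ refl))
      ... | no ¬p = upd⇓ refl ⨟⇓ else⇓ (dec-false (not b Bool.≟ c) ¬p) (else⇓ refl (upd⇓ refl) ⨟⇓ upd⇓ refl)

-- Evaluating the leaves of the game

module Leaves (M : RandomizedTM 1) where

  open Simulation M public

  module LeafRuns (u : List Bool) where

    open SimulationRuns u public

    perform-mts : ∀ {n} (f : Sym → Sym × Move) (ts : Vec (Tape Mark) n) →
                  Vec.zipWith actᵗ (Vec.map f (Vec.map scanned ts)) ts
                    ≡ Vec.map (λ t → actᵗ (f (scanned t)) t) ts
    perform-mts f []       = refl
    perform-mts f (t ∷ ts) = cong (_ ∷_) (perform-mts f ts)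

    simulated : Tapes → Tape Mark → Simulated → Tapes
    simulated σ w (a , p , ts) = record σ { wt = w ; addr = a ; pos = p ; mts = ts }

    spread-run : ∀ σ w s (f : Sym → Sym × Move) → Exec (exec (λ _ → spread f)) (vec (simulated σ w s))
                   (vec (simulated σ w (everywhere (λ t → actᵗ (f (scanned t)) t) s))) 1
    spread-run σ w (a , p , ts) f =
      exec⇓ (cong (λ ts → vec (simulated σ w (actᵗ (f (scanned a)) a , actᵗ (f (scanned p)) p , ts)))
        (perform-mts f ts))

    wipe-run : ∀ σ h a p ts → extent a ≤ length h → extent p ≤ length h → Small (length h) ts →
      Exec wipe-all (vec (record σ { wt = resting h ; addr = a ; pos = p ; mts = ts }))
                    (vec (record σ { wt = resting h ; addr = blankTape ; pos = posTape 0
                      ; mts = Vec.replicate _ blankTape }))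
                    (wipeCost (length h))
    wipe-run σ h a p ts le le′ les =
      sweep-run {h = h} (λ l r → foldr (λ _ → everywhere (moveᵗ right)) s r)
        (λ l r → foldr (λ _ s → everywhere wiped (everywhere wiped s))
          (foldr (λ _ → everywhere (moveᵗ right)) s (l ʳ++ r)) l)
        (λ l c r _ → spread-run σ (leftward (c ∷ l) r) _ (λ s → s , right))
        (λ l c r _ → spread-run σ (rightward l (c ∷ r)) _ (λ _ → blank , left)
          ⨟⇓ spread-run σ (rightward l (c ∷ r)) _ (λ _ → blank , left))
        (λ r → refl)
      ⨟⇓ ends-in (cong (λ s → vec (simulated σ (resting h) s)) erased)
        (spread-run σ (resting h) moved (λ _ → blank , left))
      ⨟⇓ upd⇓ refl
      where
      s : Simulated
      s = a , p , ts
      open On {A = Simulated} wt# (λ w s → vec (simulated σ w s)) (λ _ _ → refl) (λ _ _ _ → refl)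
      righted = foldr (λ _ → everywhere (moveᵗ right)) s (h ʳ++ [])
      moved = foldr (λ _ s → everywhere wiped (everywhere wiped s)) righted h
      twice : ∀ s (r : List Cell) → foldr (λ _ s → everywhere wiped (everywhere wiped s)) s r
        ≡ everywhere (iter (wiped ∘ wiped) (length r)) s
      twice (a , p , ts) []      = cong (λ ts → a , p , ts) (sym (Vec.map-id ts))
      twice s            (c ∷ r) = trans (cong (everywhere wiped ∘ everywhere wiped) (twice s r))
        (trans (cong (everywhere wiped) (everywhere-∘ wiped (iter (wiped ∘ wiped) (length r)) s))
          (everywhere-∘ wiped (wiped ∘ iter (wiped ∘ wiped) (length r)) s))
      N = length h
      erased : everywhere wiped moved ≡ (blankTape , blankTape , Vec.replicate _ blankTape)
      erased = trans (cong (everywhere wiped)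
        (trans (twice righted h) (cong (everywhere (iter (wiped ∘ wiped) N))
                 (trans (everywhere-foldr (moveᵗ right) s (h ʳ++ []))
                   (cong (λ j → everywhere (iter (moveᵗ right) j) s) (List.length-reverse h))))))
               (trans (cong (everywhere wiped) (everywhere-∘ (iter (wiped ∘ wiped) N) (iter (moveᵗ right) N) s))
               (trans (everywhere-∘ wiped (iter (wiped ∘ wiped) N ∘ iter (moveᵗ right) N) s)
                 (cong₂ _,_ (erase-blank N a le) (cong₂ _,_ (erase-blank N p le′) (erase-small N ts les)))))

    map-embed-blank : ∀ n → Vec.map (embedTape raise) (Vec.replicate n blankTape) ≡ Vec.replicate n blankTape
    map-embed-blank zero    = refl
    map-embed-blank (suc n) = cong (blankTape ∷_) (map-embed-blank n)

    trial-run : ∀ σ x hᶜ h a r → Faithful x hᶜ →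
      Exec trial (vec (record (ready σ) { wt = resting h ; ct = resting hᶜ ; bal = stack (map bit (net a r)) }))
                 (vec (record (ready σ) { wt = resting h ; ct = resting hᶜ
                                        ; bal = stack (map bit (uncurry net (vote (accepts x h) (a , r)))) }))
                 (trialCost (length h) (length hᶜ))
    trial-run σ x hᶜ h a r faithful =
      upd⇓ (cong (λ ts → vec (record (ready σ₁)
        { sta = single (stateSym M.start) ; mts = ts ; bal = stack (map bit (net a r)) }))
          (sym (map-embed-blank (suc M.work))))
      ⨟⇓ coins-run (record σ { bal = stack (map bit (net a r)) }) x hᶜ faithful h
      ⨟⇓ decide (accepts x h) refl
      ⨟⇓ wipe-run (record (ready σ₁) { sta = single (stateSym (M.state c))
        ; bal = stack (map bit (uncurry net (vote (accepts x h) (a , r)))) })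
           h (embedTape raise (Vec.head (M.tapeOf c)))
             (posTape (length (before (embedTape raise (Vec.head (M.tapeOf c))))))
           (Vec.map (embedTape raise) (Vec.tail (M.tapeOf c)))
           small₀ (≤-trans (≤-reflexive (extent-posTape (length (before a₀))))
             (≤-trans (m≤m+n _ (length (after a₀))) small₀)) small₁
      ⨟⇓ upd⇓ refl
      where
      σ₁ = record σ { wt = resting h ; ct = resting hᶜ }
      c = afterCoins x h
      a₀ = embedTape raise (Vec.head (M.tapeOf c))
      parts : ∀ {n N} (ts : Vec (Tape M.Aux) (suc n)) → Small N ts →
              extent (embedTape raise (Vec.head ts)) ≤ N × Small N (Vec.map (embedTape raise) (Vec.tail ts))
      parts (t ∷ ts) (le ∷ les) = ≤-trans (extent-embed t) le , small-embed _ ts les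
      small₀ = proj₁ (parts (M.tapeOf c) (small-afterCoins x h))
      small₁ = proj₂ (parts (M.tapeOf c) (small-afterCoins x h))
      σ₂ : ℕ × ℕ → Tapes
      σ₂ ar = record (shown c σ₁) { sav = blankTape ; ans = blankTape ; cand = blankTape
        ; bal = stack (map bit (uncurry net ar)) }
      decide : ∀ b → accepts x h ≡ b →
        Exec (branch (sees accepting sta#) (tally true) (tally false)) (vec (σ₂ (a , r)))
          (vec (σ₂ (vote b (a , r)))) 6
      decide true  eq = then⇓ eq (tally-run (σ₂ (a , r)) true a r)
      decide false eq = else⇓ eq (tally-run (σ₂ (a , r)) false a r)

-- Backward induction on the table of game values

module Evaluation (M : RandomizedTM 1) where

  open Leaves M public

  foldPlays-++ : ∀ {A : Set} κs κs′ (f : List Cell → A → A) h a →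
                 foldPlays (κs ++ κs′) f h a ≡ foldPlays κs (foldPlays κs′ f) h a
  foldPlays-++ []       κs′ f h a = refl
  foldPlays-++ (κ ∷ κs) κs′ f h a = trans (foldPlays-++ κs κs′ f _ _)
    (cong (foldPlays κs (foldPlays κs′ f) ((κ , true) ∷ h)) (foldPlays-++ κs κs′ f _ a))

  foldPlays-pairs : ∀ {A : Set} κs (F : List Cell → A × A) h ps →
    foldPlays κs (λ h xs → proj₂ (F h) ∷ proj₁ (F h) ∷ xs) h (pairs↓ ps)
      ≡ pairs↓ (foldPlays κs (λ h ps → F h ∷ ps) h ps)
  foldPlays-pairs []       F h ps = refl
  foldPlays-pairs (κ ∷ κs) F h ps = trans
    (cong (foldPlays κs _ ((κ , true) ∷ h)) (foldPlays-pairs κs F ((κ , false) ∷ h) ps))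
    (foldPlays-pairs κs F ((κ , true) ∷ h) _)

  -- The odometer visits the plays in increasing order and each value goes on top of the stack,
  -- whence the decreasing order of `table`.
  foldPlays-table : ∀ {A : Set} K (F : List Cell → A) → foldPlays (K ʳ++ []) (λ h xs → F h ∷ xs) [] []
    ≡ table K F
  foldPlays-table []      F = refl
  foldPlays-table (κ ∷ K) F = trans
    (cong (λ κs → foldPlays κs (λ h xs → F h ∷ xs) [] []) (List.unfold-reverse κ K))
    (trans (foldPlays-++ (K ʳ++ []) (κ ∷ []) (λ h xs → F h ∷ xs) [] [])
    (trans (foldPlays-pairs (K ʳ++ []) (λ h → F ((κ , false) ∷ h) , F ((κ , true) ∷ h)) [] [])
           (cong pairs↓ (foldPlays-table K _))))

  length-play : ∀ κs s h → length (play κs s h) ≡ length κs + length h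
  length-play []       s       h = refl
  length-play (κ ∷ κs) []      h = trans (length-play κs [] _) (+-suc (length κs) (length h))
  length-play (κ ∷ κs) (b ∷ s) h = trans (length-play κs s _) (+-suc (length κs) (length h))

  kinds-play : ∀ κs s h → kinds (play κs s h) ≡ κs ʳ++ kinds h
  kinds-play []       s       h = refl
  kinds-play (κ ∷ κs) []      h = kinds-play κs [] _
  kinds-play (κ ∷ κs) (b ∷ s) h = kinds-play κs s _

  votes : List Bool → List Kind → List Cell → ℕ × ℕ → ℕ × ℕ
  votes x κs = foldPlays κs (λ h → vote (accepts x h))

  majority : List Bool → List Kind → Bool
  majority x κs = firstBit (uncurry net (votes x κs [] (0 , 0)))

  total-vote : ∀ b ar → proj₁ (vote b ar) + proj₂ (vote b ar) ≡ suc (proj₁ ar + proj₂ ar)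
  total-vote true  ar      = refl
  total-vote false (a , r) = +-suc a r

  total-votes : ∀ x κs h ar → proj₁ (votes x κs h ar) + proj₂ (votes x κs h ar) ≡ 2 ^ length κs
    + (proj₁ ar + proj₂ ar)
  total-votes x []       h ar = total-vote (accepts x h) ar
  total-votes x (κ ∷ κs) h ar = trans (total-votes x κs ((κ , true) ∷ h) _)
    (trans (cong (2 ^ length κs +_) (total-votes x κs ((κ , false) ∷ h) ar))
    (trans (sym (+-assoc (2 ^ length κs) _ _)) (cong (λ z → 2 ^ length κs + z + _) (sym (+-identityʳ _)))))

  length-net : ∀ a r → length (net a r) ≤ a + r
  length-net zero    r       = ≤-reflexive (List.length-replicate r)
  length-net (suc a) zero    = s≤s (≤-trans (≤-reflexive (List.length-replicate a)) (m≤m+n a 0))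
  length-net (suc a) (suc r) = ≤-trans (length-net a r) (≤-trans (+-monoʳ-≤ a (n≤1+n r)) (n≤1+n _))

  -- `nothing` needs a symbol of its own, as a blank would be taken for the bottom of the stack.
  valueSym : Value → Sym
  valueSym nothing  = mark
  valueSym (just b) = bit b

  valueOf : Sym → Value
  valueOf (bit b) = just b
  valueOf _       = nothing

  valueOf-Sym : ∀ v → valueOf (valueSym v) ≡ v
  valueOf-Sym nothing  = refl
  valueOf-Sym (just b) = refl

  valueSym-full : ∀ v → isBlank (valueSym v) ≡ false
  valueSym-full nothing  = refl
  valueSym-full (just b) = refl

  kindOf : Sym → Kind
  kindOf (aux (inj₂ (inj₂ (just (κ , _))))) = κ
  kindOf _                                  = toss

  emitted : Sym → Bool → Sym → Sym × Move
  emitted s b t = if emits (kindOf s) then (bit b , right) else (t , stay)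

  -- `tab` holds the values of all histories of one length. `foldLevel` halves it, combining
  -- siblings onto `tmp` while their choice bits go to `stk`, and then moves the results back while
  -- pushing the type bits. As the longest histories come first, popping `stk` at the end yields the
  -- advice in its final order.
  evaluateLeaf foldPair unfoldValue foldLevel writeBit output evaluate-game : Cmd
  evaluateLeaf = odometer wt# trial
    ⨟ goLeft bal# ⨟ upd tab# (λ _ s → bit (isBitOf true (onSym bal# s)) , right)
    ⨟ while (sees-no isBlank bal#) (skip ⨟ pop bal#)
  foldPair = upd cand# (λ _ s → onSym tab# s , stay) ⨟ pop tab#
    ⨟ upd tmp# (λ _ s → valueSym (combine (kindOf (onSym ct# s)) (valueOf (onSym tab# s))
      (valueOf (onSym cand# s))) , right)
    ⨟ upd stk# (λ _ s → emitted (onSym ct# s)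
        (choiceBit (kindOf (onSym ct# s)) (valueOf (onSym tab# s)) (valueOf (onSym cand# s))) (onSym stk# s))
    ⨟ put cand# blank stay ⨟ pop tab#
  unfoldValue = upd tab# (λ _ s → onSym tmp# s , right)
    ⨟ upd stk# (λ _ s → emitted (onSym ct# s) (typeBit (kindOf (onSym ct# s))) (onSym stk# s)) ⨟ pop tmp#
  foldLevel = goLeft tab# ⨟ while (sees-no isBlank tab#) foldPair ⨟ goLeft tmp#
    ⨟ while (sees-no isBlank tmp#) unfoldValue
  writeBit  = upd out# (λ _ s → onSym stk# s , right) ⨟ pop stk#
  output    = put stk# (bit false) right ⨟ put stk# (bit false) right ⨟ goLeft stk#
    ⨟ while (sees-no isBlank stk#) writeBit
  evaluate-game = odometer ct# evaluateLeaf ⨟ sweep ct# foldLevel skip ⨟ output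

  leafCost : ℕ → ℕ → ℕ
  leafCost L N = (odometerCost (trialCost L N) L + 1 + (1 + loop 1 L)) + (1 + (1 + loop (1 + 1) (2 ^ L)))

  foldCost outputCost : ℕ → ℕ
  foldCost N   = 1 + (loop 6 (2 ^ N) + (1 + loop 3 (2 ^ N)))
  outputCost j = 1 + (1 + (1 + loop 2 j))

  evaluateCost : ℕ → ℕ → ℕ
  evaluateCost L N = (odometerCost (leafCost L N) N + 1 + (1 + loop 1 N))
    + (sweepCost (foldCost N) 1 N + outputCost (2 ^ suc N))

  module EvaluationRuns (u : List Bool) where

    open LeafRuns u public

    leaf-run : ∀ σ L x hᶜ vs → Faithful x hᶜ → let κs = replicate L toss in
      Exec evaluateLeaf
        (vec (record (ready σ) { wt = resting (play κs [] []) ; ct = resting hᶜ ; bal = blankTape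
          ; tab = stack vs }))
        (vec (record (ready σ) { wt = resting (play κs [] []) ; ct = resting hᶜ ; bal = blankTape
                               ; tab = stack (bit (majority x κs) ∷ vs) }))
        (leafCost L (length hᶜ))
    leaf-run σ L x hᶜ vs faithful =
      takes (cong (λ j → odometerCost (trialCost L (length hᶜ)) j + 1 + (1 + loop 1 j))
        (List.length-replicate L))
            (odometer-run (λ h → vote (accepts x h)) κs
              (λ s (a , r) → takes (cong (λ j → trialCost j (length hᶜ))
                (trans (length-play κs s []) (trans (+-identityʳ _) (List.length-replicate L))))
                 (trial-run (record σ { tab = stack vs }) x hᶜ (play κs s []) a r faithful))
              (0 , 0))
      ⨟⇓ upd⇓ (cong (λ t → vec (record σ₁ { bal = t })) (top-bits (uncurry net ar)))
      ⨟⇓ upd⇓ (cong (λ b → vec (record σ₁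
        { bal = top (map bit (uncurry net ar)) ; tab = stack (bit b ∷ vs) })) (leader (uncurry net ar)))
      ⨟⇓ weaken (loop-mono 2 short)
           (On.drain-loop {A = ⊤} bal# (λ t _ →
             vec (record σ₁ { bal = t ; tab = stack (bit (majority x κs) ∷ vs) })) (λ _ _ → refl)
               (λ _ _ _ → refl)
              bit (λ _ → refl) (length (uncurry net ar)) (λ _ → tt) (λ _ _ _ → skip⇓) (uncurry net ar) ≤-refl)
      where
      κs = replicate L toss
      place : Tape Mark → ℕ × ℕ → Store
      place w (a , r) = vec (record (ready σ)
        { wt = w ; ct = resting hᶜ ; bal = stack (map bit (net a r)) ; tab = stack vs })
      open On {A = ℕ × ℕ} wt# place (λ _ _ → refl) (λ _ _ _ → refl) using (odometer-run)
      ar = votes x κs [] (0 , 0)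
      σ₁ = record (ready σ) { wt = resting (play κs [] []) ; ct = resting hᶜ ; tab = stack vs }
      top-bits : ∀ cs → moveᵗ left (stack (map bit cs)) ≡ top (map bit cs)
      top-bits []      = refl
      top-bits (_ ∷ _) = refl
      leader : ∀ cs → isBitOf true (scanned (top (map bit cs))) ≡ firstBit cs
      leader []          = refl
      leader (true ∷ _)  = refl
      leader (false ∷ _) = refl
      short : length (uncurry net ar) ≤ 2 ^ L
      short = ≤-trans (length-net (proj₁ ar) (proj₂ ar)) (≤-reflexive (trans (total-votes x κs [] (0 , 0))
        (trans (+-identityʳ _) (cong (2 ^_) (List.length-replicate L)))))

    fold-pairs : ∀ σ l κ b r ps ws bs →
      Exec (while (sees-no isBlank tab#) foldPair)
        (vec (record σ { ct = leftward ((κ , b) ∷ l) r ; cand = blankTape ; tab = top (map valueSym (pairs↓ ps))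
                       ; tmp = stack (map valueSym ws) ; stk = stack (map bit bs) }))
        (vec (record σ { ct = leftward ((κ , b) ∷ l) r ; cand = blankTape ; tab = blankTape
                       ; tmp = stack (map valueSym (map (uncurry (combine κ)) ps ʳ++ ws))
                       ; stk = stack (map bit (if emits κ then map
                         (uncurry (choiceBit κ)) ps ʳ++ bs else bs)) }))
        (loop 6 (length ps))
    fold-pairs σ l κ b r [] ws bs = ends-in (cong (λ cs → vec (record σ
        { ct = leftward ((κ , b) ∷ l) r ; cand = blankTape ; tab = blankTape ; tmp = stack (map valueSym ws)
          ; stk = stack (map bit cs) }))
      (same (emits κ))) (finish refl)
      where
      same : ∀ e → bs ≡ (if e then bs else bs)
      same true  = refl
      same false = refl
    fold-pairs σ l κ b r ((v₀ , v₁) ∷ ps) ws bs = again (cong not (valueSym-full v₁))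
      (upd⇓ refl ⨟⇓ upd⇓ refl
       ⨟⇓ upd⇓ (cong₂ (λ w₀ w₁ → vec (record σ₁
         { cand = single (valueSym v₁) ; tab = top (map valueSym (v₀ ∷ pairs↓ ps))
                                              ; tmp = stack (valueSym (combine κ w₀ w₁) ∷ map valueSym ws)
                                                })) (valueOf-Sym v₀) (valueOf-Sym v₁))
       ⨟⇓ upd⇓ (trans (cong₂ (λ w₀ w₁ →
         vec (record σ₂ { cand = single (valueSym v₁) ; tab = top (map valueSym (v₀ ∷ pairs↓ ps))
                         ; stk = actᵗ (if emits κ then (bit (choiceBit κ w₀ w₁) , right) else
                           (blank , stay)) (stack (map bit bs)) })) (valueOf-Sym v₀) (valueOf-Sym v₁))
                      (cong (λ t → vec (record σ₂ { cand = single (valueSym v₁)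
                        ; tab = top (map valueSym (v₀ ∷ pairs↓ ps)) ; stk = t }))
                          (push (emits κ) (choiceBit κ v₀ v₁))))
       ⨟⇓ upd⇓ refl
       ⨟⇓ upd⇓ (cong (λ t → vec (record σ₂
         { tab = t ; stk = stack (map bit (pushed (emits κ) (choiceBit κ v₀ v₁))) })) (popped (pairs↓ ps))))
      (ends-in (cong (λ cs → vec (record σ₂ { tab = blankTape ; stk = stack (map bit cs)
                               ; tmp = stack (map valueSym (map (uncurry (combine κ)) ps ʳ++
                                 (combine κ v₀ v₁ ∷ ws))) })) (accumulated (emits κ)))
         (fold-pairs σ l κ b r ps (combine κ v₀ v₁ ∷ ws) (pushed (emits κ) (choiceBit κ v₀ v₁))))
      where
      σ₁ = record σ { ct = leftward ((κ , b) ∷ l) r ; stk = stack (map bit bs) }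
      σ₂ = record σ₁ { cand = blankTape ; tmp = stack (map valueSym (combine κ v₀ v₁ ∷ ws)) }
      pushed : Bool → Bool → List Bool
      pushed e c = if e then c ∷ bs else bs
      push : ∀ e c → actᵗ (if e then (bit c , right) else (blank , stay)) (stack (map bit bs))
        ≡ stack (map bit (pushed e c))
      push true  c = refl
      push false c = refl
      popped : ∀ vs → actᵗ (blank , left) (top (map valueSym (v₀ ∷ vs))) ≡ top (map valueSym vs)
      popped []      = refl
      popped (_ ∷ _) = refl
      accumulated : ∀ e → (if e then map (uncurry (choiceBit κ)) ps ʳ++ pushed e
        (choiceBit κ v₀ v₁) else pushed e (choiceBit κ v₀ v₁))
                          ≡ (if e then map (uncurry (choiceBit κ)) ((v₀ , v₁) ∷ ps) ʳ++ bs else bs)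
      accumulated true  = refl
      accumulated false = refl

    unfold-values : ∀ σ l κ b r ws vs bs →
      Exec (while (sees-no isBlank tmp#) unfoldValue)
        (vec (record σ { ct = leftward ((κ , b) ∷ l) r ; tab = stack (map valueSym vs)
                       ; tmp = top (map valueSym ws) ; stk = stack (map bit bs) }))
        (vec (record σ { ct = leftward ((κ , b) ∷ l) r ; tab = stack (map valueSym (ws ʳ++ vs))
                       ; tmp = blankTape ; stk = stack
                         (map bit (if emits κ then replicate (length ws) (typeBit κ) ++ bs else bs)) }))
        (loop 3 (length ws))
    unfold-values σ l κ b r [] vs bs = ends-in (cong (λ cs → vec (record σ
        { ct = leftward ((κ , b) ∷ l) r ; tab = stack (map valueSym vs) ; tmp = blankTape
          ; stk = stack (map bit cs) }))
      (same (emits κ))) (finish refl)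
      where
      same : ∀ e → bs ≡ (if e then bs else bs)
      same true  = refl
      same false = refl
    unfold-values σ l κ b r (w ∷ ws) vs bs = again (cong not (valueSym-full w))
      (upd⇓ refl
       ⨟⇓ upd⇓ (cong (λ t → vec (record σ₁ { tmp = top (map valueSym (w ∷ ws)) ; stk = t })) (push (emits κ)))
       ⨟⇓ upd⇓ (cong (λ t → vec (record σ₁ { tmp = t ; stk = stack (map bit (pushed (emits κ))) }))
         (popped ws)))
      (ends-in (cong (λ cs → vec (record σ₁
        { tab = stack (map valueSym (ws ʳ++ (w ∷ vs))) ; tmp = blankTape ; stk = stack (map bit cs) }))
                 (accumulated (emits κ)))
         (unfold-values σ l κ b r ws (w ∷ vs) (pushed (emits κ))))
      where
      σ₁ = record σ { ct = leftward ((κ , b) ∷ l) r ; tab = stack (map valueSym (w ∷ vs)) }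
      c = typeBit κ
      pushed : Bool → List Bool
      pushed e = if e then c ∷ bs else bs
      push : ∀ e → actᵗ (if e then (bit c , right) else (blank , stay)) (stack (map bit bs))
        ≡ stack (map bit (pushed e))
      push true  = refl
      push false = refl
      popped : ∀ ws → actᵗ (blank , left) (top (map valueSym (w ∷ ws))) ≡ top (map valueSym ws)
      popped []      = refl
      popped (_ ∷ _) = refl
      shift : ∀ j → replicate j c ++ c ∷ bs ≡ c ∷ replicate j c ++ bs
      shift zero    = refl
      shift (suc j) = cong (c ∷_) (shift j)
      accumulated : ∀ e → (if e then replicate (length ws) c ++ pushed e else pushed e)
                          ≡ (if e then replicate (length (w ∷ ws)) c ++ bs else bs)
      accumulated true  = shift (length ws)
      accumulated false = refl

    level-run : ∀ σ N l κ b r ps bs → length ps ≤ 2 ^ N →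
      Exec foldLevel
        (vec (record σ { ct = leftward ((κ , b) ∷ l) r ; cand = blankTape
          ; tab = stack (map valueSym (pairs↓ ps))
                       ; tmp = blankTape ; stk = stack (map bit bs) }))
        (vec (record σ { ct = leftward ((κ , b) ∷ l) r ; cand = blankTape
          ; tab = stack (map valueSym (map (uncurry (combine κ)) ps))
                       ; tmp = blankTape
                       ; stk = stack (map bit (if emits κ then replicate (length ps) (typeBit κ)
                         ++ (map (uncurry (choiceBit κ)) ps ʳ++ bs) else bs)) }))
        (foldCost N)
    level-run σ N l κ b r ps bs le =
      upd⇓ (cong (λ t → vec (record σ₀ { tab = t })) (lifted (pairs↓ ps)))
      ⨟⇓ weaken (loop-mono 6 le) (fold-pairs σ l κ b r ps [] bs)
      ⨟⇓ upd⇓ (cong (λ t → vec (record σ₁ { tab = blankTape ; tmp = t })) (lifted ws))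
      ⨟⇓ weaken (loop-mono 3 (≤-trans (≤-reflexive lengths) le))
           (ends-in (cong₂ (λ vs cs → vec (record σ₁
             { tab = stack (map valueSym vs) ; tmp = blankTape ; stk = stack (map bit cs) }))
                      (List.reverse-involutive (map (uncurry (combine κ)) ps)) (emission (emits κ)))
             (unfold-values (record σ { cand = blankTape }) l κ b r ws [] cs₁))
      where
      ws = map (uncurry (combine κ)) ps ʳ++ []
      cs₁ = if emits κ then map (uncurry (choiceBit κ)) ps ʳ++ bs else bs
      σ₀ = record σ { ct = leftward ((κ , b) ∷ l) r ; cand = blankTape ; tmp = blankTape
        ; stk = stack (map bit bs) }
      σ₁ = record σ { ct = leftward ((κ , b) ∷ l) r ; cand = blankTape ; stk = stack (map bit cs₁) }
      lifted : ∀ vs → moveᵗ left (stack (map valueSym vs)) ≡ top (map valueSym vs)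
      lifted []      = refl
      lifted (_ ∷ _) = refl
      lengths : length ws ≡ length ps
      lengths = trans (List.length-reverse (map (uncurry (combine κ)) ps)) (List.length-map _ ps)
      emission : ∀ e → (if e then replicate (length ws) (typeBit κ)
        ++ (if e then map (uncurry (choiceBit κ)) ps ʳ++ bs else bs)
                        else (if e then map (uncurry (choiceBit κ)) ps ʳ++ bs else bs))
                       ≡ (if e then replicate (length ps) (typeBit κ)
                         ++ (map (uncurry (choiceBit κ)) ps ʳ++ bs) else bs)
      emission true  = cong (λ j → replicate j (typeBit κ) ++ (map (uncurry (choiceBit κ)) ps ʳ++ bs)) lengths
      emission false = refl

    write-run : ∀ σ bs os →
      Exec (while (sees-no isBlank stk#) writeBit)
        (vec (record σ { out = stack (map bit os) ; stk = top (map bit bs) }))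
        (vec (record σ { out = stack (map bit (bs ʳ++ os)) ; stk = blankTape })) (loop 2 (length bs))
    write-run σ []       os = finish refl
    write-run σ (b ∷ bs) os = again refl
      (upd⇓ refl ⨟⇓ upd⇓ (cong (λ t → vec (record σ { out = stack (map bit (b ∷ os)) ; stk = t })) (popped bs)))
      (write-run σ bs (b ∷ os))
      where
      popped : ∀ bs → actᵗ (blank , left) (top (map bit (b ∷ bs))) ≡ top (map bit bs)
      popped []      = refl
      popped (_ ∷ _) = refl

    output-run : ∀ σ bs →
      Exec output (vec (record σ { out = blankTape ; stk = stack (map bit bs) }))
                  (vec (record σ { out = stack (map bit ((false ∷ false ∷ bs) ʳ++ [])) ; stk = blankTape }))
                  (outputCost (2 + length bs))
    output-run σ bs = upd⇓ refl ⨟⇓ upd⇓ refl ⨟⇓ upd⇓ refl ⨟⇓ write-run σ (false ∷ false ∷ bs) []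

    module _ (g : List Cell → Value) where

      open Advice g

      -- The invariant of the sweep: the kinds in `r` have been folded away, those in `l` still
      -- index the table, and `stk` holds the blocks of the levels already folded.
      levels : List Cell → List Cell → List Value × List Bool
      levels l r = table (kinds l) (gameValue (kinds r) g) , blocks (kinds l) (kinds r)

      folding : Tapes → Tape Mark → List Value × List Bool → Store
      folding σ t (vs , bs) = vec (record σ
        { ct = t ; cand = blankTape ; tab = stack (map valueSym vs) ; tmp = blankTape
          ; stk = stack (map bit bs) })

      fold-run : ∀ σ h → Exec (sweep ct# foldLevel skip) (folding σ (resting h) (levels h []))
                              (folding σ (resting h) (levels [] (h ʳ++ [])))
                                (sweepCost (foldCost (length h)) 1 (length h))
      fold-run σ h = On.sweep-run {A = List Value × List Bool} ct# (folding σ) (λ _ _ → refl) (λ _ _ _ → refl)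
        {h = h} levels (λ l r → levels [] (l ʳ++ r)) step (λ _ _ _ _ → skip⇓) (λ _ → refl)
        where
        step : ∀ l c r → l ʳ++ (c ∷ r) ≡ h ʳ++ [] →
               Exec foldLevel (folding σ (leftward (c ∷ l) r) (levels (c ∷ l) r))
                 (folding σ (leftward (c ∷ l) r) (levels l (c ∷ r))) (foldCost (length h))
        step l (κ , b) r eq = ends-in (cong (folding σ (leftward ((κ , b) ∷ l) r))
          (cong₂ _,_ (map-table (kinds l) (uncurry (combine κ)) (options κ (kinds r))) (block (emits κ))))
          (level-run σ (length h) l κ b r ps (blocks (κ ∷ kinds l) (kinds r)) small)
          where
          ps = table (kinds l) (options κ (kinds r))
          lengths : length ps ≡ 2 ^ length (kinds l)
          lengths = length-table (kinds l) (options κ (kinds r))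
          small : length ps ≤ 2 ^ length h
          small = ≤-trans (≤-reflexive (trans lengths (cong (2 ^_) (length-kinds l)))) (^-monoʳ-≤ 2 (begin
            length l                     ≤⟨ m≤m+n _ (length ((κ , b) ∷ r)) ⟩
            length l + length ((κ , b) ∷ r) ≡⟨ List.length-ʳ++ l ⟨
            length (l ʳ++ ((κ , b) ∷ r)) ≡⟨ cong length eq ⟩
            length (h ʳ++ [])            ≡⟨ List.length-reverse h ⟩
            length h                     ∎))
            where open ≤-Reasoning
          block : ∀ e → (if e then replicate (length ps) (typeBit κ)
            ++ (map (uncurry (choiceBit κ)) ps ʳ++ blocks (κ ∷ kinds l) (kinds r)) else blocks (κ ∷ kinds l)
              (kinds r))
                        ≡ (if e then replicate (2 ^ length (kinds l)) (typeBit κ)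
                          ++ (choices (kinds l) κ (kinds r) ʳ++ blocks (κ ∷ kinds l) (kinds r)) else blocks
                            (κ ∷ kinds l) (kinds r))
          block true  = cong₂ (λ j cs → replicate j (typeBit κ) ++ (cs ʳ++ blocks (κ ∷ kinds l) (kinds r)))
            lengths
                          (map-table (kinds l) (uncurry (choiceBit κ)) (options κ (kinds r)))
          block false = refl

      -- The addresses below `2 ^ suc (length K)` are left to shorter histories, and each further
      -- level at most doubles the total.
      length-blocks : ∀ K κs → length (blocks K κs) + 2 ^ suc (length K) ≤ 2 ^ (suc (length K) + length κs)
      length-blocks K []       = ≤-reflexive (cong (2 ^_) (sym (+-identityʳ (suc (length K)))))
      length-blocks K (κ ∷ κs) = ≤-trans (bound (emits κ))
        (subst (λ j → length (blocks (κ ∷ K) κs) + 2 ^ suc (suc (length K)) ≤ 2 ^ j)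
          (sym (+-suc (suc (length K)) (length κs))) (length-blocks (κ ∷ K) κs))
        where
        open ≤-Reasoning
        n = length (blocks (κ ∷ K) κs)
        types = replicate (2 ^ length K) (typeBit κ)
        bound : ∀ e → length (if e then types
          ++ (choices K κ κs ʳ++ blocks (κ ∷ K) κs) else blocks (κ ∷ K) κs) + 2 ^ suc (length K)
                      ≤ n + 2 ^ suc (suc (length K))
        bound false = +-monoʳ-≤ n (^-monoʳ-≤ 2 (n≤1+n (suc (length K))))
        bound true  = ≤-reflexive (begin-equality
          length (types ++ (choices K κ κs ʳ++ blocks (κ ∷ K) κs)) + 2 ^ suc (length K)
            ≡⟨ cong (_+ 2 ^ suc (length K))
              (trans (List.length-++ types) (cong₂ _+_ (List.length-replicate (2 ^ length K))
                 (trans (List.length-ʳ++ (choices K κ κs)) (cong (_+ n) (length-table K _))))) ⟩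
          2 ^ length K + (2 ^ length K + n) + 2 ^ suc (length K)
            ≡⟨ cong (_+ 2 ^ suc (length K)) (trans (sym (+-assoc (2 ^ length K) _ n)) (+-comm _ n)) ⟩
          n + (2 ^ length K + 2 ^ length K) + 2 ^ suc (length K)
            ≡⟨ +-assoc n _ _ ⟩
          n + (2 ^ length K + 2 ^ length K + 2 ^ suc (length K))
            ≡⟨ cong (n +_) (cong₂ _+_ (cong (2 ^ length K +_) (sym (+-identityʳ _))) (sym (+-identityʳ _))) ⟩
          n + 2 ^ suc (suc (length K)) ∎)

    module _ (L : ℕ) (κs : List Kind) (input : List Cell → List Bool)
             (faithful : ∀ s → Faithful (input (play κs s [])) (play κs s [])) where

      leafOf : List Cell → Value
      leafOf h = just (majority (input h) (replicate L toss))

      evaluate-run : ∀ σ → ∃[ τ ] (out τ ≡ stack (map bit (Advice.advice leafOf κs ʳ++ [])) × Exec evaluate-game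
        (vec (record (ready σ) { wt = resting (play (replicate L toss) [] []) ; ct = resting (play κs [] [])
                               ; bal = blankTape ; tab = blankTape ; tmp = blankTape ; stk = blankTape
                                 ; out = blankTape }))
        (vec τ) (evaluateCost L (length κs)))
      evaluate-run σ = record σ₁ { ct = resting h₀ ; stk = blankTape
        ; out = stack (map bit (Advice.advice leafOf κs ʳ++ []))
          ; tab = stack (map valueSym (proj₁ end)) } , refl ,
        (On.odometer-run {A = List Value} ct# place (λ _ _ → refl) (λ _ _ _ → refl) (λ h vs → leafOf h ∷ vs) κs
          (λ s vs → takes (cong (leafCost L) (trans (length-play κs s []) (+-identityʳ _)))
             (leaf-run (record σ { tmp = blankTape ; stk = blankTape ; out = blankTape }) L
               (input (play κs s [])) (play κs s []) (map valueSym vs) (faithful s)))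
          []
        ⨟⇓ takes (cong (λ j → sweepCost (foldCost j) 1 j) (trans (length-play κs [] []) (+-identityʳ _)))
             (starts-in (cong (folding leafOf σ₁ (resting h₀)) begin-levels) (fold-run leafOf σ₁ h₀))
        ⨟⇓ weaken (+-monoʳ-≤ 3 (loop-mono 2 short))
             (subst (λ bs → Exec output (folding leafOf σ₁ (resting h₀) end)
                 (vec (record σ₁ { ct = resting h₀ ; stk = blankTape
                   ; out = stack (map bit ((false ∷ false ∷ bs) ʳ++ []))
                     ; tab = stack (map valueSym (proj₁ end)) }))
                 (outputCost (2 + length bs)))
               end-blocks
               (output-run (record σ₁ { ct = resting h₀ ; tab = stack (map valueSym (proj₁ end)) })
                 (proj₂ end))))
        where
        h₀ = play κs [] []
        σ₁ = record (ready σ) { wt = resting (play (replicate L toss) [] []) ; bal = blankTape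
          ; tmp = blankTape ; out = blankTape }
        end = levels leafOf [] (h₀ ʳ++ [])
        place : Tape Mark → List Value → Store
        place t vs = vec (record (ready σ) { wt = resting (play (replicate L toss) [] []) ; ct = t
                               ; bal = blankTape ; tab = stack (map valueSym vs) ; tmp = blankTape
                                 ; stk = blankTape ; out = blankTape })
        kinds-h₀ : kinds h₀ ≡ κs ʳ++ []
        kinds-h₀ = kinds-play κs [] []
        begin-levels : levels leafOf h₀ [] ≡ (foldPlays κs (λ h vs → leafOf h ∷ vs) [] [] , [])
        begin-levels = cong (_, []) (trans (sym (foldPlays-table (kinds h₀) leafOf))
          (cong (λ ks → foldPlays ks (λ h vs → leafOf h ∷ vs) [] [])
            (trans (cong (_ʳ++ []) kinds-h₀) (List.reverse-involutive κs))))
        end-blocks : proj₂ end ≡ Advice.blocks leafOf [] κs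
        end-blocks = cong (Advice.blocks leafOf [])
          (trans (List.map-ʳ++ proj₁ h₀) (trans (cong (_ʳ++ []) kinds-h₀) (List.reverse-involutive κs)))
        short : 2 + length (Advice.blocks leafOf [] κs) ≤ 2 ^ suc (length κs)
        short = ≤-trans (≤-reflexive (+-comm 2 _)) (length-blocks leafOf [] κs)

-- Setting up the tapes

width : ∀ n → ∃[ k ] ((∀ j → j < k → 2 ^ j ≤ n) × n < 2 ^ k)
width zero    = 0 , (λ _ ()) , s≤s z≤n
width (suc n) with width n
... | k , below , above with suc n <? 2 ^ k
...   | yes lt = k , (λ j j<k → m≤n⇒m≤1+n (below j j<k)) , lt
...   | no ¬lt = suc k , below′ ,
  ≤-<-trans above (subst (2 ^ k <_) (cong (2 ^ k +_) (sym (+-identityʳ _))) (m<m+n (2 ^ k) (m^n>0 2 k)))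
  where
  below′ : ∀ j → j < suc k → 2 ^ j ≤ suc n
  below′ j (s≤s j≤k) with m≤n⇒m<n∨m≡n j≤k
  ... | inj₁ j<k  = m≤n⇒m≤1+n (below j j<k)
  ... | inj₂ refl = ≮⇒≥ ¬lt

opaque

  digits : ℕ → ℕ
  digits n = proj₁ (width n)

  digits-below : ∀ n j → j < digits n → 2 ^ j ≤ n
  digits-below n = proj₁ (proj₂ (width n))

  digits-above : ∀ n → n < 2 ^ digits n
  digits-above n = proj₂ (proj₂ (width n))

  power : ℕ → ℕ → ℕ
  power y zero    = 1
  power y (suc e) = power y e * y

  power-zero : ∀ y → power y 0 ≡ 1
  power-zero y = refl

  power-suc : ∀ y e → power y (suc e) ≡ power y e * y
  power-suc y e = refl

value-ones : ∀ j → suc (value (replicate j true)) ≡ 2 ^ j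
value-ones zero    = refl
value-ones (suc j) = trans (sym (*-suc 2 (value (replicate j true)))) (cong (2 *_) (value-ones j))

nth-beyond : ∀ {A : Set} (xs : List A) i → length xs ≤ i → nth xs i ≡ nothing
nth-beyond []       i       le       = refl
nth-beyond (x ∷ xs) (suc i) (s≤s le) = nth-beyond xs i le

ones-at : ∀ n i → i < n → replicate n true at i ≡ just true
ones-at n i lt = trans (at-nth (replicate n true) i) (nth-replicate n true i lt)

ones-beyond : ∀ n i → n ≤ i → replicate n true at i ≡ nothing
ones-beyond n i le = trans (at-nth (replicate n true) i)
  (nth-beyond (replicate n true) i (≤-trans (≤-reflexive (List.length-replicate n)) le))

replicate-shift : ∀ {A : Set} j (c : A) h → replicate j c ++ c ∷ h ≡ c ∷ replicate j c ++ h
replicate-shift zero    c h = refl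
replicate-shift (suc j) c h = cong (c ∷_) (replicate-shift j c h)

module Setup (M : RandomizedTM 1) where

  open Evaluation M public

  unit : Cell
  unit = toss , false

  push : Fin k → Cell → Cmd
  push i c = put i (cellSym c) right

  anything : Reads → Scan → Bool
  anything r _ = not (isNothing (Vec.head r))

  -- The address made of `j` ones is `2 ^ j - 1`, which lies within the string of `n` ones just when
  -- `2 ^ j ≤ n`. So the loop stops at `j = digits n` without any arithmetic on `n`.
  measureDigits : Cmd
  measureDigits = while anything (put addr# (bit true) right ⨟ goRight pos# ⨟ push yy# unit)

  pushUnits : ℕ → Cmd
  pushUnits zero    = skip
  pushUnits (suc j) = push yy# unit ⨟ pushUnits j

  eraseAddress multiply : Cmd
  eraseAddress = while (sees-no isMark pos#) (goLeft addr# ⨟ put addr# blank stay ⨟ goLeft pos#)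
  multiply = drain len# (sweep yy# skip (push tmp# unit)) ⨟ drain tmp# (push len# unit)

  multiplications : ℕ → Cmd
  multiplications zero    = skip
  multiplications (suc e) = multiplications e ⨟ multiply

  layRounds : Fin k → Kind → Kind → Cmd
  layRounds i κ α = drain i (sweep wt# skip (push ct# (κ , false)) ⨟ push ct# (α , false))

  layOut : Cmd
  layOut = put wt# mark right ⨟ put ct# mark right
    ⨟ drain len# (push wt# unit ⨟ push tmp# unit ⨟ push tab# unit)
    ⨟ layRounds tmp# exists query ⨟ push ct# (pivot , false) ⨟ layRounds tab# index answer

  -- `L = power (digits n + B) e` is computed in unary, which is affordable since `L` is
  -- polylogarithmic. `B` and `e` are constants, unrolled into the program. The schedule is then
  -- laid out with all bits 0, ready for the odometers.
  setup : ℕ → ℕ → Cmd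
  setup B e = put pos# mark stay ⨟ put yy# mark right ⨟ measureDigits ⨟ eraseAddress ⨟ pushUnits B
    ⨟ push len# unit ⨟ multiplications e ⨟ layOut

  units : ℕ → List Cell
  units j = replicate j unit

  multiplyCost : ℕ → ℕ → ℕ
  multiplyCost z y = drainCost (sweepCost 1 1 y) z + drainCost 1 (z * y)

  layCost : ℕ → ℕ
  layCost L = drainCost (sweepCost 1 1 L + 1) L

  multiplicationsCost : ℕ → ℕ → ℕ
  multiplicationsCost zero    y = 1
  multiplicationsCost (suc e) y = multiplicationsCost e y + multiplyCost (power y e) y

  layOutCost : ℕ → ℕ
  layOutCost L = 1 + (1 + (drainCost (1 + (1 + 1)) L + (layCost L + (1 + layCost L))))

  setupCost : ℕ → ℕ → ℕ → ℕ
  setupCost k B e = 1 + (1 + (loop 3 k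
    + (loop 3 k + (suc B + (1 + (multiplicationsCost e (k + B) + layOutCost (power (k + B) e)))))))

  times-suc : ∀ j → times j suc 0 ≡ j
  times-suc j = trans (shift j 0) (+-identityʳ j)
    where
    shift : ∀ j m → times j suc m ≡ j + m
    shift zero    m = refl
    shift (suc j) m = trans (shift j (suc m)) (+-suc j m)

  module SetupRuns (n : ℕ) where

    open EvaluationRuns (replicate n true) public

    ones : ℕ → Tape Mark
    ones j = stack (replicate j (bit true))

    contents-ones : ∀ j → contents (ones j) ≡ replicate j true
    contents-ones j = trans (go j []) (List.++-identityʳ _)
      where
      go : ∀ j bs → leadingBits {A = Mark} (replicate j (bit true) ʳ++ (map bit bs ++ blank ∷ []))
        ≡ replicate j true ++ bs
      go zero    []       = refl
      go zero    (b ∷ bs) = cong (b ∷_) (go zero bs)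
      go (suc j) bs       = trans (go j (true ∷ bs)) (replicate-shift j true bs)

    scanning : Tapes → ℕ → Tapes
    scanning σ j = record σ { addr = ones j ; pos = posTape j ; yy = resting (units j) }

    measure-run : ∀ σ d j → j + d ≡ digits n →
                  Exec measureDigits (vec (scanning σ j)) (vec (scanning σ (digits n))) (loop 3 d)
    measure-run σ zero j eq = ends-in (cong (λ i → vec (scanning σ i)) (trans (sym (+-identityʳ j)) eq))
      (finish (cong (not ∘ isNothing) (trans (cong (λ w → replicate n true at value w) (contents-ones j))
        (ones-beyond n (value (replicate j true))
          (≤-pred (subst (n <_) (trans (cong (2 ^_) (sym (trans (sym (+-identityʳ j)) eq)))
            (sym (value-ones j)))
          (digits-above n)))))))
    measure-run σ (suc d) j eq = again
      (cong (not ∘ isNothing) (trans (cong (λ w → replicate n true at value w) (contents-ones j))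
        (ones-at n (value (replicate j true)) (subst (_≤ n) (sym (value-ones j))
          (digits-below n j (subst (j <_) eq (m<m+n j (s≤s z≤n))))))))
      (upd⇓ refl ⨟⇓ upd⇓ (cong (λ p →
        vec (record σ { addr = ones (suc j) ; pos = p ; yy = resting (units j) })) (posTape-right j))
          ⨟⇓ upd⇓ refl)
      (measure-run σ d (suc j) (trans (sym (+-suc j d)) eq))

    erase-run : ∀ σ j → Exec eraseAddress (vec (record σ { addr = ones j ; pos = posTape j }))
                                          (vec (record σ { addr = blankTape ; pos = posTape 0 })) (loop 3 j)
    erase-run σ zero    = finish refl
    erase-run σ (suc j) = again refl (upd⇓ refl ⨟⇓ upd⇓ refl
      ⨟⇓ upd⇓ (cong (λ p → vec (record σ { addr = ones j ; pos = p })) (back′ j))) (erase-run σ j)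
      where
      back′ : ∀ j → moveᵗ left (posTape (suc j)) ≡ posTape j
      back′ zero    = refl
      back′ (suc j) = refl

    push-units-run : ∀ σ B j → Exec (pushUnits B) (vec (record σ { yy = resting (units j) }))
                                                  (vec (record σ { yy = resting (units (j + B)) })) (suc B)
    push-units-run σ zero    j = ends-in
      (cong (λ i → vec (record σ { yy = resting (units i) })) (sym (+-identityʳ j))) skip⇓
    push-units-run σ (suc B) j = upd⇓ refl
      ⨟⇓ ends-in (cong (λ i → vec (record σ { yy = resting (units i) })) (sym (+-suc j B)))
        (push-units-run σ B (suc j))

    unitStack : ℕ → Tape Mark
    unitStack j = stack (map cellSym (units j))

    multiply-run : ∀ σ z y → Exec multiply
      (vec (record σ { yy = resting (units y) ; len = unitStack z ; tmp = blankTape }))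
                                           (vec (record σ { yy = resting (units y) ; len = unitStack (z * y)
                                             ; tmp = blankTape })) (multiplyCost z y)
    multiply-run σ z y =
      ends-in (cong (λ j → vec (record σ { yy = resting (units y) ; len = blankTape ; tmp = unitStack j }))
        (trans (times-+ z 0) (+-identityʳ _)))
        (On.drain-replicate {A = ℕ} len#
          (λ t m → vec (record σ { yy = resting (units y) ; len = t ; tmp = unitStack m }))
          (λ _ _ → refl) (λ _ _ _ → refl) cellSym (λ _ → refl) (y +_)
          (λ c cs m → add (record σ { len = top (map cellSym (c ∷ cs)) }) m) unit z 0)
      ⨟⇓ ends-in (cong (λ j → vec (record σ
        { yy = resting (units y) ; len = unitStack j ; tmp = blankTape })) (times-suc (z * y)))
        (On.drain-replicate {A = ℕ} tmp#
          (λ t m → vec (record σ { yy = resting (units y) ; len = unitStack m ; tmp = t }))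
          (λ _ _ → refl) (λ _ _ _ → refl) cellSym (λ _ → refl) suc (λ _ _ _ → upd⇓ refl) unit (z * y) 0)
      where
      times-+ : ∀ j m → times j (y +_) m ≡ j * y + m
      times-+ zero    m = refl
      times-+ (suc j) m = trans (times-+ j (y + m))
        (trans (sym (+-assoc (j * y) y m)) (cong (_+ m) (+-comm (j * y) y)))
      add : ∀ σ m → Exec (sweep yy# skip (push tmp# unit))
                         (vec (record σ { yy = resting (units y) ; tmp = unitStack m }))
                         (vec (record σ { yy = resting (units y) ; tmp = unitStack (y + m) })) (sweepCost 1 1 y)
      add σ m = takes (cong (sweepCost 1 1) (List.length-replicate y))
        (ends-in (cong (λ j → vec (record σ { yy = resting (units y) ; tmp = unitStack (j + m) }))
          (List.length-replicate y))
        (On.sweep-run {A = ℕ} yy# (λ t m → vec (record σ { yy = t ; tmp = unitStack m })) (λ _ _ → refl)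
          (λ _ _ _ → refl)
          {h = units y} (λ _ _ → m) (λ l _ → length l + m) (λ _ _ _ _ → skip⇓) (λ _ _ _ _ → upd⇓ refl)
            (λ _ → refl)))

    multiplications-run : ∀ σ y e →
      Exec (multiplications e) (vec (record σ { yy = resting (units y) ; len = unitStack 1 ; tmp = blankTape }))
                               (vec (record σ { yy = resting (units y) ; len = unitStack (power y e)
                                 ; tmp = blankTape })) (multiplicationsCost e y)
    multiplications-run σ y zero    =
      ends-in (cong (λ z → vec (record σ { yy = resting (units y) ; len = unitStack z ; tmp = blankTape }))
        (sym (power-zero y))) skip⇓
    multiplications-run σ y (suc e) = multiplications-run σ y e
      ⨟⇓ ends-in (cong (λ z → vec (record σ
        { yy = resting (units y) ; len = unitStack z ; tmp = blankTape })) (sym (power-suc y e)))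
          (multiply-run σ (power y e) y)

    module Layout (L : ℕ) where

      roundOf : Kind → Kind → List Cell → List Cell
      roundOf κ α h = (α , false) ∷ replicate L (κ , false) ++ h

      play-replicate-zeros : ∀ j κ h → play (replicate j κ) [] h ≡ replicate j (κ , false) ++ h
      play-replicate-zeros zero    κ h = refl
      play-replicate-zeros (suc j) κ h = trans (play-replicate-zeros j κ _) (replicate-shift j (κ , false) h)

      play-++-zeros : ∀ κs κs′ h → play (κs ++ κs′) [] h ≡ play κs′ [] (play κs [] h)
      play-++-zeros []       κs′ h = refl
      play-++-zeros (κ ∷ κs) κs′ h = play-++-zeros κs κs′ _

      play-rounds : ∀ κ α m κs h → play (Game.rounds L κ α m κs) [] h ≡ play κs [] (times m (roundOf κ α) h)
      play-rounds κ α zero    κs h = refl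
      play-rounds κ α (suc m) κs h = trans (play-++-zeros (replicate L κ) _ h)
        (trans (cong (λ h′ → play (Game.rounds L κ α m κs) [] ((α , false) ∷ h′)) (play-replicate-zeros L κ h))
               (play-rounds κ α m κs (roundOf κ α h)))

      round-run : ∀ σ κ α h → Exec (sweep wt# skip (push ct# (κ , false)) ⨟ push ct# (α , false))
        (vec (record σ { wt = resting (units L) ; ct = resting h }))
        (vec (record σ { wt = resting (units L) ; ct = resting (roundOf κ α h) })) (sweepCost 1 1 L + 1)
      round-run σ κ α h = takes (cong (sweepCost 1 1) (List.length-replicate L))
        (ends-in (cong (λ h′ → vec (record σ { wt = resting (units L) ; ct = resting (h′ ++ h) }))
          (List.map-replicate (λ _ → κ , false) L unit))
        (On.sweep-run {A = List Cell} wt# (λ t h → vec (record σ { wt = t ; ct = resting h }))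
          (λ _ _ → refl) (λ _ _ _ → refl)
          {h = units L} (λ _ _ → h) (λ l _ → map (λ _ → κ , false) l ++ h) (λ _ _ _ _ → skip⇓)
            (λ _ _ _ _ → upd⇓ refl) (λ _ → refl)))
        ⨟⇓ upd⇓ refl

      layOut-run : ∀ σ → Exec layOut
        (vec (record σ { wt = blankTape ; ct = blankTape ; len = unitStack L ; tmp = blankTape
          ; tab = blankTape }))
        (vec (record σ { wt = resting (play (replicate L toss) [] [])
          ; ct = resting (play (Game.schedule L) [] [])
                       ; len = blankTape ; tmp = blankTape ; tab = blankTape })) (layOutCost L)
      layOut-run σ = upd⇓ refl ⨟⇓ upd⇓ refl
        ⨟⇓ ends-in (cong (copied blankTape) (times-suc L))
          (On.drain-replicate {A = ℕ} len# copied (λ _ _ → refl) (λ _ _ _ → refl) cellSym (λ _ → refl) suc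
               (λ _ _ _ → upd⇓ refl ⨟⇓ upd⇓ refl ⨟⇓ upd⇓ refl) unit L 0)
        ⨟⇓ On.drain-replicate {A = List Cell} tmp#
          (λ t h → vec (record σ { wt = resting (units L) ; ct = resting h ; len = blankTape ; tmp = t
            ; tab = unitStack L }))
               (λ _ _ → refl) (λ _ _ _ → refl) cellSym (λ _ → refl) (roundOf exists query)
               (λ c cs h → round-run (record σ
                 { len = blankTape ; tmp = top (map cellSym (c ∷ cs)) ; tab = unitStack L }) exists query h)
                   unit L []
        ⨟⇓ upd⇓ refl
        ⨟⇓ ends-in (cong₂ (λ h h′ → vec (record σ
          { wt = resting h ; ct = resting h′ ; len = blankTape ; tmp = blankTape ; tab = blankTape }))
            tosses laid)
             (On.drain-replicate {A = List Cell} tab# (λ t h → vec (record σ₁ { ct = resting h ; tab = t }))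
               (λ _ _ → refl) (λ _ _ _ → refl) cellSym (λ _ → refl) (roundOf index answer)
               (λ c cs h → round-run (record σ₁ { tab = top (map cellSym (c ∷ cs)) }) index answer h) unit L h₁)
        where
        copied : Tape Mark → ℕ → Store
        copied t m = vec (record σ { wt = resting (units m) ; ct = resting [] ; len = t ; tmp = unitStack m
          ; tab = unitStack m })
        σ₁ = record σ { wt = resting (units L) ; len = blankTape ; tmp = blankTape }
        h₁ = (pivot , false) ∷ times L (roundOf exists query) []
        tosses : units L ≡ play (replicate L toss) [] []
        tosses = sym (trans (play-replicate-zeros L toss []) (List.++-identityʳ _))
        laid : times L (roundOf index answer) h₁ ≡ play (Game.schedule L) [] []
        laid = sym (trans (play-rounds exists query L (pivot ∷ Game.universal L L) [])
          (play-rounds index answer L [] h₁))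

    setup-run : ∀ B e → let L = power (digits n + B) e in ∃[ σ ] Exec (setup B e)
      (vec (tapes blankTape blankTape blankTape blankTape blankTape blankTape blankTape blankTape blankTape
        blankTape
                  blankTape blankTape blankTape blankTape blankTape (Vec.replicate _ blankTape)))
      (vec (record (ready σ) { wt = resting (play (replicate L toss) [] [])
        ; ct = resting (play (Game.schedule L) [] [])
                             ; bal = blankTape ; tab = blankTape ; tmp = blankTape ; stk = blankTape
                               ; out = blankTape }))
      (setupCost (digits n) B e)
    setup-run B e = record blanks { yy = resting (units y) } ,
      (upd⇓ refl ⨟⇓ upd⇓ refl ⨟⇓ measure-run blanks (digits n) 0 refl
       ⨟⇓ erase-run (record blanks { yy = resting (units (digits n)) }) (digits n)
       ⨟⇓ push-units-run (record blanks { pos = posTape 0 }) B (digits n)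
       ⨟⇓ upd⇓ refl
       ⨟⇓ multiplications-run (record blanks { pos = posTape 0 }) y e
       ⨟⇓ Layout.layOut-run (power y e) (record blanks { pos = posTape 0 ; yy = resting (units y) }))
      where
      y = digits n + B
      blanks = tapes blankTape blankTape blankTape blankTape blankTape blankTape blankTape blankTape
        blankTape blankTape
                     blankTape blankTape blankTape blankTape blankTape (Vec.replicate (suc M.work) blankTape)

-- Random coin tosses

module Coins (M : RandomizedTM 1) where

  open Setup M public

  runFrom : ∀ {t} → List Bool → M.Config → Vec Bool t → M.Config
  runFrom x c ω = Vec.foldl′ (M.step (x ∷ [])) c ω

  accepted : M.Config → Bool
  accepted c = does (M.verdict c ≟ᵛ just true)

  acceptCount rejectCount : List Bool → ℕ → M.Config → ℕ
  acceptCount x t c = count (λ ω → accepted (runFrom x c ω)) (coinTosses t)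
  rejectCount x t c = count (λ ω → not (accepted (runFrom x c ω))) (coinTosses t)

  count-++ : ∀ {A : Set} (p : A → Bool) xs ys → count p (xs ++ ys) ≡ count p xs + count p ys
  count-++ p []       ys = refl
  count-++ p (x ∷ xs) ys = trans (cong (indicator (p x) +_) (count-++ p xs ys))
    (sym (+-assoc (indicator (p x)) _ _))

  count-coinTosses : ∀ t (p : Vec Bool (suc t) → Bool) →
    count p (coinTosses (suc t)) ≡ count (p ∘ (true ∷_)) (coinTosses t) + count (p ∘ (false ∷_)) (coinTosses t)
  count-coinTosses t p = trans (count-++ p (map (true ∷_) (coinTosses t)) _)
    (cong₂ _+_ (count-map p (true ∷_) (coinTosses t))
      (trans (count-++ p (map (false ∷_) (coinTosses t)) [])
        (trans (+-identityʳ _) (count-map p (false ∷_) (coinTosses t)))))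

  length-coinTosses : ∀ t → length (coinTosses t) ≡ 2 ^ t
  length-coinTosses zero    = refl
  length-coinTosses (suc t) = trans (List.length-++ (map (true ∷_) (coinTosses t)))
    (cong₂ _+_ (trans (List.length-map _ (coinTosses t)) (length-coinTosses t))
      (trans (List.length-++ (map (false ∷_) (coinTosses t)))
        (cong (_+ 0) (trans (List.length-map _ (coinTosses t)) (length-coinTosses t)))))

  count-not : ∀ {A : Set} (p : A → Bool) xs → count p xs + count (not ∘ p) xs ≡ length xs
  count-not p []       = refl
  count-not p (x ∷ xs) with p x
  ... | true  = cong suc (count-not p xs)
  ... | false = trans (+-suc _ _) (cong suc (count-not p xs))

  -- The odometer meets the coin strings in another order than `coinTosses` lists them, which the
  -- counts do not notice.
  votes-count : ∀ x t h a r → votes x (replicate t toss) h (a , r)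
                ≡ (acceptCount x t (afterCoins x h) + a , rejectCount x t (afterCoins x h) + r)
  votes-count x zero    h a r with accepts x h
  ... | true  = refl
  ... | false = refl
  votes-count x (suc t) h a r
    rewrite count-coinTosses t (λ ω → accepted (runFrom x (afterCoins x h) ω))
          | count-coinTosses t (λ ω → not (accepted (runFrom x (afterCoins x h) ω)))
          | votes-count x t ((toss , false) ∷ h) a r
          | votes-count x t ((toss , true) ∷ h) (acceptCount x t (afterCoins x ((toss , false) ∷ h)) + a)
                                                (rejectCount x t (afterCoins x ((toss , false) ∷ h)) + r) =
    cong₂ _,_ (sym (+-assoc (acceptCount x t (afterCoins x ((toss , true) ∷ h))) _ a))
              (sym (+-assoc (rejectCount x t (afterCoins x ((toss , true) ∷ h))) _ r))

  Halted : M.Config → Set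
  Halted c = ∃[ b ] M.halting (M.state c) ≡ just b

  step-fixed : ∀ x c b → Halted c → M.step (x ∷ []) c b ≡ c
  step-fixed x (M.config q ts) b (_ , eq) = step-halted {x ∷ []} b ts eq

  counts-halted : (φ : Bool → Bool) → ∀ x r c → Halted c →
    count (λ ω → φ (accepted (runFrom x c ω))) (coinTosses r) ≡ 2 ^ r * indicator (φ (accepted c))
  counts-halted φ x zero    c h = refl
  counts-halted φ x (suc r) c h = trans (count-coinTosses r _)
    (trans (cong₂ _+_ (half true) (half false))
      (trans (sym (*-distribʳ-+ (indicator (φ (accepted c))) (2 ^ r) (2 ^ r)))
      (cong (λ z → (2 ^ r + z) * indicator (φ (accepted c))) (sym (+-identityʳ _)))))
    where
    half : ∀ b → count (λ ω → φ (accepted (runFrom x (M.step (x ∷ []) c b) ω))) (coinTosses r)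
      ≡ 2 ^ r * indicator (φ (accepted c))
    half b = trans (cong (λ c → count (λ ω → φ (accepted (runFrom x c ω))) (coinTosses r))
      (step-fixed x c b h)) (counts-halted φ x r c h)

  -- Once halted, the machine ignores its coins, so `r` more of them multiply every count by
  -- `2 ^ r`. Majorities stay the same, and an upper bound on the running time can stand in for the
  -- running time.
  counts-extended : (φ : Bool → Bool) → ∀ x t r c → (∀ (ω : Vec Bool t) → Halted (runFrom x c ω)) →
    count (λ ω → φ (accepted (runFrom x c ω))) (coinTosses (t + r))
      ≡ 2 ^ r * count (λ ω → φ (accepted (runFrom x c ω))) (coinTosses t)
  counts-extended φ x zero    r c h =
    trans (counts-halted φ x r c (h [])) (cong (2 ^ r *_) (sym (+-identityʳ _)))
  counts-extended φ x (suc t) r c h = trans (count-coinTosses (t + r) _)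
    (trans (cong₂ _+_ (counts-extended φ x t r _ (h ∘ (true ∷_))) (counts-extended φ x t r _ (h ∘ (false ∷_))))
    (trans (sym (*-distribˡ-+ (2 ^ r)
      (count (λ ω → φ (accepted (runFrom x (M.step (x ∷ []) c true) ω))) (coinTosses t)) _))
           (cong (2 ^ r *_) (sym (count-coinTosses t (λ ω → φ (accepted (runFrom x c ω))))))))

  firstBit-net : ∀ a r → (r < a → firstBit (net a r) ≡ true) × (a < r → firstBit (net a r) ≡ false)
  firstBit-net zero    zero    = (λ ()) , (λ ())
  firstBit-net zero    (suc r) = (λ ()) , (λ _ → refl)
  firstBit-net (suc a) zero    = (λ _ → refl) , (λ ())
  firstBit-net (suc a) (suc r) = (λ lt → proj₁ (firstBit-net a r) (≤-pred lt)) ,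
    (λ lt → proj₂ (firstBit-net a r) (≤-pred lt))

  -- From `2 * (a + r) ≤ 3 * a` follows `2 * r ≤ a`. If also `a ≤ r`, both vanish, but their sum is
  -- a power of 2.
  twice-less : ∀ a r t → a + r ≡ 2 ^ t → 2 * 2 ^ t ≤ 3 * a → r < a
  twice-less a r t eq le with r <? a
  ... | yes lt = lt
  ... | no ¬lt = contradiction (m^n>0 2 t)
    (subst (λ z → ¬ (0 < z)) eq (λ pos → contradiction pos (<-irrefl (sym (cong₂ _+_ a≡0 r≡0)))))
    where
    a≤r = ≮⇒≥ ¬lt
    2r≤a : 2 * r ≤ a
    2r≤a = +-cancelˡ-≤ (2 * a) (2 * r) a (begin
      2 * a + 2 * r    ≡⟨ *-distribˡ-+ 2 a r ⟨
      2 * (a + r)      ≡⟨ cong (2 *_) eq ⟩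
      2 * 2 ^ t        ≤⟨ le ⟩
      3 * a            ≡⟨ +-comm a (2 * a) ⟩
      2 * a + a        ∎)
      where open ≤-Reasoning
    r≡0 : r ≡ 0
    r≡0 = n≤0⇒n≡0 (+-cancelˡ-≤ r r 0 (≤-trans (≤-reflexive (cong (r +_) (sym (+-identityʳ r))))
      (≤-trans 2r≤a (≤-trans a≤r (≤-reflexive (sym (+-identityʳ r)))))))
    a≡0 : a ≡ 0
    a≡0 = n≤0⇒n≡0 (≤-trans a≤r (≤-reflexive r≡0))

  length-filter : ∀ {A : Set} {P : A → Set} (P? : ∀ x → Dec (P x)) xs → length (filter P? xs)
    ≡ count (does ∘ P?) xs
  length-filter P? []       = refl
  length-filter P? (x ∷ xs) with P? x
  ... | yes _ = cong suc (length-filter P? xs)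
  ... | no _  = length-filter P? xs

  module Decided {ℓ : Level} {T : ℕ → ℕ} {L : Language ℓ} (D : DecidesRandomized M T L) where

    open DecidesRandomized D renaming (accepts to accepts-inside; rejects to rejects-outside)

    record Answer (x : List Bool) (N : ℕ) : Set ℓ where
      field
        value-≡  : Bool
        majority-≡ : majority x (replicate N toss) ≡ value-≡
        likely   : 2 * 2 ^ T (length x)
          ≤ 3 * count (λ ω → does (accepted (runFrom x M.initial ω) Bool.≟ value-≡)) (coinTosses (T (length x)))
        inside   : L x → value-≡ ≡ true
        outside  : ¬ L x → value-≡ ≡ false

    module Tallies (x : List Bool) (N : ℕ) (le : T (length x) ≤ N) where

      t = T (length x)
      A = acceptCount x t M.initial
      R = rejectCount x t M.initial

      total : A + R ≡ 2 ^ t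
      total = trans (count-not (λ ω → accepted (runFrom x M.initial ω)) (coinTosses t)) (length-coinTosses t)

      settles : ∀ (ω : Vec Bool t) → Halted (runFrom x M.initial ω)
      settles ω = is-just (M.verdict (runFrom x M.initial ω)) (halts x ω)
        where
        is-just : ∀ (v : Maybe Bool) → Is-just v → ∃[ b ] v ≡ just b
        is-just (just b) _ = b , refl

      extended : (φ : Bool → Bool) → count (λ ω → φ (accepted (runFrom x M.initial ω))) (coinTosses N)
                                     ≡ 2 ^ (N ∸ t) * count (λ ω → φ (accepted (runFrom x M.initial ω)))
                                       (coinTosses t)
      extended φ = trans (cong (λ j → count (λ ω → φ (accepted (runFrom x M.initial ω))) (coinTosses j))
        (sym (m+[n∸m]≡n le)))
        (counts-extended φ x t (N ∸ t) M.initial settles)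

      leading : majority x (replicate N toss) ≡ firstBit (net (2 ^ (N ∸ t) * A) (2 ^ (N ∸ t) * R))
      leading = trans (cong (firstBit ∘ uncurry net) (votes-count x N [] 0 0))
        (cong₂ (λ a r → firstBit (net a r)) (trans (+-identityʳ _) (extended id))
          (trans (+-identityʳ _) (extended not)))

      scaled : ∀ {i j} → i < j → 2 ^ (N ∸ t) * i < 2 ^ (N ∸ t) * j
      scaled = *-monoʳ-< (2 ^ (N ∸ t)) {{m^n≢0 2 (N ∸ t)}}

      says-false : Vec Bool t → Bool
      says-false ω = does (result x ω ≟ᵛ just false)

      often-false : Answers false x → 2 * 2 ^ t ≤ 3 * count says-false (coinTosses t)
      often-false = subst₂ (λ i j → 2 * i ≤ 3 * j) (length-coinTosses t) (length-filter _ (coinTosses t))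

      false-rejects : ∀ ω → says-false ω ≡ true → not (accepted (runFrom x M.initial ω)) ≡ true
      false-rejects ω eq with M.verdict (runFrom x M.initial ω)
      ... | just false = refl

      false-agrees : ∀ ω → says-false ω ≡ true → does (accepted (runFrom x M.initial ω) Bool.≟ false) ≡ true
      false-agrees ω eq with M.verdict (runFrom x M.initial ω)
      ... | just false = refl

      A<R : Answers false x → A < R
      A<R ans = twice-less R A t (trans (+-comm R A) total)
        (≤-trans (often-false ans) (*-monoʳ-≤ 3 (count-≤ false-rejects (coinTosses t))))

    -- Membership in `L` is not given as decidable, so the distinction is whether acceptance is
    -- likely. If it is not, `x` lies outside `L` by `accepts-inside`, and then rejection is likely.
    answer-of : ∀ x N → T (length x) ≤ N → Answer x N
    answer-of x N le with 2 * length (coinTosses (T (length x))) ≤?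
                          3 * length (filter (λ ω → result x ω ≟ᵛ just true) (coinTosses (T (length x))))
    ... | yes often = record
      { value-≡    = true
      ; majority-≡ = trans leading (proj₁ (firstBit-net _ _) (scaled R<A))
      ; likely     = ≤-trans often′ (*-monoʳ-≤ 3
        (count-≤ (λ ω eq → trans (cong (λ b → does (b Bool.≟ true)) eq) refl) (coinTosses t)))
      ; inside     = λ _ → refl
      ; outside    = λ x∉L → contradiction R<A (<⇒≯ (A<R (rejects-outside x x∉L)))
      }
      where
      open Tallies x N le
      often′ = subst₂ (λ i j → 2 * i ≤ 3 * j) (length-coinTosses t) (length-filter _ (coinTosses t)) often
      R<A = twice-less A R t total often′
    ... | no rare = record
      { value-≡    = false
      ; majority-≡ = trans leading (proj₂ (firstBit-net _ _) (scaled (A<R rejected)))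
      ; likely     = ≤-trans (often-false rejected) (*-monoʳ-≤ 3 (count-≤ false-agrees (coinTosses t)))
      ; inside     = λ x∈L → contradiction (accepts-inside x x∈L) rare
      ; outside    = λ _ → refl
      }
      where
      open Tallies x N le
      rejected = rejects-outside x (λ x∈L → rare (accepts-inside x x∈L))

-- The decision tree of a randomized machine

module Derandomization (M : RandomizedTM 1) where

  open Coins M public

  -- An address beyond the end reads `nothing` on every input of length `n` and thus counts as no
  -- query.
  inRange : ∀ n → ℕ → List (Fin n)
  inRange n i with i <? n
  ... | yes lt = fromℕ< lt ∷ []
  ... | no _   = []

  length-inRange : ∀ n i → length (inRange n i) ≤ 1
  length-inRange n i with i <? n
  ... | yes lt = ≤-refl
  ... | no _   = z≤n

  at-lookup : ∀ {n} (x : Vec Bool n) i (lt : i < n) → Vec.toList x at i ≡ just (Vec.lookup x (fromℕ< lt))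
  at-lookup (b ∷ x) zero    (s≤s lt) = refl
  at-lookup (b ∷ x) (suc i) (s≤s lt) = at-lookup x i lt

  at-beyond : ∀ {n} (x : Vec Bool n) i → n ≤ i → Vec.toList x at i ≡ nothing
  at-beyond x i le = trans (at-nth (Vec.toList x) i)
    (nth-beyond (Vec.toList x) i (≤-trans (≤-reflexive (Vec.length-toList x)) le))

  at-agree : ∀ {n} (x y : Vec Bool n) i → Agree (inRange n i) x y → Vec.toList x at i ≡ Vec.toList y at i
  at-agree {n} x y i agree with i <? n
  at-agree x y i (eq ∷ []) | yes lt = trans (at-lookup x i lt) (trans (cong just eq) (sym (at-lookup y i lt)))
  at-agree x y i []        | no ge  = trans (at-beyond x i (≮⇒≥ ge)) (sym (at-beyond y i (≮⇒≥ ge)))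

  addressOf : M.Config → ℕ
  addressOf c = value (contents (Vec.head (M.tapeOf c)))

  step-agree : ∀ {x y} c b → x at addressOf c ≡ y at addressOf c → M.step (x ∷ []) c b ≡ M.step (y ∷ []) c b
  step-agree {x} {y} (M.config q (t ∷ ts)) b eq = go (M.halting q) refl
    where
    go : ∀ v → M.halting q ≡ v → M.step (x ∷ []) (M.config q (t ∷ ts)) b
      ≡ M.step (y ∷ []) (M.config q (t ∷ ts)) b
    go (just v) h = trans (step-halted {x ∷ []} b (t ∷ ts) h) (sym (step-halted {y ∷ []} b (t ∷ ts) h))
    go nothing  h = trans (step-running {x ∷ []} b (t ∷ ts) h)
      (trans (cong (λ a → advanceConfig (M.δ q b (a ∷ []) (Vec.map scanned (t ∷ ts))) (t ∷ ts)) eq)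
             (sym (step-running {y ∷ []} b (t ∷ ts) h)))

  queries : ∀ {n t} → Vec Bool n → M.Config → Vec Bool t → List (Fin n)
  queries x c []      = []
  queries x c (b ∷ ω) = inRange _ (addressOf c) ++ queries x (M.step (Vec.toList x ∷ []) c b) ω

  length-queries : ∀ {n t} (x : Vec Bool n) c (ω : Vec Bool t) → length (queries x c ω) ≤ t
  length-queries x c []      = z≤n
  length-queries {n} x c (b ∷ ω) = ≤-trans (≤-reflexive (List.length-++ (inRange n (addressOf c))))
    (+-mono-≤ (length-inRange n (addressOf c)) (length-queries x (M.step (Vec.toList x ∷ []) c b) ω))

  runs-agree : ∀ {n t} (x y : Vec Bool n) c (ω : Vec Bool t) → Agree (queries x c ω) x y →
               runFrom (Vec.toList x) c ω ≡ runFrom (Vec.toList y) c ω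
  runs-agree x y c []      agree = refl
  runs-agree {n} x y c (b ∷ ω) agree = trans
    (runs-agree x y (M.step (Vec.toList x ∷ []) c b) ω (All.++⁻ʳ (inRange n (addressOf c)) agree))
    (cong (λ c′ → runFrom (Vec.toList y) c′ ω)
      (step-agree c b (at-agree x y (addressOf c) (All.++⁻ˡ (inRange n (addressOf c)) agree))))

  module Decision {ℓ : Level} {T : ℕ → ℕ} {L : Language ℓ} (D : DecidesRandomized M T L) (n N : ℕ)
                  (enough : T n ≤ N) where

    open Decided D

    -- The function f of the game is the majority vote over all tosses, since this is what
    -- preprocessing can compute; `Answer` ties it to `L`.
    majorityOf : Vec Bool n → Bool
    majorityOf x = majority (Vec.toList x) (replicate N toss)

    likely-at : ∀ x → length x ≡ n → 2 * length (coinTosses (T n)) ≤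
      3 * count (λ ω → does (accepted (runFrom x M.initial ω) Bool.≟ majority x (replicate N toss)))
        (coinTosses (T n))
    likely-at x refl = subst₂ (λ i b → 2 * i
      ≤ 3 * count (λ ω → does (accepted (runFrom x M.initial ω) Bool.≟ b)) (coinTosses (T n)))
      (sym (length-coinTosses (T n))) (sym majority-≡) likely
      where open Answer (answer-of x N enough)

    open Sensitivity {d = T n} (coinTosses (T n)) (subst (1 ≤_) (sym (length-coinTosses (T n))) (m^n>0 2 (T n)))
      majorityOf (λ x ω → accepted (runFrom (Vec.toList x) M.initial ω)) (λ x ω → queries x M.initial ω)
      (λ x ω → length-queries x M.initial ω) (λ x y ω agree → cong accepted (runs-agree x y M.initial ω agree))
      (λ x → likely-at (Vec.toList x) (Vec.length-toList x)) using (decision-tree; C) public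

    module Advised (n≤2^N : n ≤ 2 ^ N) (deep : suc C * C ≤ N) where

      tree : Tree n N
      tree = deepen deep (proj₁ decision-tree)

      tree-correct : ∀ x → evaluate tree x ≡ majorityOf x
      tree-correct x = trans (evaluate-deepen deep (proj₁ decision-tree) x) (proj₂ decision-tree x)

      input : List Cell → List Bool
      input h = Vec.toList (Game.virtual N n≤2^N majorityOf tree tree-correct h)

      advice : List Bool
      advice = Advice.advice (Game.leafValue N n≤2^N majorityOf tree tree-correct) (Game.schedule N)

      reply-respond : ∀ es w b → All (λ e → length (proj₁ e) ≡ N) es → value w < 2 ^ N →
                      reply es w b ≡ respond es (value w) b
      reply-respond []             w b []       lt = refl
      reply-respond ((u , c) ∷ es) w b (p ∷ ps) lt = trans (reply-respond es w _ ps lt)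
        (cong (λ z → respond es (value w) (if z then c else b))
          (matches-value u w (subst (λ j → value w < 2 ^ j) (sym p) lt)))

      open SetupRuns n

      -- An address within the input is below `2 ^ N`, where bitwise matching against indices of
      -- length `N` amounts to equality of numbers. Beyond the input both sides are `nothing`.
      faithful : ∀ s → Faithful (input (play (Game.schedule N) s [])) (play (Game.schedule N) s [])
      faithful s w = by-range (value w <? n)
        where
        h = play (Game.schedule N) s []
        v = Game.virtual N n≤2^N majorityOf tree tree-correct h
        i = value w
        by-range : Dec (i < n) → Vec.toList v at i
          ≡ answered (replicate n true at i) (reply (entries h) w false)
        by-range (yes lt) = begin
          Vec.toList v at i                                        ≡⟨ at-lookup v i lt ⟩
          just (Vec.lookup v (fromℕ< lt))                          ≡⟨
            cong just (Vec.lookup∘tabulate _ (fromℕ< lt)) ⟩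
          just (respond (entries h) (toℕ (fromℕ< lt)) false)       ≡⟨
            cong (λ j → just (respond (entries h) j false)) (Fin.toℕ-fromℕ< lt) ⟩
          just (respond (entries h) i false)                       ≡⟨
            cong just (reply-respond (entries h) w false (proj₁ (Game.Sized-schedule N s))
              (<-≤-trans lt n≤2^N)) ⟨
          just (reply (entries h) w false)                         ≡⟨
            cong (λ a → answered a (reply (entries h) w false)) (ones-at n i lt) ⟨
          answered (replicate n true at i) (reply (entries h) w false) ∎
          where open ≡-Reasoning
        by-range (no ge) = trans (at-beyond v i (≮⇒≥ ge))
          (cong (λ a → answered a (reply (entries h) w false)) (sym (ones-beyond n i (≮⇒≥ ge))))

-- Growth rates

private
  variable
    f g : ℕ → ℕ

n≤2^n : ∀ n → n ≤ 2 ^ n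
n≤2^n zero    = z≤n
n≤2^n (suc n) = ≤-trans (+-mono-≤ (m^n>0 2 n) (n≤2^n n)) (≤-reflexive (cong (2 ^ n +_) (sym (+-identityʳ _))))

2≤log : ∀ n → 4 ≤ n → 2 ≤ ⌊log₂ n ⌋
2≤log n le = ≤-trans (≤-reflexive (sym (⌊log₂[2^n]⌋≡n 2))) (⌊log₂⌋-mono-≤ le)

Polylog-≤ : (∀ n → f n ≤ g n) → Polylog g → Polylog f
Polylog-≤ f≤g (c , n₀ , h) = c , n₀ , λ n le → ≤-trans (f≤g n) (h n le)

Polylog-const : ∀ K → Polylog (λ _ → K)
-- The exponent `K` works because `K ≤ 2 ^ K` and the logarithm is at least 2 from 4 on.
Polylog-const K = K , 4 , λ n le → ≤-trans (n≤2^n K) (^-monoˡ-≤ K (2≤log n le))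

Polylog-+ : Polylog f → Polylog g → Polylog (λ n → f n + g n)
-- The extra factor in the exponent absorbs the 2 that the sum of two powers brings; the 4 makes the
-- logarithm at least 2.
Polylog-+ {f} {g} (a , n₀ , p) (b , n₁ , q) = suc (a + b) , 4 + (n₀ + n₁) , λ n le →
  let l    = ⌊log₂ n ⌋
      two  = 2≤log n (≤-trans (m≤m+n 4 _) le)
      n₀≤n = ≤-trans (≤-trans (m≤m+n n₀ n₁) (m≤n+m _ 4)) le
      n₁≤n = ≤-trans (≤-trans (m≤n+m n₁ n₀) (m≤n+m _ 4)) le
      instance l≢0 = >-nonZero (≤-trans (s≤s z≤n) two)
  in begin
    f n + g n                          ≤⟨ +-mono-≤ (p n n₀≤n) (q n n₁≤n) ⟩
    l ^ a + l ^ b                      ≤⟨ +-mono-≤ (^-monoʳ-≤ l (m≤m+n a b)) (^-monoʳ-≤ l (m≤n+m b a)) ⟩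
    l ^ (a + b) + l ^ (a + b)          ≡⟨ cong (l ^ (a + b) +_) (+-identityʳ _) ⟨
    2 * l ^ (a + b)                    ≤⟨ *-monoˡ-≤ (l ^ (a + b)) two ⟩
    l ^ suc (a + b)                    ∎
  where open ≤-Reasoning

Polylog-* : Polylog f → Polylog g → Polylog (λ n → f n * g n)
Polylog-* {f} {g} (a , n₀ , p) (b , n₁ , q) = a + b , n₀ + n₁ , λ n le → ≤-trans
  (*-mono-≤ (p n (≤-trans (m≤m+n n₀ n₁) le)) (q n (≤-trans (m≤n+m n₁ n₀) le)))
  (≤-reflexive (sym (^-distribˡ-+-* ⌊log₂ n ⌋ a b)))

Polylog-loop : Polylog f → Polylog g → Polylog (λ n → loop (f n) (g n))
Polylog-loop {f} {g} p q = Polylog-≤ (λ n → ≤-reflexive (loop-≡ (f n) (g n)))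
  (Polylog-+ (Polylog-* q (Polylog-+ (Polylog-const 1) p)) (Polylog-const 1))

Polylog-power : ∀ e → Polylog f → Polylog (λ n → power (f n) e)
Polylog-power {f} zero    p = Polylog-≤ (λ n → ≤-reflexive (power-zero (f n))) (Polylog-const 1)
Polylog-power {f} (suc e) p = Polylog-≤ (λ n → ≤-reflexive (power-suc (f n) e))
  (Polylog-* (Polylog-power e p) p)

Quasipoly-≤ : (∀ n → f n ≤ g n) → Quasipoly g → Quasipoly f
Quasipoly-≤ f≤g (e , p , h) = e , p , λ n → ≤-trans (f≤g n) (h n)

Quasipoly-2^ : Polylog f → Quasipoly (λ n → 2 ^ f n)
Quasipoly-2^ {f} p = f , p , λ n → ≤-refl

Quasipoly-polylog : Polylog f → Quasipoly f
Quasipoly-polylog {f} p = f , p , λ n → n≤2^n (f n)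

Quasipoly-const : ∀ K → Quasipoly (λ _ → K)
Quasipoly-const K = Quasipoly-polylog (Polylog-const K)

Quasipoly-* : Quasipoly f → Quasipoly g → Quasipoly (λ n → f n * g n)
Quasipoly-* (a , p , h) (b , q , i) = (λ n → a n + b n) , Polylog-+ p q , λ n →
  ≤-trans (*-mono-≤ (h n) (i n)) (≤-reflexive (sym (^-distribˡ-+-* 2 (a n) (b n))))

Quasipoly-+ : Quasipoly f → Quasipoly g → Quasipoly (λ n → f n + g n)
Quasipoly-+ {f} {g} (a , p , h) (b , q , i) = (λ n → 1 + (a n + b n)) ,
  Polylog-+ (Polylog-const 1) (Polylog-+ p q) , λ n → begin
  f n + g n                             ≤⟨ +-mono-≤ (h n) (i n) ⟩
  2 ^ a n + 2 ^ b n                     ≤⟨ +-mono-≤ (^-monoʳ-≤ 2 (m≤m+n (a n) (b n)))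
    (^-monoʳ-≤ 2 (m≤n+m (b n) (a n))) ⟩
  2 ^ (a n + b n) + 2 ^ (a n + b n)     ≡⟨ cong (2 ^ (a n + b n) +_) (+-identityʳ _) ⟨
  2 ^ (1 + (a n + b n))                 ∎
  where open ≤-Reasoning

Quasipoly-loop : Quasipoly f → Quasipoly g → Quasipoly (λ n → loop (f n) (g n))
Quasipoly-loop {f} {g} p q = Quasipoly-≤ (λ n → ≤-reflexive (loop-≡ (f n) (g n)))
  (Quasipoly-+ (Quasipoly-* q (Quasipoly-+ (Quasipoly-const 1) p)) (Quasipoly-const 1))

digits-≤ : ∀ n → digits n ≤ suc ⌊log₂ n ⌋
digits-≤ n = go (digits n) (digits-below n)
  where
  go : ∀ k → (∀ j → j < k → 2 ^ j ≤ n) → k ≤ suc ⌊log₂ n ⌋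
  go zero    below = z≤n
  go (suc j) below = s≤s (≤-trans (≤-reflexive (sym (⌊log₂[2^n]⌋≡n j))) (⌊log₂⌋-mono-≤ (below j ≤-refl)))

log-≤-digits : ∀ n → ⌊log₂ n ⌋ ≤ digits n
log-≤-digits n = ≤-trans (⌊log₂⌋-mono-≤ (<⇒≤ (digits-above n))) (≤-reflexive (⌊log₂[2^n]⌋≡n (digits n)))

Polylog-digits : Polylog digits
Polylog-digits = Polylog-≤ digits-≤
  (Polylog-+ (Polylog-const 1) (1 , 0 , λ n _ → ≤-reflexive (sym (^-identityʳ _))))

power-^ : ∀ y e → power y e ≡ y ^ e
power-^ y zero    = power-zero y
power-^ y (suc e) = trans (power-suc y e) (trans (*-comm (power y e) y) (cong (y *_) (power-^ y e)))

-- Quasipolynomial bounds on the cost of preprocessing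

module CostBounds (M : RandomizedTM 1) where

  open Setup M

  -- The recurrence doubles at each step and adds at most K.
  odometerCost-≤ : ∀ b N j → j ≤ N → odometerCost b j ≤ 4 ^ j * (b + (8 + loop 1 N))
  odometerCost-≤ b N zero    le = ≤-trans (≤-reflexive (+-comm 3 b))
    (≤-trans (+-monoʳ-≤ b (m≤m+n 3 (5 + loop 1 N))) (≤-reflexive (sym (+-identityʳ _))))
  odometerCost-≤ b N (suc j) le = begin
    c + ((4 + loop 1 j) + (c + 4))            ≡⟨ cong (c +_)
      (trans (sym (+-assoc (4 + loop 1 j) c 4))
        (trans (cong (_+ 4) (+-comm (4 + loop 1 j) c)) (+-assoc c _ 4))) ⟩
    c + (c + (4 + loop 1 j + 4))              ≡⟨ cong (λ z → c + (c + z)) (+-comm (4 + loop 1 j) 4) ⟩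
    c + (c + (8 + loop 1 j))                  ≤⟨ +-mono-≤ ih
      (+-mono-≤ ih (≤-trans (+-monoʳ-≤ 8 (loop-mono 1 (≤-trans (n≤1+n j) le))) K≤X)) ⟩
    -- Three is rounded up to four so that the base is a power of 2, as `Quasipoly-2^` wants it.
    X + (X + X)                               ≤⟨ +-monoʳ-≤ X (+-monoʳ-≤ X (m≤m+n X (X + 0))) ⟩
    4 * X                                     ≡⟨ *-assoc 4 (4 ^ j) (b + K) ⟨
    4 ^ suc j * (b + K)                       ∎
    where
    open ≤-Reasoning
    c = odometerCost b j
    K = 8 + loop 1 N
    X = 4 ^ j * (b + K)
    ih : c ≤ X
    ih = odometerCost-≤ b N j (≤-trans (n≤1+n j) le)
    K≤X : K ≤ X
    K≤X = ≤-trans (m≤n+m K b) (≤-trans (≤-reflexive (sym (*-identityˡ (b + K))))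
      (*-monoˡ-≤ (b + K) (m^n>0 4 j)))

  module _ {k L N : ℕ → ℕ} (pk : Polylog k) (pL : Polylog L) (pN : Polylog N) where

    private
      #_ = Quasipoly-const
      infixr 6 _⊕_
      _⊕_ : Quasipoly f → Quasipoly g → Quasipoly (λ n → f n + g n)
      _⊕_ = Quasipoly-+

    Quasipoly-odometer : Quasipoly f → Polylog g → Quasipoly (λ n → odometerCost (f n) (g n))
    Quasipoly-odometer {f} {g} p q = Quasipoly-≤
      (λ n → ≤-trans (odometerCost-≤ (f n) (g n) (g n) ≤-refl)
        (*-monoˡ-≤ (f n + (8 + loop 1 (g n))) (≤-reflexive (^-*-assoc 2 2 (g n)))))
      (Quasipoly-* (Quasipoly-2^ (Polylog-* (Polylog-const 2) q))
        (p ⊕ (# 8 ⊕ Quasipoly-loop (# 1) (Quasipoly-polylog q))))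

    Quasipoly-sweep : ∀ {h} → Quasipoly f → Quasipoly g → Quasipoly h →
      Quasipoly (λ n → sweepCost (f n) (g n) (h n))
    Quasipoly-sweep p q r = # 1 ⊕ (Quasipoly-loop (p ⊕ # 1) r ⊕ (# 1 ⊕ Quasipoly-loop (q ⊕ # 1) r))

    Quasipoly-drain : Quasipoly f → Quasipoly g → Quasipoly (λ n → drainCost (f n) (g n))
    Quasipoly-drain p q = # 1 ⊕ Quasipoly-loop (p ⊕ # 1) q

    private
      qL = Quasipoly-polylog pL
      qN = Quasipoly-polylog pN
      qk = Quasipoly-polylog pk

    Quasipoly-lookup : Quasipoly (λ n → lookupCost (L n) (N n))
    Quasipoly-lookup = Quasipoly-loop (# 3) qL ⊕
      (# 1 ⊕ (Quasipoly-sweep (# 4 ⊕ Quasipoly-loop (# 2) qL) (# 1) qN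
      ⊕ (# 1 ⊕ (# 1 ⊕ (Quasipoly-loop (# 2) qL ⊕ Quasipoly-drain (# 2) qL)))))

    Quasipoly-trial : Quasipoly (λ n → trialCost (L n) (N n))
    Quasipoly-trial = # 1 ⊕ (Quasipoly-sweep (# 1) (Quasipoly-lookup ⊕ # 2) qL
      ⊕ (# 6 ⊕ ((Quasipoly-sweep (# 1) (# 2) qL ⊕ # 2) ⊕ # 1)))

    Quasipoly-leaf : Quasipoly (λ n → leafCost (L n) (N n))
    Quasipoly-leaf = ((Quasipoly-odometer Quasipoly-trial pL ⊕ # 1) ⊕ (# 1 ⊕ Quasipoly-loop (# 1) qL))
      ⊕ (# 1 ⊕ (# 1 ⊕ Quasipoly-loop (# 2) (Quasipoly-2^ pL)))

    Quasipoly-fold : Quasipoly (λ n → foldCost (N n))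
    Quasipoly-fold = # 1 ⊕ (Quasipoly-loop (# 6) (Quasipoly-2^ pN) ⊕
      (# 1 ⊕ Quasipoly-loop (# 3) (Quasipoly-2^ pN)))

    Quasipoly-evaluate : Quasipoly (λ n → evaluateCost (L n) (N n))
    Quasipoly-evaluate = ((Quasipoly-odometer Quasipoly-leaf pN ⊕ # 1) ⊕ (# 1 ⊕ Quasipoly-loop (# 1) qN))
      ⊕ (Quasipoly-sweep Quasipoly-fold (# 1) qN
      ⊕ (# 1 ⊕ (# 1 ⊕ (# 1 ⊕ Quasipoly-loop (# 2) (Quasipoly-2^ (Polylog-+ (Polylog-const 1) pN))))))

    module _ (B e : ℕ) (L-≡ : ∀ n → L n ≡ power (k n + B) e) where

      private
        py : Polylog (λ n → k n + B)
        py = Polylog-+ pk (Polylog-const B)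
        qy = Quasipoly-polylog py

      Quasipoly-multiplications : ∀ i → Quasipoly (λ n → multiplicationsCost i (k n + B))
      Quasipoly-multiplications zero    = # 1
      Quasipoly-multiplications (suc i) = Quasipoly-multiplications i
        ⊕ (Quasipoly-drain (Quasipoly-sweep (# 1) (# 1) qy) (Quasipoly-polylog (Polylog-power i py))
        ⊕ Quasipoly-drain (# 1) (Quasipoly-polylog (Polylog-* (Polylog-power i py) py)))

      Quasipoly-setup : Quasipoly (λ n → setupCost (k n) B e)
      Quasipoly-setup = # 1 ⊕ (# 1 ⊕ (Quasipoly-loop (# 3) qk ⊕ (Quasipoly-loop (# 3) qk ⊕ (# suc B ⊕ (# 1
        ⊕ (Quasipoly-multiplications e ⊕ Quasipoly-≤
          (λ n → ≤-reflexive (cong layOutCost (sym (L-≡ n)))) lay))))))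
        where
        qlay : Quasipoly (λ n → layCost (L n))
        qlay = Quasipoly-drain (Quasipoly-sweep (# 1) (# 1) qL ⊕ # 1) qL
        lay : Quasipoly (λ n → layOutCost (L n))
        lay = # 1 ⊕ (# 1 ⊕ (Quasipoly-drain (# 3) qL ⊕ (qlay ⊕ (# 1 ⊕ qlay))))

length-rounds : ∀ L κ α m κs → length (Game.rounds L κ α m κs) ≡ m * suc L + length κs
length-rounds L κ α zero    κs = refl
length-rounds L κ α (suc m) κs = trans (List.length-++ (replicate L κ))
  (trans (cong₂ _+_ (List.length-replicate L) (cong suc (length-rounds L κ α m κs)))
  (trans (+-suc L _) (cong suc (sym (+-assoc L (m * suc L) (length κs))))))

module _ {L : ℕ → ℕ} (pL : Polylog L) where

  Polylog-rounds : ∀ {κ α} → Polylog (λ n → length (Game.rounds (L n) κ α (L n) []))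
  Polylog-rounds {κ} {α} = Polylog-≤ (λ n → ≤-reflexive (length-rounds (L n) κ α (L n) []))
    (Polylog-+ (Polylog-* pL (Polylog-+ (Polylog-const 1) pL)) (Polylog-const 0))

  Polylog-schedule : Polylog (λ n → length (Game.schedule (L n)))
  Polylog-schedule = Polylog-≤ (λ n →
    ≤-reflexive (length-rounds (L n) exists query (L n) (pivot ∷ Game.universal (L n) (L n))))
    (Polylog-+ (Polylog-* pL (Polylog-+ (Polylog-const 1) pL)) (Polylog-+ (Polylog-const 1) Polylog-rounds))

  Polylog-follow : Polylog (λ n → Follower.followCost (L n))
  Polylog-follow = Polylog-+ (Polylog-const 1) (Polylog-+
    (Polylog-loop round (Polylog-+ (Polylog-const 2) Polylog-rounds)) (Polylog-const 1))
    where
    pℓ : Polylog (λ n → length (Game.rounds (L n) exists query (L n) []) + 1)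
    pℓ = Polylog-+ Polylog-rounds (Polylog-const 1)
    round : Polylog (λ n → Follower.roundCost (length (Game.rounds (L n) exists query (L n) []) + 1))
    round = Polylog-+ (Polylog-+ (Polylog-const 1)
      (Polylog-+ (Polylog-loop (Polylog-const 3) pℓ) (Polylog-const 2)))
      (Polylog-+ (Polylog-const 5) (Polylog-+
        (Polylog-+ (Polylog-const 3) (Polylog-loop (Polylog-const 4) pℓ)) (Polylog-const 2)))


-- Choice of the parameters and assembly of the two machines

module Derandomized {ℓ : Level} (L : Language ℓ) (M : RandomizedTM 1) (T : ℕ → ℕ) (c n₀ : ℕ)
  (T-polylog : ∀ n → n₀ ≤ n → T n ≤ ⌊log₂ n ⌋ ^ c) (D : DecidesRandomized M T L) where

  open Derandomization M

  -- Dominates the finitely many running times below `n₀`, where the polylogarithmic bound says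
  -- nothing.
  sumBelow : ℕ → ℕ
  sumBelow zero    = 0
  sumBelow (suc m) = T m + sumBelow m

  ≤-sumBelow : ∀ m n → n < m → T n ≤ sumBelow m
  ≤-sumBelow (suc m) n (s≤s le) with m≤n⇒m<n∨m≡n le
  ... | inj₁ lt   = ≤-trans (≤-sumBelow m n lt) (m≤n+m _ (T m))
  ... | inj₂ refl = m≤m+n (T n) _

  -- With `y = digits n + B`, the summands of `B` give `y ≥ 2` and `y ≥ T n` for `n < n₀`, so that
  -- `T n ≤ y ^ (c + 1)` for every `n`. Then `3 * T n ≤ y * y * y ^ (c + 1) = y ^ d`. The tree has
  -- depth `suc C * C` with `C ≤ y ^ (d + d)` and `suc C ≤ y * y ^ (d + d)`, which adds up to the
  -- exponent `e`.
  B d e : ℕ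
  B = 2 + sumBelow n₀
  d = 3 + c
  e = suc ((d + d) + (d + d))

  base-size size : ℕ → ℕ
  base-size n = digits n + B
  size n      = power (base-size n) e

  module Sizes (n : ℕ) where

    y = base-size n

    2≤y : 2 ≤ y
    2≤y = ≤-trans (m≤m+n 2 (sumBelow n₀)) (m≤n+m B (digits n))

    instance
      y≢0 : NonZero y
      y≢0 = >-nonZero (≤-trans (s≤s z≤n) 2≤y)

    y≤y^ : ∀ i → y ≤ y ^ suc i
    y≤y^ i = ≤-trans (≤-reflexive (sym (^-identityʳ y))) (^-monoʳ-≤ y {1} {suc i} (s≤s z≤n))

    T-≤ : T n ≤ y ^ suc c
    T-≤ with n <? n₀
    ... | yes lt = ≤-trans (≤-sumBelow n₀ n lt) (≤-trans (m≤n+m _ 2) (≤-trans (m≤n+m B (digits n)) (y≤y^ c)))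
    ... | no ge  = ≤-trans (T-polylog n (≮⇒≥ ge))
      (≤-trans (^-monoˡ-≤ c (≤-trans (log-≤-digits n) (m≤m+n (digits n) B)))
                     (^-monoʳ-≤ y (n≤1+n c)))

    size-≡ : size n ≡ y ^ e
    size-≡ = power-^ y e

    enough : T n ≤ size n
    enough = ≤-trans T-≤ (≤-trans (^-monoʳ-≤ y
      (s≤s (≤-trans (m≤n+m c 3) (≤-trans (m≤m+n d d) (m≤m+n (d + d) (d + d))))))
      (≤-reflexive (sym size-≡)))

    n≤2^size : n ≤ 2 ^ size n
    n≤2^size = ≤-trans (<⇒≤ (digits-above n)) (^-monoʳ-≤ 2 (≤-trans (m≤m+n (digits n) B)
      (≤-trans (y≤y^ ((d + d) + (d + d))) (≤-reflexive (sym size-≡)))))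

    deep : suc (3 * T n * (3 * T n)) * (3 * T n * (3 * T n)) ≤ size n
    deep = begin
      suc C * C                                ≤⟨ *-mono-≤ suc-C≤ C≤ ⟩
      (y * (W * W)) * (W * W)                  ≡⟨ *-assoc y (W * W) (W * W) ⟩
      y * ((W * W) * (W * W))                  ≡⟨ cong (λ z → y * (z * z)) (^-distribˡ-+-* y d d) ⟨
      y * (y ^ (d + d) * y ^ (d + d))          ≡⟨ cong (y *_) (^-distribˡ-+-* y (d + d) (d + d)) ⟨
      y ^ e                                    ≡⟨ size-≡ ⟨
      size n                                   ∎
      where
      open ≤-Reasoning
      C = 3 * T n * (3 * T n)
      W = y ^ d
      3T≤W : 3 * T n ≤ W
      3T≤W = ≤-trans (*-mono-≤ (≤-trans (n≤1+n 3) (*-mono-≤ 2≤y 2≤y)) T-≤)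
        (≤-reflexive (*-assoc y y (y ^ suc c)))
      C≤ : C ≤ W * W
      C≤ = *-mono-≤ 3T≤W 3T≤W
      suc-C≤ : suc C ≤ y * (W * W)
      suc-C≤ = ≤-trans (+-mono-≤ (*-mono-≤ (m^n>0 y d) (m^n>0 y d))
        (≤-trans C≤ (≤-reflexive (sym (+-identityʳ (W * W))))))
                       (*-monoˡ-≤ (W * W) 2≤y)

  module Input (n : ℕ) where

    open Decision D n (size n) (Sizes.enough n) public
    open Advised (Sizes.n≤2^size n) (Sizes.deep n) public

  advice : ℕ → List Bool
  advice n = Input.advice n

  levelCount : ℕ → ℕ
  levelCount n = length (Game.schedule (size n))

  Polylog-size : Polylog size
  Polylog-size = Polylog-power e (Polylog-+ Polylog-digits (Polylog-const B))

  opaque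

    program : Cmd
    program = setup B e ⨟ evaluate-game

    follow : Follower.Cmd
    follow = Follower.program

  halted-well : Reads → Scan → Bool
  halted-well _ _ = true

  preprocessing : DeterministicTM 1
  preprocessing = compile program Finite-Mark halted-well

  opaque

    preprocessingTime followTime : ℕ → ℕ
    preprocessingTime n = suc (setupCost (digits n) B e + evaluateCost (size n) (levelCount n))
    followTime n        = suc (Follower.followCost (size n))

    preprocessingTime-≡ : ∀ n → preprocessingTime n ≡ 1
      + (setupCost (digits n) B e + evaluateCost (size n) (levelCount n))
    preprocessingTime-≡ n = refl

    followTime-≡ : ∀ n → followTime n ≡ 1 + Follower.followCost (size n)
    followTime-≡ n = refl

  Quasipoly-preprocessingTime : Quasipoly preprocessingTime
  Quasipoly-preprocessingTime = Quasipoly-≤ (λ n → ≤-reflexive (preprocessingTime-≡ n))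
    (Quasipoly-+ (Quasipoly-const 1) (Quasipoly-+
    (CostBounds.Quasipoly-setup M Polylog-digits Polylog-size (Polylog-schedule Polylog-size) B e (λ _ → refl))
    (CostBounds.Quasipoly-evaluate M Polylog-digits Polylog-size (Polylog-schedule Polylog-size))))

  module Preprocessing (n : ℕ) where

    open SetupRuns n
    open Input n using (input; faithful)

    start = setup-run B e
    finished = evaluate-run (size n) (Game.schedule (size n)) input faithful (proj₁ start)

    opaque

      unfolding program

      whole : Exec program (Vec.replicate k blankTape) (vec (proj₁ finished))
                   (setupCost (digits n) B e + evaluateCost (size n) (levelCount n))
      whole = proj₂ start ⨟⇓ proj₂ (proj₂ finished)

    ends : Correctness.Ends (replicate n true ∷ []) program Finite-Mark halted-well
             (vec (proj₁ finished)) (runFor preprocessing (preprocessingTime n) (replicate n true ∷ []))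
    ends = Correctness.compile-correct (replicate n true ∷ []) program Finite-Mark halted-well
      whole (preprocessingTime n) (≤-reflexive (sym (preprocessingTime-≡ n)))

    contents-bits : ∀ bs → contents (stack (map bit (bs ʳ++ []))) ≡ bs
    contents-bits bs = trans (cong leadingBits
      (trans (cong (_ʳ++ (blank ∷ [])) (List.map-ʳ++ bit bs)) (List.ʳ++-ʳ++ (map bit bs))))
                             (leading bs)
      where
      leading : ∀ bs → leadingBits {A = Mark} (map bit bs ++ blank ∷ []) ≡ bs
      leading []       = refl
      leading (b ∷ bs) = cong (b ∷_) (leading bs)

    output-correct : Machine.output preprocessing
      (runFor preprocessing (preprocessingTime n) (replicate n true ∷ [])) ≡ advice n
    output-correct = trans
      (Correctness.output-≡ (replicate n true ∷ []) program Finite-Mark halted-well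
        (runFor preprocessing (preprocessingTime n) (replicate n true ∷ [])))
      (trans (cong (λ ts → contents (Vec.head (Vec.drop 1 ts))) (Correctness.Ends.tapes-≡ ends))
      (trans (cong contents (proj₁ (proj₂ finished))) (contents-bits (advice n))))

  to-Is-just : ∀ {b : Bool} {v : Maybe Bool} → v ≡ just b → Is-just v
  to-Is-just refl = MaybeAny.just tt

  preprocesses : Preprocesses preprocessing preprocessingTime advice
  preprocesses = record
    { halts   = λ n → to-Is-just (Correctness.Ends.verdict-≡ (Preprocessing.ends n))
    ; outputs = Preprocessing.output-correct
    }

  follower : DeterministicTM 2
  follower = Follower.compile follow Follower.Finite-Mark Follower.accepting

  module Following (x : List Bool) where

    n = length x
    v = Vec.fromList x

    open Input n using (majorityOf; tree; tree-correct)
    open Follower.Walk (size n) (Sizes.n≤2^size n) majorityOf tree tree-correct v using (program-run)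
    open Decided D

    solved : Answer x (size n)
    solved = answer-of x (size n) (Sizes.enough n)

    opaque

      unfolding follow

      followed-program : Follower.Semantics.Exec (Vec.toList v ∷ advice n ∷ []) follow
        (Vec.replicate 5 blankTape)
        (Follower.store blankTape blankTape
          (Follower.leftward ((pivot , majorityOf v) ∷ proj₁ program-run) []) Follower.mark)
        (Follower.followCost (size n))
      followed-program = proj₂ program-run

    verdict-≡ : Machine.verdict follower (runFor follower (followTime n) (x ∷ advice n ∷ []))
      ≡ just (Answer.value-≡ solved)
    verdict-≡ = trans (subst (λ x′ →
      Machine.verdict follower (runFor follower (followTime n) (x′ ∷ advice n ∷ [])) ≡ just (majorityOf v))
                        (Vec.toList∘fromList x) followed)
                      (cong just (trans (cong (λ x′ → majority x′ (replicate (size n) toss))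
                        (Vec.toList∘fromList x)) (Answer.majority-≡ solved)))
      where
      followed : Machine.verdict follower (runFor follower (followTime n) (Vec.toList v ∷ advice n ∷ []))
        ≡ just (majorityOf v)
      followed = Follower.Correctness.Ends.verdict-≡
        (Follower.Correctness.compile-correct (Vec.toList v ∷ advice n ∷ [])
        follow Follower.Finite-Mark Follower.accepting followed-program (followTime n)
          (≤-reflexive (sym (followTime-≡ n))))

  decides : DecidesWithAdvice follower followTime advice L
  decides = record
    { halts   = λ x → to-Is-just (Following.verdict-≡ x)
    ; accepts = λ x x∈L → trans (Following.verdict-≡ x)
      (cong just (Decided.Answer.inside (Following.solved x) x∈L))
    ; rejects = λ x x∉L → trans (Following.verdict-≡ x)
      (cong just (Decided.Answer.outside (Following.solved x) x∉L))
    }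

corollary2p2 : ∀ {ℓ : Level} (L : Language ℓ) →
    PolylogRandomized L → PolylogWithQuasipolyPreprocessing L
corollary2p2 L (M , T , (c , n₀ , T-polylog) , D) =
  preprocessing , follower , preprocessingTime , followTime , advice ,
  Quasipoly-preprocessingTime , preprocesses ,
  Polylog-≤ (λ n → ≤-reflexive (followTime-≡ n))
    (Polylog-+ (Polylog-const 1) (Polylog-follow Polylog-size)) , decides
  where open Derandomized L M T c n₀ T-polylog D
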